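{- Let $G_1$ and $H_1$ be cospectral regular graphs, and let $G_2$ and $H_2$ be non-isomorphic, regular and cospectral graphs. Then $G_1\underset{=}{\vee}G_2$ and $H_1\underset{=}{\vee}H_2$ are non-regular and $\{A,L,Q,\mathcal L\}$NICS.
   Context: Graphs are finite, undirected and simple. $A(G)$ is the adjacency matrix, $D(G)$ the diagonal degree matrix, $L(G)=D(G)-A(G)$ the Laplacian, $Q(G)=D(G)+A(G)$ the signless Laplacian, and $\mathcal L(G)=I-D(G)^{ -1/2}A(G)D(G)^{ -1/2}$ the normalized Laplacian (with the convention that for a vertex of degree $0$ one sets $d_i^{ -1/2}=0$ and the corresponding diagonal entry of $\mathcal L(G)$ is $0$). For $X\in\{A,L,Q,\mathcal L\}$ two graphs are $X$-cospectral if $X(\cdot)$ has the same eigenvalues with multiplicities for both. For $S\subseteq\{A,L,Q,\mathcal L\}$, two graphs are $S$NICS if they are non-isomorphic and $X$-cospectral for every $X\in S$. Two regular graphs are called cospectral if they are $X$-cospectral for any (equivalently, all) $X\in\{A,L,Q,\mathcal L\}$. For vertex-disjoint graphs $G_1$ (with $V(G_1)=\{u_1,\dots,u_{n_1}\}$) and $G_2$, the join $G_1\vee G_2$ is the disjoint union together with all edges between $V(G_1)$ and $V(G_2)$. The NNS (Non Neighbors Splitting) join $G_1\underset{=}{\vee}G_2$ is obtained from $G_1\vee G_2$ by adding new vertices $u_1',\dots,u_{n_1}'$ and joining $u_i'$ to $u_j$ if and only if $i\ne j$ and $u_iu_j\notin E(G_1)$. -}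

module Defs where

open import Algebra.Bundles using (CommutativeRing; Semiring)
open import Algebra.Core using (Op₁; Op₂)
import Algebra.Definitions.RawSemiring as RawSemiringOps
import Algebra.Properties.Ring as RingProperties
import Algebra.Solver.Ring.NaturalCoefficients.Default as SemiringSolver
open import Data.Bool.Base using (Bool; true; false; not; _∧_; if_then_else_)
open import Data.Fin.Base using (Fin; zero; suc; toℕ; punchIn; splitAt)
open import Data.Fin.Properties using (_≟_)
open import Data.Fin.Subset using (∣_∣)
open import Data.List.Base using (List; foldr)
open import Data.List.Membership.Propositional using (_∈_)
open import Data.Nat.Base as ℕ using (ℕ; zero; suc)
open import Data.Product.Base using (Σ; ∃; _×_; _,_)
open import Data.Sum.Base using (_⊎_; inj₁; inj₂)
open import Data.Vec.Base using (tabulate)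
open import Data.Vec.Functional using (Vector)
open import Function.Bundles using (_↔_; Inverse)
open import Level using (_⊔_) renaming (suc to lsuc)
open import Relation.Binary.Core using (Rel)
open import Relation.Binary.PropositionalEquality.Core as ≡ using (_≡_)
import Relation.Binary.Reasoning.Setoid as SetoidReasoning
open import Relation.Binary.Structures using (IsDecTotalOrder)
open import Relation.Nullary using (¬_; does)

------------------------------------------------------------------------
-- Graphs

record Graph (n : ℕ) : Set where
  field
    adj        : Fin n → Fin n → Bool
    adj-sym    : ∀ i j → adj i j ≡ adj j i
    adj-irrefl : ∀ i → adj i i ≡ false

open Graph public

degree : ∀ {n} → Graph n → Fin n → ℕ
degree G i = ∣ tabulate (adj G i) ∣

Regular : ∀ {n} → Graph n → Set
Regular G = ∃ λ r → ∀ i → degree G i ≡ r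

infix 4 _≅_

_≅_ : ∀ {n m} → Graph n → Graph m → Set
_≅_ {n} {m} G H = Σ (Fin n ↔ Fin m) λ φ →
  ∀ i j → adj G i j ≡ adj H (Inverse.to φ i) (Inverse.to φ j)

nonNeighbour : ∀ {n} → Graph n → Fin n → Fin n → Bool
nonNeighbour G i j = not (does (i ≟ j)) ∧ not (adj G i j)

infixr 6 _∨_ _∨₌_

_∨_ : ∀ {n m} → Graph n → Graph m → Graph (n ℕ.+ m)
_∨_ {n} {m} G H = record
  { adj        = λ v w → E (splitAt n v) (splitAt n w)
  ; adj-sym    = λ v w → E-sym (splitAt n v) (splitAt n w)
  ; adj-irrefl = λ v → E-irrefl (splitAt n v)
  }
  where
  E : Fin n ⊎ Fin m → Fin n ⊎ Fin m → Bool
  E (inj₁ i) (inj₁ j) = adj G i j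
  E (inj₁ i) (inj₂ l) = true
  E (inj₂ k) (inj₁ j) = true
  E (inj₂ k) (inj₂ l) = adj H k l

  E-sym : ∀ v w → E v w ≡ E w v
  E-sym (inj₁ i) (inj₁ j) = adj-sym G i j
  E-sym (inj₁ i) (inj₂ l) = ≡.refl
  E-sym (inj₂ k) (inj₁ j) = ≡.refl
  E-sym (inj₂ k) (inj₂ l) = adj-sym H k l

  E-irrefl : ∀ v → E v v ≡ false
  E-irrefl (inj₁ i) = adj-irrefl G i
  E-irrefl (inj₂ k) = adj-irrefl H k

-- The NNS join.  The first n + m vertices are those of G ∨ H, and the
-- last n are the added vertices u′₁, …, u′ₙ.
_∨₌_ : ∀ {n m} → Graph n → Graph m → Graph ((n ℕ.+ m) ℕ.+ n)
_∨₌_ {n} {m} G H = record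
  { adj        = λ v w → E (splitAt (n ℕ.+ m) v) (splitAt (n ℕ.+ m) w)
  ; adj-sym    = λ v w → E-sym (splitAt (n ℕ.+ m) v) (splitAt (n ℕ.+ m) w)
  ; adj-irrefl = λ v → E-irrefl (splitAt (n ℕ.+ m) v)
  }
  where
  new-old : Fin n → Fin n ⊎ Fin m → Bool
  new-old i (inj₁ j) = nonNeighbour G i j
  new-old i (inj₂ l) = false

  E : Fin (n ℕ.+ m) ⊎ Fin n → Fin (n ℕ.+ m) ⊎ Fin n → Bool
  E (inj₁ v) (inj₁ w) = adj (G ∨ H) v w
  E (inj₁ v) (inj₂ i) = new-old i (splitAt n v)
  E (inj₂ i) (inj₁ w) = new-old i (splitAt n w)
  E (inj₂ i) (inj₂ j) = false

  E-sym : ∀ v w → E v w ≡ E w v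
  E-sym (inj₁ v) (inj₁ w) = adj-sym (G ∨ H) v w
  E-sym (inj₁ v) (inj₂ i) = ≡.refl
  E-sym (inj₂ i) (inj₁ w) = ≡.refl
  E-sym (inj₂ i) (inj₂ j) = ≡.refl

  E-irrefl : ∀ v → E v v ≡ false
  E-irrefl (inj₁ v) = adj-irrefl (G ∨ H) v
  E-irrefl (inj₂ i) = ≡.refl

------------------------------------------------------------------------
-- Matrices, determinants and spectra over a commutative ring

module Matrices {c ℓ} (K : CommutativeRing c ℓ) where

  open CommutativeRing K hiding (zero)
  open RawSemiringOps (Semiring.rawSemiring semiring) public
    using (sum; _^_) renaming (_×_ to _·_)

  fromℕ : ℕ → Carrier
  fromℕ n = n · 1#

  Matrix : ℕ → Set c
  Matrix n = Fin n → Fin n → Carrier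

  infixl 6 _+ᴹ_ _-ᴹ_
  infixl 7 _*ᴹ_

  _+ᴹ_ _-ᴹ_ _*ᴹ_ : ∀ {n} → Matrix n → Matrix n → Matrix n
  (M +ᴹ N) i j = M i j + N i j
  (M -ᴹ N) i j = M i j - N i j
  (M *ᴹ N) i j = sum λ k → M i k * N k j

  diag : ∀ {n} → Vector Carrier n → Matrix n
  diag d i j = if does (i ≟ j) then d i else 0#

  -- Laplace expansion along the first row.
  det : ∀ {n} → Matrix n → Carrier
  det {zero}  M = 1#
  det {suc n} M = sum λ j →
    (- 1#) ^ toℕ j * M zero j * det (λ i k → M (suc i) (punchIn j k))

  -- The characteristic polynomial det(xI − M), as a function of x.
  charPoly : ∀ {n} → Matrix n → Carrier → Carrier
  charPoly M x = det (diag (λ _ → x) -ᴹ M)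

  -- λs lists the eigenvalues of M with (algebraic) multiplicities:
  -- det(xI − M) = ∏ (x − λ).  Over an infinite field, which is the only
  -- case used below, equality for all x is equality of polynomials; in
  -- particular it determines λs up to order and forces it to have
  -- length n.
  IsSpectrum : ∀ {n} → Matrix n → List Carrier → Set (c ⊔ ℓ)
  IsSpectrum M λs = ∀ x → charPoly M x ≈ foldr (λ e p → (x - e) * p) 1# λs

  -- Every monic polynomial x^(n+1) + aₙ xⁿ + … + a₀ has a root.
  AlgebraicallyClosed : Set (c ⊔ ℓ)
  AlgebraicallyClosed = ∀ n (a : Vector Carrier (suc n)) →
    ∃ λ z → z ^ suc n + sum (λ i → a i * z ^ toℕ i) ≈ 0#

------------------------------------------------------------------------
-- The ring K[i], with (a , b) standing for a + bi

module Complexification {c ℓ} (K : CommutativeRing c ℓ) where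

  open CommutativeRing K
  open RingProperties ring using (-1*x≈-x; -0#≈0#)
  open SemiringSolver commutativeSemiring using (solve; _:*_; _:+_; _:=_)
  open SetoidReasoning setoid

  private
    -- Writing - x as n * x with n = - 1# turns the ring laws of K[i]
    -- into semiring identities.
    n : Carrier
    n = - 1#

    neg : ∀ x → - x ≈ n * x
    neg x = sym (-1*x≈-x x)

    assoc-re : ∀ a b c d e f →
      (a * c - b * d) * e - (a * d + b * c) * f ≈
      a * (c * e - d * f) - b * (c * f + d * e)
    assoc-re a b c d e f = begin
      (a * c - b * d) * e - (a * d + b * c) * f
        ≈⟨ +-cong (*-congʳ (+-congˡ (neg _))) (neg _) ⟩
      (a * c + n * (b * d)) * e + n * ((a * d + b * c) * f)
        ≈⟨ solve 7 (λ a b c d e f n →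
             (a :* c :+ n :* (b :* d)) :* e :+ n :* ((a :* d :+ b :* c) :* f) :=
             a :* (c :* e :+ n :* (d :* f)) :+ n :* (b :* (c :* f :+ d :* e)))
             refl a b c d e f n ⟩
      a * (c * e + n * (d * f)) + n * (b * (c * f + d * e))
        ≈⟨ +-cong (*-congˡ (+-congˡ (neg _))) (neg _) ⟨
      a * (c * e - d * f) - b * (c * f + d * e) ∎

    assoc-im : ∀ a b c d e f →
      (a * c - b * d) * f + (a * d + b * c) * e ≈
      a * (c * f + d * e) + b * (c * e - d * f)
    assoc-im a b c d e f = begin
      (a * c - b * d) * f + (a * d + b * c) * e
        ≈⟨ +-congʳ (*-congʳ (+-congˡ (neg _))) ⟩
      (a * c + n * (b * d)) * f + (a * d + b * c) * e
        ≈⟨ solve 7 (λ a b c d e f n →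
             (a :* c :+ n :* (b :* d)) :* f :+ (a :* d :+ b :* c) :* e :=
             a :* (c :* f :+ d :* e) :+ b :* (c :* e :+ n :* (d :* f)))
             refl a b c d e f n ⟩
      a * (c * f + d * e) + b * (c * e + n * (d * f))
        ≈⟨ +-congˡ (*-congˡ (+-congˡ (neg _))) ⟨
      a * (c * f + d * e) + b * (c * e - d * f) ∎

    distribˡ-re : ∀ a b c d e f →
      a * (c + e) - b * (d + f) ≈ (a * c - b * d) + (a * e - b * f)
    distribˡ-re a b c d e f = begin
      a * (c + e) - b * (d + f)
        ≈⟨ +-congˡ (neg _) ⟩
      a * (c + e) + n * (b * (d + f))
        ≈⟨ solve 7 (λ a b c d e f n →
             a :* (c :+ e) :+ n :* (b :* (d :+ f)) :=
             (a :* c :+ n :* (b :* d)) :+ (a :* e :+ n :* (b :* f)))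
             refl a b c d e f n ⟩
      (a * c + n * (b * d)) + (a * e + n * (b * f))
        ≈⟨ +-cong (+-congˡ (neg _)) (+-congˡ (neg _)) ⟨
      (a * c - b * d) + (a * e - b * f) ∎

    distribˡ-im : ∀ a b c d e f →
      a * (d + f) + b * (c + e) ≈ (a * d + b * c) + (a * f + b * e)
    distribˡ-im = solve 6 (λ a b c d e f →
      a :* (d :+ f) :+ b :* (c :+ e) := (a :* d :+ b :* c) :+ (a :* f :+ b :* e))
      refl

    comm-re : ∀ a b c d → a * c - b * d ≈ c * a - d * b
    comm-re a b c d = +-cong (*-comm a c) (-‿cong (*-comm b d))

    comm-im : ∀ a b c d → a * d + b * c ≈ c * b + d * a
    comm-im a b c d = trans (+-comm _ _) (+-cong (*-comm b c) (*-comm a d))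

    identityˡ-re : ∀ a b → 1# * a - 0# * b ≈ a
    identityˡ-re a b = begin
      1# * a - 0# * b  ≈⟨ +-cong (*-identityˡ a) (-‿cong (zeroˡ b)) ⟩
      a - 0#           ≈⟨ +-congˡ -0#≈0# ⟩
      a + 0#           ≈⟨ +-identityʳ a ⟩
      a                ∎

    identityˡ-im : ∀ a b → 1# * b + 0# * a ≈ b
    identityˡ-im a b = trans (+-cong (*-identityˡ b) (zeroˡ a)) (+-identityʳ b)

  infix  4 _≈ᶜ_
  infixl 6 _+ᶜ_
  infixl 7 _*ᶜ_

  _≈ᶜ_ : Rel (Carrier × Carrier) ℓ
  (a , b) ≈ᶜ (c , d) = (a ≈ c) × (b ≈ d)

  _+ᶜ_ _*ᶜ_ : Op₂ (Carrier × Carrier)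
  (a , b) +ᶜ (c , d) = (a + c) , (b + d)
  (a , b) *ᶜ (c , d) = (a * c - b * d) , (a * d + b * c)

  -ᶜ_ : Op₁ (Carrier × Carrier)
  -ᶜ (a , b) = (- a) , (- b)

  real : Carrier → Carrier × Carrier
  real a = a , 0#

  complexRing : CommutativeRing c ℓ
  complexRing = record
    { Carrier = Carrier × Carrier
    ; _≈_ = _≈ᶜ_
    ; _+_ = _+ᶜ_
    ; _*_ = _*ᶜ_
    ; -_  = -ᶜ_
    ; 0#  = real 0#
    ; 1#  = real 1#
    ; isCommutativeRing = record
      { isRing = record
        { +-isAbelianGroup = record
          { isGroup = record
            { isMonoid = record
              { isSemigroup = record
                { isMagma = record
                  { isEquivalence = record
                    { refl  = refl , refl
                    ; sym   = λ { (p , q) → sym p , sym q }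
                    ; trans = λ { (p , q) (r , s) → trans p r , trans q s }
                    }
                  ; ∙-cong = λ { (p , q) (r , s) → +-cong p r , +-cong q s }
                  }
                ; assoc = λ { (a , b) (c , d) (e , f) →
                    +-assoc a c e , +-assoc b d f }
                }
              ; identity = (λ { (a , b) → +-identityˡ a , +-identityˡ b })
                         , (λ { (a , b) → +-identityʳ a , +-identityʳ b })
              }
            ; inverse = (λ { (a , b) → -‿inverseˡ a , -‿inverseˡ b })
                      , (λ { (a , b) → -‿inverseʳ a , -‿inverseʳ b })
            ; ⁻¹-cong = λ { (p , q) → -‿cong p , -‿cong q }
            }
          ; comm = λ { (a , b) (c , d) → +-comm a c , +-comm b d }
          }
        ; *-cong = λ { (p , q) (r , s) →
            +-cong (*-cong p r) (-‿cong (*-cong q s)) ,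
            +-cong (*-cong p s) (*-cong q r) }
        ; *-assoc = λ { (a , b) (c , d) (e , f) →
            assoc-re a b c d e f , assoc-im a b c d e f }
        ; *-identity =
            (λ { (a , b) → identityˡ-re a b , identityˡ-im a b }) ,
            (λ { (a , b) → trans (comm-re a b _ _) (identityˡ-re a b) ,
                           trans (comm-im a b _ _) (identityˡ-im a b) })
        ; distrib =
            (λ { (a , b) (c , d) (e , f) →
               distribˡ-re a b c d e f , distribˡ-im a b c d e f }) ,
            (λ { (a , b) (c , d) (e , f) →
               trans (comm-re _ _ a b) (trans (distribˡ-re a b c d e f)
                 (+-cong (comm-re a b c d) (comm-re a b e f))) ,
               trans (comm-im _ _ a b) (trans (distribˡ-im a b c d e f)
                 (+-cong (comm-im a b c d) (comm-im a b e f))) })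
        }
      ; *-comm = λ { (a , b) (c , d) → comm-re a b c d , comm-im a b c d }
      }
    }

------------------------------------------------------------------------
-- The real numbers

-- The standard library has no real numbers.  They enter only as a real
-- closed field: an ordered field ℝ for which ℂ = ℝ[i] is algebraically
-- closed.  The operations _⁻¹ and √ are total, but nothing is assumed
-- about their values outside the usual domain.
record RealClosedField c ℓ₁ ℓ₂ : Set (lsuc (c ⊔ ℓ₁ ⊔ ℓ₂)) where
  infix 4 _≤_
  infix 9 _⁻¹ √_
  field
    commutativeRing : CommutativeRing c ℓ₁
  open CommutativeRing commutativeRing
  field
    _≤_             : Rel Carrier ℓ₂
    isDecTotalOrder : IsDecTotalOrder _≈_ _≤_
    +-mono-≤        : ∀ {x y} z → x ≤ y → x + z ≤ y + z
    *-nonneg        : ∀ {x y} → 0# ≤ x → 0# ≤ y → 0# ≤ x * y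
    0≉1             : ¬ 0# ≈ 1#
    _⁻¹             : Op₁ Carrier
    *-inverseʳ      : ∀ x → ¬ x ≈ 0# → x * x ⁻¹ ≈ 1#
    √_              : Op₁ Carrier
    √-nonneg        : ∀ x → 0# ≤ x → 0# ≤ √ x
    √-square        : ∀ x → 0# ≤ x → √ x * √ x ≈ x
    ℂ-closed        : Matrices.AlgebraicallyClosed
                        (Complexification.complexRing commutativeRing)

------------------------------------------------------------------------
-- Graph matrices and cospectrality

data MatrixKind : Set where
  𝐀 𝐋 𝐐 𝓛 : MatrixKind

module Spectral {c ℓ₁ ℓ₂} (R : RealClosedField c ℓ₁ ℓ₂) where

  open RealClosedField R using (commutativeRing; _⁻¹; √_)
  open CommutativeRing commutativeRing using (Carrier; 0#; 1#)
  open Matrices commutativeRing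
  open Complexification commutativeRing using (complexRing; real)
  module ℂ where
    open CommutativeRing complexRing public using (Carrier)
    open Matrices complexRing public

  adjacency : ∀ {n} → Graph n → Matrix n
  adjacency G i j = if adj G i j then 1# else 0#

  degreeMatrix : ∀ {n} → Graph n → Matrix n
  degreeMatrix G = diag λ i → fromℕ (degree G i)

  -- d ↦ d^(-1/2), with value 0 at d = 0.
  invSqrt : ℕ → Carrier
  invSqrt zero    = 0#
  invSqrt (suc d) = (√ fromℕ (suc d)) ⁻¹

  -- The identity matrix, except that diagonal entries at isolated
  -- vertices are 0.
  supportIdentity : ∀ {n} → Graph n → Matrix n
  supportIdentity G = diag λ i → entry (degree G i)
    where
    entry : ℕ → Carrier
    entry zero    = 0#
    entry (suc d) = 1#

  matrix : MatrixKind → ∀ {n} → Graph n → Matrix n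
  matrix 𝐀 G = adjacency G
  matrix 𝐋 G = degreeMatrix G -ᴹ adjacency G
  matrix 𝐐 G = degreeMatrix G +ᴹ adjacency G
  matrix 𝓛 G = supportIdentity G -ᴹ D^-½ *ᴹ adjacency G *ᴹ D^-½
    where
    D^-½ = diag λ i → invSqrt (degree G i)

  IsSpectrumOf : MatrixKind → ∀ {n} → Graph n → List ℂ.Carrier → Set (c ⊔ ℓ₁)
  IsSpectrumOf X G = ℂ.IsSpectrum λ i j → real (matrix X G i j)

  Cospectral : MatrixKind → ∀ {n m} → Graph n → Graph m → Set (c ⊔ ℓ₁)
  Cospectral X G H = ∃ λ λs → IsSpectrumOf X G λs × IsSpectrumOf X H λs

  -- For regular graphs, cospectrality for some kind of matrix is
  -- equivalent to cospectrality for all four.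
  RegularCospectral : ∀ {n m} → Graph n → Graph m → Set (c ⊔ ℓ₁)
  RegularCospectral G H =
    Regular G × Regular H × ∃ λ X → Cospectral X G H

  NICS : List MatrixKind → ∀ {n m} → Graph n → Graph m → Set (c ⊔ ℓ₁)
  NICS S G H = ¬ G ≅ H × (∀ X → X ∈ S → Cospectral X G H)

{-# OPTIONS --safe #-}

-- With C = J − I − A, each of the four matrices X of G ∨₌ H satisfies
--
--              ⎛ p + qA   γJ       δC ⎞
--     x − X =  ⎜ γJ       a + bB   0  ⎟
--              ⎝ δC       0        α  ⎠
--
-- where A and B are the adjacency matrices of G and H and the scalars
-- depend only on x and the degrees.  For α ≠ 0 the Schur complement
-- removes the last block row.  Since AJ = JA = rJ, it replaces p + qA by
-- P(A) + σJ with P quadratic, and for generic x the terms containing J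
-- can be split off as a factor that depends on A and B only through
-- their sizes and row sums.  Hence det(x − X) = det P(A) · det(a + bB) ·
-- (common factor) off a finite set, and factoring P over ℂ expresses it
-- by the characteristic polynomials of A and B; being polynomial in x,
-- the determinants for two cospectral pairs agree everywhere.
--
-- For a regular graph X = a + bA, so tr X = na and tr X² = n(a² + b²r)
-- recover the degree r, and then the spectrum of A, from that of X.
--
-- In G ∨₌ H the old vertices of H are told apart by their degree unless
-- H is complete, so an isomorphism of joins restricts to them.

module Submission where

open import Defs
open import Algebra.Bundles using (CommutativeRing; RawRing)
import Algebra.Properties.CommutativeMonoid.Sum as CommutativeMonoidSum
import Algebra.Properties.Ring as RingProperties
import Algebra.Properties.Semiring.Mult.TCOptimised as Mult
import Algebra.Properties.Semiring.Sum as SemiringSum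
import Algebra.Solver.Ring as RingSolver
open import Algebra.Solver.Ring.AlmostCommutativeRing
  using (_-Raw-AlmostCommutative⟶_; fromCommutativeRing)
open import Data.Bool.Base using (Bool; true; false; not; if_then_else_)
open import Data.Empty using (⊥-elim)
open import Data.Fin.Base
  using (Fin; zero; suc; toℕ; fromℕ<; inject₁; punchIn; punchOut; splitAt; _↑ˡ_; _↑ʳ_)
open import Data.Fin.Properties as Fin
  using ( _≟_; punchInᵢ≢i; punchIn-punchOut; punchIn-injective; toℕ-injective; toℕ-inject₁
        ; toℕ-↑ˡ; splitAt-↑ˡ; splitAt-↑ʳ; splitAt⁻¹-↑ˡ; splitAt⁻¹-↑ʳ; ↑ˡ-injective; ↑ʳ-injective )
open import Data.Fin.Subset using (∣_∣)
import Data.Integer.Base as ℤ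
import Data.Integer.Properties as ℤ
open import Data.List.Base using (List; []; _∷_; foldr)
open import Data.List.Relation.Unary.All using (All; []; _∷_)
open import Data.Maybe.Base as Maybe using (Maybe)
open import Data.Nat.Base as ℕ using (ℕ; zero; suc; NonZero)
import Data.Nat.Properties as ℕ
open import Data.Product.Base using (∃; _×_; _,_; proj₁; proj₂)
open import Data.Sum.Base as Sum using (_⊎_; inj₁; inj₂; [_,_]′)
open import Data.Vec.Base using (tabulate)
open import Data.Vec.Functional as Vector using (Vector)
open import Function.Base using (_∘_)
open import Function.Bundles using (Inverse; mk↔ₛ′)
open import Function.Construct.Identity using (↔-id)
open import Level using (_⊔_)
open import Relation.Binary.Definitions using (Decidable; tri<; tri≈; tri>)
open import Relation.Binary.PropositionalEquality as ≡ using (_≡_; _≢_)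
import Relation.Binary.Reasoning.Setoid as SetoidReasoning
open import Relation.Binary.Structures using (IsDecTotalOrder)
open import Relation.Nullary using (¬_; does; yes; no)
open import Relation.Nullary.Decidable using (dec⇒maybe; _×-dec_)

-- The spectrum is known only through the values of det(xI - X), so polynomials occur as functions
-- with a degree bound, and characteristic zero supplies the points that make their coefficients
-- comparable. Each graph matrix is a diagonal φ(d) plus ε ω(d) A ω(d′) in the degrees d, d′. The
-- determinant is computed once for arbitrary φ, ω, ε; the four kinds are told apart only when the
-- degree of a regular graph is recovered. There 𝓛 is the delicate kind: its diagonal tells only
-- whether r = 0. For r > 0 the coefficient of A is -1/r, so that b²r = 1/r yields r; for r = 0 it
-- vanishes, but then there are no edges to recover. Laplace expansion along the first row does not
-- make multiplicativity of the determinant visible; the uniqueness of alternating forms does.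
-- Inverses enter the matrix identities only as equations `y * x ≈ 1#`, so these hold over every
-- commutative ring, and the field has to supply points x at which the scalars in question are
-- invertible.

-- A ring solver with integer coefficients

module IntegerCoefficients {c ℓ} (K : CommutativeRing c ℓ) where

  open import Data.Integer.Base using (ℤ; +_; -[1+_]; _⊖_)
  open CommutativeRing K
  open RingProperties ring using (-‿involutive; -0#≈0#; -‿distribˡ-*; -‿distribʳ-*; -‿+-comm)
  open Mult semiring using (×-homo-+; ×1-homo-*; 1+×) renaming (_×_ to infixl 8 _×ᵣ_)
  open SetoidReasoning setoid

  private
    ℤ-rawRing : RawRing _ _
    ℤ-rawRing = record
      { Carrier = ℤ ; _≈_ = _≡_ ; _+_ = ℤ._+_ ; _*_ = ℤ._*_ ; -_ = ℤ.-_
      ; 0# = ℤ.0ℤ ; 1# = ℤ.1ℤ }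

    ⟦_⟧ : ℤ → Carrier
    ⟦ + n ⟧      = n ×ᵣ 1#
    ⟦ -[1+ n ] ⟧ = - (suc n ×ᵣ 1#)

    neg-homo : ∀ i → ⟦ ℤ.- i ⟧ ≈ - ⟦ i ⟧
    neg-homo (+ zero)   = sym -0#≈0#
    neg-homo (+ suc n)  = refl
    neg-homo (-[1+ n ]) = sym (-‿involutive _)

    ⊖-homo : ∀ m n → ⟦ m ⊖ n ⟧ ≈ m ×ᵣ 1# - n ×ᵣ 1#
    ⊖-homo m       zero    = sym (trans (+-congˡ -0#≈0#) (+-identityʳ _))
    ⊖-homo zero    (suc n) = sym (+-identityˡ _)
    ⊖-homo (suc m) (suc n) = begin
      ⟦ suc m ⊖ suc n ⟧                    ≡⟨ ≡.cong ⟦_⟧ (ℤ.[1+m]⊖[1+n]≡m⊖n m n) ⟩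
      ⟦ m ⊖ n ⟧                            ≈⟨ ⊖-homo m n ⟩
      m ×ᵣ 1# - n ×ᵣ 1#                      ≈⟨ +-congʳ (+-identityʳ _) ⟨
      (m ×ᵣ 1# + 0#) - n ×ᵣ 1#               ≈⟨ +-congʳ (+-congˡ (-‿inverseʳ 1#)) ⟨
      (m ×ᵣ 1# + (1# - 1#)) - n ×ᵣ 1#        ≈⟨ +-congʳ (+-assoc _ _ _) ⟨
      ((m ×ᵣ 1# + 1#) - 1#) - n ×ᵣ 1#        ≈⟨ +-assoc _ _ _ ⟩
      (m ×ᵣ 1# + 1#) + (- 1# - n ×ᵣ 1#)      ≈⟨ +-cong (+-comm _ _) (-‿+-comm _ _) ⟩
      (1# + m ×ᵣ 1#) - (1# + n ×ᵣ 1#)        ≈⟨ +-cong (1+× m 1#) (-‿cong (1+× n 1#)) ⟨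
      suc m ×ᵣ 1# - suc n ×ᵣ 1#              ∎

    +-homo : ∀ i j → ⟦ i ℤ.+ j ⟧ ≈ ⟦ i ⟧ + ⟦ j ⟧
    +-homo (+ m)    (+ n)    = ×-homo-+ 1# m n
    +-homo (+ m)    -[1+ n ] = ⊖-homo m (suc n)
    +-homo -[1+ m ] (+ n)    = trans (⊖-homo n (suc m)) (+-comm _ _)
    +-homo -[1+ m ] -[1+ n ] = begin
      - (suc (suc (m ℕ.+ n)) ×ᵣ 1#)             ≡⟨ ≡.cong (λ k → - (k ×ᵣ 1#)) (≡.cong suc (ℕ.+-suc m n)) ⟨
      - ((suc m ℕ.+ suc n) ×ᵣ 1#)               ≈⟨ -‿cong (×-homo-+ 1# (suc m) (suc n)) ⟩
      - (suc m ×ᵣ 1# + suc n ×ᵣ 1#)              ≈⟨ -‿+-comm _ _ ⟨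
      - (suc m ×ᵣ 1#) - (suc n ×ᵣ 1#)            ∎

    *-homo⁺ : ∀ m j → ⟦ + m ℤ.* j ⟧ ≈ ⟦ + m ⟧ * ⟦ j ⟧
    *-homo⁺ m (+ n) = begin
      ⟦ + m ℤ.* + n ⟧      ≡⟨ ≡.cong ⟦_⟧ (ℤ.pos-* m n) ⟨
      (m ℕ.* n) ×ᵣ 1#       ≈⟨ ×1-homo-* m n ⟩
      m ×ᵣ 1# * (n ×ᵣ 1#)    ∎
    *-homo⁺ m -[1+ n ] = begin
      ⟦ + m ℤ.* -[1+ n ] ⟧        ≡⟨ ≡.cong ⟦_⟧ (ℤ.neg-distribʳ-* (+ m) (+ suc n)) ⟨
      ⟦ ℤ.- (+ m ℤ.* + suc n) ⟧   ≈⟨ neg-homo (+ m ℤ.* + suc n) ⟩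
      - ⟦ + m ℤ.* + suc n ⟧       ≈⟨ -‿cong (*-homo⁺ m (+ suc n)) ⟩
      - (⟦ + m ⟧ * ⟦ + suc n ⟧)   ≈⟨ -‿distribʳ-* _ _ ⟩
      ⟦ + m ⟧ * - ⟦ + suc n ⟧     ∎

    *-homo : ∀ i j → ⟦ i ℤ.* j ⟧ ≈ ⟦ i ⟧ * ⟦ j ⟧
    *-homo (+ m)    j = *-homo⁺ m j
    *-homo -[1+ m ] j = begin
      ⟦ -[1+ m ] ℤ.* j ⟧        ≡⟨ ≡.cong ⟦_⟧ (ℤ.neg-distribˡ-* (+ suc m) j) ⟨
      ⟦ ℤ.- (+ suc m ℤ.* j) ⟧   ≈⟨ neg-homo (+ suc m ℤ.* j) ⟩
      - ⟦ + suc m ℤ.* j ⟧       ≈⟨ -‿cong (*-homo⁺ (suc m) j) ⟩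
      - (⟦ + suc m ⟧ * ⟦ j ⟧)   ≈⟨ -‿distribˡ-* _ _ ⟩
      - ⟦ + suc m ⟧ * ⟦ j ⟧     ∎

    -- To collect terms the solver has to compare coefficients, and equality in `K` is not
    -- decidable. The integers map to every ring and are decidable. With the optimised multiple,
    -- `1 ×ᵣ 1#` reduces to `1#`, so the constant `:1` matches `1#` in goals by computation.
    homomorphism : ℤ-rawRing -Raw-AlmostCommutative⟶ fromCommutativeRing K
    homomorphism = record
      { ⟦_⟧ = ⟦_⟧ ; +-homo = +-homo ; *-homo = *-homo ; -‿homo = neg-homo
      ; 0-homo = refl ; 1-homo = refl }

    coefficient-≟ : ∀ i j → Maybe (⟦ i ⟧ ≈ ⟦ j ⟧)
    coefficient-≟ i j = Maybe.map (λ i≡j → reflexive (≡.cong ⟦_⟧ i≡j)) (dec⇒maybe (i ℤ.≟ j))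

  open RingSolver ℤ-rawRing (fromCommutativeRing K) homomorphism coefficient-≟ public
    using (Polynomial; solve; con; _:+_; _:*_; _:-_; :-_; _:=_)

  :0 :1 : ∀ {n} → Polynomial n
  :0 = con ℤ.0ℤ
  :1 = con ℤ.1ℤ

-- Determinants through alternating forms

module MatrixAlgebra {c ℓ} (K : CommutativeRing c ℓ) where

  open CommutativeRing K hiding (zero)
  open SemiringSum semiring using (sum-cong-≋; ∑-distrib-+; sum-replicate-zero; *-distribˡ-sum; *-distribʳ-sum)
  open Matrices K
  open IntegerCoefficients K
  open SetoidReasoning setoid
  open Vector using () renaming (_∷_ to infixr 5 _∷ᵛ_)

  Rect : ℕ → ℕ → Set c
  Rect n m = Fin n → Fin m → Carrier

  infix 4 _≈ᴹ_
  _≈ᴹ_ : ∀ {n m} → Rect n m → Rect n m → Set ℓ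
  M ≈ᴹ N = ∀ i j → M i j ≈ N i j

  infix 10 _ᵀ
  _ᵀ : ∀ {n m} → Rect n m → Rect m n
  (M ᵀ) i j = M j i

  scalar : ∀ {n} → Carrier → Matrix n
  scalar x = diag λ _ → x

  1ᴹ : ∀ {n} → Matrix n
  1ᴹ = scalar 1#

  sum-zero : ∀ {n} {t : Vector Carrier n} → (∀ i → t i ≈ 0#) → sum t ≈ 0#
  sum-zero {n} t≈0 = trans (sum-cong-≋ t≈0) (sum-replicate-zero n)

  -- Meant for the expansion along a column of a matrix with two equal adjacent rows: every minor
  -- that keeps both rows vanishes, which leaves two terms.
  sum-adjacent : ∀ {n} (i : Fin n) (t : Vector Carrier (suc n)) →
    (∀ p → p ≢ inject₁ i → p ≢ suc i → t p ≈ 0#) →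
    sum t ≈ t (inject₁ i) + t (suc i)
  sum-adjacent zero t t≈0 = begin
    t zero + (t (suc zero) + sum (λ p → t (suc (suc p))))
      ≈⟨ +-congˡ (+-congˡ (sum-zero λ p → t≈0 (suc (suc p)) (λ ()) (λ ()))) ⟩
    t zero + (t (suc zero) + 0#)
      ≈⟨ +-congˡ (+-identityʳ _) ⟩
    t zero + t (suc zero) ∎
  sum-adjacent (suc i) t t≈0 = begin
    t zero + sum (t ∘ suc)
      ≈⟨ +-cong (t≈0 zero (λ ()) (λ ()))
           (sum-adjacent i (t ∘ suc) λ p p≢ p≢′ →
             t≈0 (suc p) (p≢ ∘ Fin.suc-injective) (p≢′ ∘ Fin.suc-injective)) ⟩
    0# + (t (suc (inject₁ i)) + t (suc (suc i)))
      ≈⟨ +-identityˡ _ ⟩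
    t (suc (inject₁ i)) + t (suc (suc i)) ∎

  diag-≡ : ∀ {n} (d : Vector Carrier n) i → diag d i i ≈ d i
  diag-≡ d i with i ≟ i
  ... | yes _   = refl
  ... | no  i≢i = ⊥-elim (i≢i ≡.refl)

  diag-≢ : ∀ {n} (d : Vector Carrier n) {i j} → i ≢ j → diag d i j ≈ 0#
  diag-≢ d {i} {j} i≢j with i ≟ j
  ... | yes i≡j = ⊥-elim (i≢j i≡j)
  ... | no  _   = refl

  diag-suc : ∀ {n} (d : Vector Carrier (suc n)) i j → diag d (suc i) (suc j) ≈ diag (d ∘ suc) i j
  diag-suc d i j with i ≟ j
  ... | yes _ = refl
  ... | no  _ = refl

  diag-sym : ∀ {n} (d : Vector Carrier n) i j → diag d i j ≈ diag d j i
  diag-sym d i j with i ≟ j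
  ... | yes ≡.refl = sym (diag-≡ d i)
  ... | no  i≢j    = sym (diag-≢ d (i≢j ∘ ≡.sym))

  sum-diagˡ : ∀ {n} (d t : Vector Carrier n) i → sum (λ j → diag d i j * t j) ≈ d i * t i
  sum-diagˡ d t zero = begin
    d zero * t zero + sum (λ j → 0# * t (suc j))
      ≈⟨ +-congˡ (sum-zero λ j → zeroˡ (t (suc j))) ⟩
    d zero * t zero + 0#  ≈⟨ +-identityʳ _ ⟩
    d zero * t zero       ∎
  sum-diagˡ d t (suc i) = begin
    0# * t zero + sum (λ j → diag d (suc i) (suc j) * t (suc j))
      ≈⟨ +-cong (zeroˡ _) (sum-cong-≋ λ j → *-congʳ (diag-suc d i j)) ⟩
    0# + sum (λ j → diag (d ∘ suc) i j * t (suc j))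
      ≈⟨ +-identityˡ _ ⟩
    sum (λ j → diag (d ∘ suc) i j * t (suc j))
      ≈⟨ sum-diagˡ (d ∘ suc) (t ∘ suc) i ⟩
    d (suc i) * t (suc i) ∎

  sum-diagʳ : ∀ {n} (d t : Vector Carrier n) j → sum (λ i → t i * diag d i j) ≈ t j * d j
  sum-diagʳ d t j = begin
    sum (λ i → t i * diag d i j)
      ≈⟨ sum-cong-≋ (λ i → trans (*-comm _ _) (*-congʳ (diag-sym d i j))) ⟩
    sum (λ i → diag d j i * t i)
      ≈⟨ sum-diagˡ d t j ⟩
    d j * t j
      ≈⟨ *-comm _ _ ⟩
    t j * d j ∎

  det-cong : ∀ {n} {M N : Matrix n} → M ≈ᴹ N → det M ≈ det N
  det-cong {zero}  M≈N = refl
  det-cong {suc n} M≈N = sum-cong-≋ λ j →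
    *-cong (*-congˡ {(- 1#) ^ toℕ j} (M≈N zero j)) (det-cong λ i k → M≈N (suc i) (punchIn j k))

  -- The rows have arbitrary length `N`, so that fixing the first row, or restricting to rows that
  -- vanish at one place, gives forms of the same kind. Only adjacent equal rows are required to
  -- give 0: this is enough to derive `swap`, and it is what an expansion yields directly. Linearity
  -- compares three matrices that agree off row `i` instead of updating a row.
  record IsAlternating {n N} (f : Rect n N → Carrier) : Set (c ⊔ ℓ) where
    field
      cong      : ∀ {M M′} → M ≈ᴹ M′ → f M ≈ f M′
      linear    : ∀ i a b {M M₁ M₂} →
                  (∀ j → j ≢ i → ∀ k → M j k ≈ M₁ j k) →
                  (∀ j → j ≢ i → ∀ k → M j k ≈ M₂ j k) →
                  (∀ k → M i k ≈ a * M₁ i k + b * M₂ i k) →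
                  f M ≈ a * f M₁ + b * f M₂
      alternate : ∀ i j {M} → toℕ j ≡ suc (toℕ i) → (∀ k → M i k ≈ M j k) → f M ≈ 0#

  open IsAlternating

  ∷-cong : ∀ {n N} {x y : Vector Carrier N} {R S : Rect n N} →
    (∀ k → x k ≈ y k) → R ≈ᴹ S → (x ∷ᵛ R) ≈ᴹ (y ∷ᵛ S)
  ∷-cong x≈y R≈S zero    = x≈y
  ∷-cong x≈y R≈S (suc i) = R≈S i

  ∷-head-tail : ∀ {n N} (M : Rect (suc n) N) → M ≈ᴹ (M zero ∷ᵛ (M ∘ suc))
  ∷-head-tail M zero    k = refl
  ∷-head-tail M (suc i) k = refl

  ∷-alternating : ∀ {n N} {f : Rect (suc n) N → Carrier} → IsAlternating f →
    ∀ x → IsAlternating (λ R → f (x ∷ᵛ R))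
  ∷-alternating alt x = record
    { cong      = λ R≈S → cong alt (∷-cong (λ _ → refl) R≈S)
    ; linear    = λ i a b p q r → linear alt (suc i) a b (away p) (away q) r
    ; alternate = λ i j j≡1+i → alternate alt (suc i) (suc j) (≡.cong suc j≡1+i)
    }
    where
    away : ∀ {i} {R S : Rect _ _} → (∀ j → j ≢ i → ∀ k → R j k ≈ S j k) →
           ∀ j → j ≢ suc i → ∀ k → (x ∷ᵛ R) j k ≈ (x ∷ᵛ S) j k
    away p zero    _     k = refl
    away p (suc j) j≢1+i k = p j (j≢1+i ∘ ≡.cong suc) k

  module _ {n N} {f : Rect (suc n) N → Carrier} (alt : IsAlternating f) where

    head-linear : ∀ a b {x y z} R → (∀ k → x k ≈ a * y k + b * z k) →
      f (x ∷ᵛ R) ≈ a * f (y ∷ᵛ R) + b * f (z ∷ᵛ R)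
    head-linear a b {x} R = linear alt zero a b away away
      where
      away : ∀ {w} j → j ≢ zero → ∀ k → (x ∷ᵛ R) j k ≈ (w ∷ᵛ R) j k
      away zero    0≢0 = ⊥-elim (0≢0 ≡.refl)
      away (suc j) _ k = refl

    head-sum : ∀ {m} (a : Vector Carrier m) (e : Rect m N) R →
      f ((λ k → sum λ j → a j * e j k) ∷ᵛ R) ≈ sum λ j → a j * f (e j ∷ᵛ R)
    head-sum {zero} a e R = begin
      f ((λ _ → 0#) ∷ᵛ R)
        ≈⟨ head-linear 0# 0# R (λ k → solve 0 (:0 := :0 :* :0 :+ :0 :* :0) refl) ⟩
      0# * f ((λ _ → 0#) ∷ᵛ R) + 0# * f ((λ _ → 0#) ∷ᵛ R)
        ≈⟨ solve 1 (λ y → :0 :* y :+ :0 :* y := :0) refl _ ⟩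
      0# ∎
    head-sum {suc m} a e R = begin
      f ((λ k → sum λ j → a j * e j k) ∷ᵛ R)
        ≈⟨ head-linear (a zero) 1# R (λ k → +-congˡ (sym (*-identityˡ _))) ⟩
      a zero * f (e zero ∷ᵛ R) + 1# * f ((λ k → sum λ j → a (suc j) * e (suc j) k) ∷ᵛ R)
        ≈⟨ +-congˡ (*-identityˡ _) ⟩
      a zero * f (e zero ∷ᵛ R) + f ((λ k → sum λ j → a (suc j) * e (suc j) k) ∷ᵛ R)
        ≈⟨ +-congˡ (head-sum (a ∘ suc) (e ∘ suc) R) ⟩
      sum (λ j → a j * f (e j ∷ᵛ R)) ∎

  module _ {n N} {f : Rect (suc (suc n)) N → Carrier} (alt : IsAlternating f) where

    adjacent-equal : ∀ x R → f (x ∷ᵛ x ∷ᵛ R) ≈ 0#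
    adjacent-equal x R = alternate alt zero (suc zero) ≡.refl (λ _ → refl)

    -- Polarisation: expand the vanishing value at the pair (x + y, x + y).
    swap : ∀ x y R → f (x ∷ᵛ y ∷ᵛ R) ≈ - f (y ∷ᵛ x ∷ᵛ R)
    swap x y R = begin
      B x y
        -- The two zeros hold the places of `B x x` and `B y y`, which the next step puts back so
        -- that bilinearity can be read backwards.
        ≈⟨ solve 2 (λ u v → u :=
             (:1 :* (:1 :* :0 :+ :1 :* u) :+ :1 :* (:1 :* v :+ :1 :* :0)) :- v) refl _ _ ⟩
      (1# * (1# * 0# + 1# * B x y) + 1# * (1# * B y x + 1# * 0#)) - B y x
        ≈⟨ +-congʳ (+-cong (*-congˡ (+-congʳ (*-congˡ (adjacent-equal x R))))
                           (*-congˡ (+-congˡ (*-congˡ (adjacent-equal y R))))) ⟨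
      (1# * (1# * B x x + 1# * B x y) + 1# * (1# * B y x + 1# * B y y)) - B y x
        ≈⟨ +-congʳ (+-cong (*-congˡ (second x)) (*-congˡ (second y))) ⟨
      (1# * B x x+y + 1# * B y x+y) - B y x
        ≈⟨ +-congʳ (head-linear alt 1# 1# (x+y ∷ᵛ R) (λ _ → refl)) ⟨
      B x+y x+y - B y x
        ≈⟨ +-congʳ (adjacent-equal x+y R) ⟩
      0# - B y x
        ≈⟨ +-identityˡ _ ⟩
      - B y x ∎
      where
      B : Vector Carrier N → Vector Carrier N → Carrier
      B u v = f (u ∷ᵛ v ∷ᵛ R)
      x+y : Vector Carrier N
      x+y k = 1# * x k + 1# * y k
      second : ∀ z → B z x+y ≈ 1# * B z x + 1# * B z y
      second z = head-linear (∷-alternating alt z) 1# 1# R (λ _ → refl)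

  -- Swapping the second row to the front and fixing it there gives an alternating form with one row
  -- less, whose first row is again `x`; the induction hypothesis treats the remaining rows. Once
  -- swapped back, only the multiple of `x` in the second row is left, and it contributes a form
  -- with two equal rows.
  add-head-multiples : ∀ {n N} {f : Rect (suc n) N → Carrier} → IsAlternating f →
    ∀ x (a : Vector Carrier n) R →
    f (x ∷ᵛ (λ i k → R i k - a i * x k)) ≈ f (x ∷ᵛ R)
  add-head-multiples {zero}  alt x a R = cong alt (∷-cong (λ _ → refl) λ ())
  add-head-multiples {suc n} {f = f} alt x a R = begin
    f (x ∷ᵛ R₁)                  ≈⟨ cong alt (∷-cong (λ _ → refl) (∷-head-tail R₁)) ⟩
    f (x ∷ᵛ y ∷ᵛ (R₁ ∘ suc))      ≈⟨ swap alt x y (R₁ ∘ suc) ⟩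
    - f (y ∷ᵛ x ∷ᵛ (R₁ ∘ suc))    ≈⟨ -‿cong (add-head-multiples (∷-alternating alt y) x (a ∘ suc) (R ∘ suc)) ⟩
    - f (y ∷ᵛ x ∷ᵛ (R ∘ suc))     ≈⟨ swap alt x y (R ∘ suc) ⟨
    f (x ∷ᵛ y ∷ᵛ (R ∘ suc))
      ≈⟨ head-linear (∷-alternating alt x) 1# (- a zero) (R ∘ suc)
           (λ k → solve 3 (λ r a x → r :- a :* x := :1 :* r :+ (:- a) :* x) refl _ _ _) ⟩
    1# * f (x ∷ᵛ R zero ∷ᵛ (R ∘ suc)) + - a zero * f (x ∷ᵛ x ∷ᵛ (R ∘ suc))
      ≈⟨ +-congˡ (*-congˡ (adjacent-equal alt x (R ∘ suc))) ⟩
    1# * f (x ∷ᵛ R zero ∷ᵛ (R ∘ suc)) + - a zero * 0#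
      ≈⟨ solve 2 (λ u a → :1 :* u :+ (:- a) :* :0 := u) refl _ _ ⟩
    f (x ∷ᵛ R zero ∷ᵛ (R ∘ suc))  ≈⟨ cong alt (∷-cong (λ _ → refl) (∷-head-tail R)) ⟨
    f (x ∷ᵛ R)                   ∎
    where
    R₁ = λ i k → R i k - a i * x k
    y  = R₁ zero

  -- Row `j` passes `toℕ j` other rows on its way to the front, and each of these swaps costs a
  -- sign.
  move-to-head : ∀ {n N} {f : Rect (suc n) N → Carrier} → IsAlternating f →
    ∀ M j → f (M j ∷ᵛ (M ∘ punchIn j)) ≈ (- 1#) ^ toℕ j * f M
  move-to-head {f = f} alt M zero = begin
    f (M zero ∷ᵛ (M ∘ suc))  ≈⟨ cong alt (∷-head-tail M) ⟨
    f M                     ≈⟨ *-identityˡ _ ⟨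
    1# * f M                ∎
  move-to-head {suc n} {f = f} alt M (suc j) = begin
    f (x ∷ᵛ (M ∘ punchIn (suc j)))
      ≈⟨ cong alt (∷-cong (λ _ → refl) (∷-head-tail (M ∘ punchIn (suc j)))) ⟩
    f (x ∷ᵛ M zero ∷ᵛ (M ∘ suc ∘ punchIn j))
      ≈⟨ swap alt x (M zero) (M ∘ suc ∘ punchIn j) ⟩
    - f (M zero ∷ᵛ x ∷ᵛ (M ∘ suc ∘ punchIn j))
      ≈⟨ -‿cong (move-to-head (∷-alternating alt (M zero)) (M ∘ suc) j) ⟩
    - ((- 1#) ^ toℕ j * f (M zero ∷ᵛ (M ∘ suc)))
      ≈⟨ -‿cong (*-congˡ (cong alt (∷-head-tail M))) ⟨
    - ((- 1#) ^ toℕ j * f M)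
      ≈⟨ solve 2 (λ s y → :- (s :* y) := (:- :1) :* s :* y) refl _ _ ⟩
    (- 1#) ^ suc (toℕ j) * f M ∎
    where x = M (suc j)

  unit : ∀ {n} → Fin n → Vector Carrier n
  unit = 1ᴹ

  insertZero : ∀ {n} → Fin (suc n) → Vector Carrier n → Vector Carrier (suc n)
  insertZero {n} j v k with j ≟ k
  ... | yes _   = 0#
  ... | no  j≢k = v (punchOut j≢k)

  insertZero-unique : ∀ {n} j (v : Vector Carrier n) (w : Vector Carrier (suc n)) →
    w j ≈ 0# → (∀ k → w (punchIn j k) ≈ v k) → ∀ k → w k ≈ insertZero j v k
  insertZero-unique j v w wj w≈v k with j ≟ k
  ... | yes ≡.refl = wj
  ... | no  j≢k    = begin
    w k                            ≡⟨ ≡.cong w (punchIn-punchOut j≢k) ⟨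
    w (punchIn j (punchOut j≢k))   ≈⟨ w≈v (punchOut j≢k) ⟩
    v (punchOut j≢k)               ∎

  insertZero-cong : ∀ {n} j {v w : Vector Carrier n} → (∀ k → v k ≈ w k) →
    ∀ k → insertZero j v k ≈ insertZero j w k
  insertZero-cong j v≈w k with j ≟ k
  ... | yes _   = refl
  ... | no  j≢k = v≈w (punchOut j≢k)

  insertZero-linear : ∀ {n} j a b {u v w : Vector Carrier n} → (∀ k → u k ≈ a * v k + b * w k) →
    ∀ k → insertZero j u k ≈ a * insertZero j v k + b * insertZero j w k
  insertZero-linear j a b u≈ k with j ≟ k
  ... | yes _   = solve 2 (λ a b → :0 := a :* :0 :+ b :* :0) refl a b
  ... | no  j≢k = u≈ (punchOut j≢k)

  unit-punchIn : ∀ {n} j (i : Fin n) k → unit (punchIn j i) k ≈ insertZero j (unit i) k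
  unit-punchIn j i = insertZero-unique j (unit i) (unit (punchIn j i))
    (diag-≢ _ (punchInᵢ≢i j i)) λ k → unit-punchIn-punchIn k
    where
    unit-punchIn-punchIn : ∀ k → unit (punchIn j i) (punchIn j k) ≈ unit i k
    unit-punchIn-punchIn k with i ≟ k
    ... | yes ≡.refl = diag-≡ _ (punchIn j i)
    ... | no  i≢k    = diag-≢ _ (i≢k ∘ punchIn-injective j i k)

  insertZero-alternating : ∀ {n N} {f : Rect n (suc N) → Carrier} → IsAlternating f →
    ∀ j → IsAlternating (λ R → f (λ i → insertZero j (R i)))
  insertZero-alternating alt j = record
    { cong      = λ R≈S → cong alt (λ i → insertZero-cong j (R≈S i))
    ; linear    = λ i a b p q r → linear alt i a b
        (λ l l≢i → insertZero-cong j (p l l≢i))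
        (λ l l≢i → insertZero-cong j (q l l≢i))
        (insertZero-linear j a b r)
    ; alternate = λ i i′ i′≡1+i Ri≈Ri′ → alternate alt i i′ i′≡1+i (insertZero-cong j Ri≈Ri′)
    }

  -- Expand the first row in the standard basis; the row eⱼ clears the
  -- j-th column, which leaves an alternating form in one dimension less.
  alternating-unique : ∀ {n} {f : Matrix n → Carrier} → IsAlternating f →
    ∀ M → f M ≈ det M * f 1ᴹ
  alternating-unique {zero} {f} alt M = begin
    f M        ≈⟨ cong alt (λ ()) ⟩
    f 1ᴹ       ≈⟨ *-identityˡ _ ⟨
    1# * f 1ᴹ  ∎
  alternating-unique {suc n} {f} alt M = begin
    f M
      ≈⟨ cong alt (∷-head-tail M) ⟩
    f (M zero ∷ᵛ R)
      ≈⟨ cong alt (∷-cong (λ k → sym (trans (sum-diagʳ (λ _ → 1#) (M zero) k) (*-identityʳ _))) (λ _ _ → refl)) ⟩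
    f ((λ k → sum λ j → M zero j * unit j k) ∷ᵛ R)
      ≈⟨ head-sum alt (M zero) unit R ⟩
    sum (λ j → M zero j * f (unit j ∷ᵛ R))
      ≈⟨ sum-cong-≋ (λ j → *-congˡ {M zero j} (expand j)) ⟩
    sum (λ j → M zero j * (det (minor j) * ((- 1#) ^ toℕ j * f 1ᴹ)))
      ≈⟨ sum-cong-≋ (λ j → solve 4 (λ m d s y → m :* (d :* (s :* y)) := s :* m :* d :* y) refl
           (M zero j) (det (minor j)) ((- 1#) ^ toℕ j) (f 1ᴹ)) ⟩
    sum (λ j → (- 1#) ^ toℕ j * M zero j * det (minor j) * f 1ᴹ)
      ≈⟨ *-distribʳ-sum (f 1ᴹ) (λ j → (- 1#) ^ toℕ j * M zero j * det (minor j)) ⟨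
    det M * f 1ᴹ ∎
    where
    R : Rect n (suc n)
    R = M ∘ suc
    minor : Fin (suc n) → Matrix n
    minor j i k = R i (punchIn j k)
    expand : ∀ j → f (unit j ∷ᵛ R) ≈ det (minor j) * ((- 1#) ^ toℕ j * f 1ᴹ)
    expand j = begin
      f (unit j ∷ᵛ R)
        ≈⟨ add-head-multiples alt (unit j) (λ i → R i j) R ⟨
      f (unit j ∷ᵛ (λ i k → R i k - R i j * unit j k))
        ≈⟨ cong alt (∷-cong (λ _ → refl) λ i → insertZero-unique j (minor j i) _
             (trans (+-congˡ (-‿cong (*-congˡ (diag-≡ _ j))))
                    (solve 1 (λ x → x :- x :* :1 := :0) refl _))
             (λ k → trans (+-congˡ (-‿cong (*-congˡ (diag-≢ _ (punchInᵢ≢i j k ∘ ≡.sym)))))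
                          (solve 2 (λ x y → x :- y :* :0 := x) refl _ _))) ⟩
      f (unit j ∷ᵛ (λ i → insertZero j (minor j i)))
        ≈⟨ alternating-unique (insertZero-alternating (∷-alternating alt (unit j)) j) (minor j) ⟩
      det (minor j) * f (unit j ∷ᵛ (λ i → insertZero j (unit i)))
        ≈⟨ *-congˡ (cong alt (∷-cong (λ _ → refl) λ i k → sym (unit-punchIn j i k))) ⟩
      det (minor j) * f (unit j ∷ᵛ (unit ∘ punchIn j))
        ≈⟨ *-congˡ (move-to-head alt 1ᴹ j) ⟩
      det (minor j) * ((- 1#) ^ toℕ j * f 1ᴹ) ∎

  -- Transposition and multiplicativity

  data PunchInAdjacent {n} (p : Fin (suc (suc n))) (i : Fin (suc n)) : Set where
    first  : p ≡ inject₁ i → PunchInAdjacent p i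
    second : p ≡ suc i → PunchInAdjacent p i
    other  : ∀ i′ → punchIn p (inject₁ i′) ≡ inject₁ i → punchIn p (suc i′) ≡ suc i →
             PunchInAdjacent p i

  -- If the deleted index is neither of two neighbours, these are still neighbours among the
  -- remaining indices, so a minor inherits the two equal adjacent rows.
  punchInAdjacent : ∀ {n} p i → PunchInAdjacent {n} p i
  punchInAdjacent zero          zero    = first ≡.refl
  punchInAdjacent {suc n} zero  (suc i) = other i ≡.refl ≡.refl
  punchInAdjacent (suc zero)    zero    = second ≡.refl
  punchInAdjacent {suc n} (suc (suc p)) zero = other zero ≡.refl ≡.refl
  punchInAdjacent {suc n} (suc p) (suc i) with punchInAdjacent p i
  ... | first p≡      = first (≡.cong suc p≡)
  ... | second p≡     = second (≡.cong suc p≡)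
  ... | other i′ e e′ = other (suc i′) (≡.cong suc e) (≡.cong suc e′)

  -- Deleting either of two neighbouring rows leaves the same list, except at the one place where
  -- the other of the two stands. If the two rows are equal, so are the minors.
  punchIn-adjacent : ∀ {n} (i k : Fin n) →
    punchIn (inject₁ i) k ≡ punchIn (suc i) k ⊎
    (punchIn (inject₁ i) k ≡ suc i × punchIn (suc i) k ≡ inject₁ i)
  punchIn-adjacent zero    zero    = inj₂ (≡.refl , ≡.refl)
  punchIn-adjacent zero    (suc k) = inj₁ ≡.refl
  punchIn-adjacent (suc i) zero    = inj₁ ≡.refl
  punchIn-adjacent (suc i) (suc k) with punchIn-adjacent i k
  ... | inj₁ e        = inj₁ (≡.cong suc e)
  ... | inj₂ (e , e′) = inj₂ (≡.cong suc e , ≡.cong suc e′)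

  -- The transpose turns the expansion along the first row into one along the first column of `M`.
  -- There each term involves every row of `M` exactly once, either through the entry in front or
  -- through the minor, so linearity and alternation pass by induction on the size.
  det-ᵀ-alternating : ∀ {n} → IsAlternating {n} {n} (λ M → det (M ᵀ))
  det-ᵀ-alternating {zero} = record
    { cong = λ _ → refl ; linear = λ () ; alternate = λ () }
  det-ᵀ-alternating {suc n} = record
    { cong      = λ M≈N → det-cong λ i j → M≈N j i
    ; linear    = det-linear
    ; alternate = λ i j {M} j≡1+i → alternate-at n i j M j≡1+i (det-ᵀ-alternating {n})
    }
    where
    minor : ∀ {n} → Matrix (suc n) → Fin (suc n) → Matrix n
    minor M p i k = M (punchIn p i) (suc k)

    term : ∀ {n} → Matrix (suc n) → Fin (suc n) → Carrier
    term M p = (- 1#) ^ toℕ p * M p zero * det (minor M p ᵀ)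

    det-linear : ∀ i a b {M M₁ M₂ : Matrix (suc n)} →
      (∀ j → j ≢ i → ∀ k → M j k ≈ M₁ j k) →
      (∀ j → j ≢ i → ∀ k → M j k ≈ M₂ j k) →
      (∀ k → M i k ≈ a * M₁ i k + b * M₂ i k) →
      det (M ᵀ) ≈ a * det (M₁ ᵀ) + b * det (M₂ ᵀ)
    det-linear i a b {M} {M₁} {M₂} M≈M₁ M≈M₂ Mi = begin
      sum (term M)
        ≈⟨ sum-cong-≋ term-linear ⟩
      sum (λ p → a * term M₁ p + b * term M₂ p)
        ≈⟨ ∑-distrib-+ (λ p → a * term M₁ p) (λ p → b * term M₂ p) ⟩
      sum (λ p → a * term M₁ p) + sum (λ p → b * term M₂ p)
        ≈⟨ +-cong (*-distribˡ-sum a (term M₁)) (*-distribˡ-sum b (term M₂)) ⟨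
      a * sum (term M₁) + b * sum (term M₂) ∎
      where
      term-linear : ∀ p → term M p ≈ a * term M₁ p + b * term M₂ p
      term-linear p with p ≟ i
      ... | yes ≡.refl = begin
        (- 1#) ^ toℕ p * M p zero * det (minor M p ᵀ)
          ≈⟨ *-congʳ (*-congˡ (Mi zero)) ⟩
        (- 1#) ^ toℕ p * (a * M₁ p zero + b * M₂ p zero) * det (minor M p ᵀ)
          ≈⟨ solve 6 (λ s a x b y d → s :* (a :* x :+ b :* y) :* d := a :* (s :* x :* d) :+ b :* (s :* y :* d))
               refl _ a _ b _ _ ⟩
        a * ((- 1#) ^ toℕ p * M₁ p zero * det (minor M p ᵀ)) + b * ((- 1#) ^ toℕ p * M₂ p zero * det (minor M p ᵀ))
          ≈⟨ +-cong (*-congˡ (*-congˡ (det-cong λ k j → M≈M₁ (punchIn p j) (punchInᵢ≢i p j) (suc k))))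
                    (*-congˡ (*-congˡ (det-cong λ k j → M≈M₂ (punchIn p j) (punchInᵢ≢i p j) (suc k)))) ⟩
        a * term M₁ p + b * term M₂ p ∎
      ... | no p≢i = begin
        (- 1#) ^ toℕ p * M p zero * det (minor M p ᵀ)
          ≈⟨ *-congˡ (linear (det-ᵀ-alternating {n}) i′ a b
               (λ j j≢i′ k → M≈M₁ (punchIn p j) (away j j≢i′) (suc k))
               (λ j j≢i′ k → M≈M₂ (punchIn p j) (away j j≢i′) (suc k))
               (λ k → ≡.subst (λ l → M l (suc k) ≈ a * M₁ l (suc k) + b * M₂ l (suc k))
                        (≡.sym (punchIn-punchOut p≢i)) (Mi (suc k)))) ⟩
        (- 1#) ^ toℕ p * M p zero * (a * det (minor M₁ p ᵀ) + b * det (minor M₂ p ᵀ))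
          ≈⟨ solve 6 (λ s x a u b v → s :* x :* (a :* u :+ b :* v) := a :* (s :* x :* u) :+ b :* (s :* x :* v))
               refl _ (M p zero) a _ b _ ⟩
        a * ((- 1#) ^ toℕ p * M p zero * det (minor M₁ p ᵀ)) + b * ((- 1#) ^ toℕ p * M p zero * det (minor M₂ p ᵀ))
          ≈⟨ +-cong (*-congˡ (*-congʳ (*-congˡ (M≈M₁ p p≢i zero)))) (*-congˡ (*-congʳ (*-congˡ (M≈M₂ p p≢i zero)))) ⟩
        a * term M₁ p + b * term M₂ p ∎
        where
        i′ = punchOut p≢i
        away : ∀ j → j ≢ i′ → punchIn p j ≢ i
        away j j≢i′ e = j≢i′ (punchIn-injective p j i′ (≡.trans e (≡.sym (punchIn-punchOut p≢i))))

    alternate-at : ∀ n (i j : Fin (suc n)) M → toℕ j ≡ suc (toℕ i) →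
      IsAlternating {n} {n} (λ M → det (M ᵀ)) → (∀ k → M i k ≈ M j k) → det (M ᵀ) ≈ 0#
    alternate-at zero    zero zero M () ih
    alternate-at (suc n) i (suc j) M j≡1+i ih Mi≈Mj = begin
      sum (term M)
        ≈⟨ sum-adjacent j (term M) (λ p p≢ p≢′ → other-terms p p≢ p≢′ (punchInAdjacent p j)) ⟩
      term M (inject₁ j) + term M (suc j)
        -- `inject₁ j` and `suc j` have the values `toℕ j` and `suc (toℕ j)`, so the two surviving
        -- terms carry opposite signs.
        ≡⟨ ≡.cong (λ m → (- 1#) ^ m * M (inject₁ j) zero * det (minor M (inject₁ j) ᵀ) + term M (suc j)) (toℕ-inject₁ j) ⟩
      (- 1#) ^ toℕ j * M (inject₁ j) zero * det (minor M (inject₁ j) ᵀ) + term M (suc j)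
        ≈⟨ +-congʳ (*-cong (*-congˡ (rows zero)) (det-cong λ k l → minors l k)) ⟩
      (- 1#) ^ toℕ j * M (suc j) zero * det (minor M (suc j) ᵀ) + term M (suc j)
        ≈⟨ solve 3 (λ s x d → s :* x :* d :+ (:- :1) :* s :* x :* d := :0) refl _ _ _ ⟩
      0# ∎
      where
      i≡ : i ≡ inject₁ j
      i≡ = toℕ-injective (≡.trans (≡.sym (ℕ.suc-injective j≡1+i)) (≡.sym (toℕ-inject₁ j)))

      rows : ∀ k → M (inject₁ j) k ≈ M (suc j) k
      rows k = ≡.subst (λ l → M l k ≈ M (suc j) k) i≡ (Mi≈Mj k)

      minors : ∀ l k → minor M (inject₁ j) l k ≈ minor M (suc j) l k
      minors l k with punchIn-adjacent j l
      ... | inj₁ e = reflexive (≡.cong (λ l → M l (suc k)) e)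
      ... | inj₂ (e , e′) = begin
        M (punchIn (inject₁ j) l) (suc k)  ≡⟨ ≡.cong (λ l → M l (suc k)) e ⟩
        M (suc j) (suc k)                  ≈⟨ rows (suc k) ⟨
        M (inject₁ j) (suc k)              ≡⟨ ≡.cong (λ l → M l (suc k)) e′ ⟨
        M (punchIn (suc j) l) (suc k)      ∎

      other-terms : ∀ p → p ≢ inject₁ j → p ≢ suc j → PunchInAdjacent p j → term M p ≈ 0#
      other-terms p p≢ p≢′ (first e)      = ⊥-elim (p≢ e)
      other-terms p p≢ p≢′ (second e)     = ⊥-elim (p≢′ e)
      other-terms p p≢ p≢′ (other j′ e e′) = begin
        (- 1#) ^ toℕ p * M p zero * det (minor M p ᵀ)
          ≈⟨ *-congˡ (alternate ih (inject₁ j′) (suc j′) {minor M p} (≡.cong suc (≡.sym (toℕ-inject₁ j′)))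
               (λ k → begin
                 M (punchIn p (inject₁ j′)) (suc k) ≡⟨ ≡.cong (λ l → M l (suc k)) e ⟩
                 M (inject₁ j) (suc k)              ≈⟨ rows (suc k) ⟩
                 M (suc j) (suc k)                  ≡⟨ ≡.cong (λ l → M l (suc k)) e′ ⟨
                 M (punchIn p (suc j′)) (suc k)     ∎)) ⟩
        (- 1#) ^ toℕ p * M p zero * 0#
          ≈⟨ zeroʳ _ ⟩
        0# ∎

  sum-head : ∀ {n} (t : Vector Carrier (suc n)) → (∀ j → t (suc j) ≈ 0#) → sum t ≈ t zero
  sum-head t t≈0 = trans (+-congˡ (sum-zero t≈0)) (+-identityʳ _)

  det-1ᴹ : ∀ {n} → det (1ᴹ {n}) ≈ 1#
  det-1ᴹ {zero}  = refl
  det-1ᴹ {suc n} = begin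
    det (1ᴹ {suc n})
      ≈⟨ sum-head {n} (λ j → (- 1#) ^ toℕ j * 1ᴹ zero j * det (λ i k → 1ᴹ (suc i) (punchIn j k)))
           (λ j → trans (*-congʳ (zeroʳ _)) (zeroˡ _)) ⟩
    1# * 1# * det {n} (λ i k → 1ᴹ (suc i) (suc k))
      ≈⟨ *-cong (*-identityˡ 1#) (det-cong {n} λ i k → diag-suc {n} (λ _ → 1#) i k) ⟩
    1# * det (1ᴹ {n})
      ≈⟨ *-identityˡ _ ⟩
    det (1ᴹ {n})
      ≈⟨ det-1ᴹ {n} ⟩
    1# ∎

  -- An alternating form is `det` times its value at the identity, and the identity is symmetric.
  det-ᵀ : ∀ {n} (M : Matrix n) → det (M ᵀ) ≈ det M
  det-ᵀ {n} M = begin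
    det (M ᵀ)              ≈⟨ alternating-unique det-ᵀ-alternating M ⟩
    det M * det (1ᴹ {n} ᵀ) ≈⟨ *-congˡ (det-cong λ i j → diag-sym {n} (λ _ → 1#) j i) ⟩
    det M * det (1ᴹ {n})   ≈⟨ *-congˡ (det-1ᴹ {n}) ⟩
    det M * 1#             ≈⟨ *-identityʳ _ ⟩
    det M                  ∎

  infixl 7 _·ᴹ_
  _·ᴹ_ : ∀ {n m l} → Rect n m → Rect m l → Rect n l
  (M ·ᴹ N) i j = sum λ k → M i k * N k j

  -- For fixed `N`, the form `det (M ·ᴹ N)` is alternating in the rows of `M`, with value `det N` at
  -- the identity. Linearity and alternation are at hand for the transposed determinant, hence the
  -- detours through `det-ᵀ`.
  det-·ᴹ : ∀ {n} (M N : Matrix n) → det (M ·ᴹ N) ≈ det M * det N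
  det-·ᴹ {n} M N = begin
    det (M ·ᴹ N)             ≈⟨ alternating-unique alt M ⟩
    det M * det (1ᴹ ·ᴹ N)    ≈⟨ *-congˡ (det-cong λ i j → trans (sum-diagˡ (λ _ → 1#) (λ k → N k j) i) (*-identityˡ _)) ⟩
    det M * det N            ∎
    where
    detᵀ : IsAlternating {n} {n} (λ M → det (M ᵀ))
    detᵀ = det-ᵀ-alternating
    alt : IsAlternating {n} {n} (λ M → det (M ·ᴹ N))
    alt = record
      { cong      = λ M≈M′ → det-cong λ i j → sum-cong-≋ λ k → *-congʳ (M≈M′ i k)
      ; linear    = λ i a b {M} {M₁} {M₂} p q r → begin
          det (M ·ᴹ N)        ≈⟨ det-ᵀ (M ·ᴹ N) ⟨
          det ((M ·ᴹ N) ᵀ)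
            ≈⟨ linear detᵀ i a b
                 (λ j j≢i l → sum-cong-≋ λ k → *-congʳ (p j j≢i k))
                 (λ j j≢i l → sum-cong-≋ λ k → *-congʳ (q j j≢i k))
                 (λ l → begin
                   sum (λ k → M i k * N k l)
                     ≈⟨ sum-cong-≋ (λ k → trans (*-congʳ (r k))
                          (solve 5 (λ a x b y n → (a :* x :+ b :* y) :* n := a :* (x :* n) :+ b :* (y :* n))
                             refl a _ b _ _)) ⟩
                   sum (λ k → a * (M₁ i k * N k l) + b * (M₂ i k * N k l))
                     ≈⟨ ∑-distrib-+ (λ k → a * (M₁ i k * N k l)) _ ⟩
                   sum (λ k → a * (M₁ i k * N k l)) + sum (λ k → b * (M₂ i k * N k l))
                     ≈⟨ +-cong (*-distribˡ-sum a (λ k → M₁ i k * N k l)) (*-distribˡ-sum b (λ k → M₂ i k * N k l)) ⟨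
                   a * (M₁ ·ᴹ N) i l + b * (M₂ ·ᴹ N) i l ∎) ⟩
          a * det ((M₁ ·ᴹ N) ᵀ) + b * det ((M₂ ·ᴹ N) ᵀ)
            ≈⟨ +-cong (*-congˡ (det-ᵀ (M₁ ·ᴹ N))) (*-congˡ (det-ᵀ (M₂ ·ᴹ N))) ⟩
          a * det (M₁ ·ᴹ N) + b * det (M₂ ·ᴹ N) ∎
      ; alternate = λ i j {M} j≡1+i Mi≈Mj → trans (sym (det-ᵀ (M ·ᴹ N)))
          (alternate detᵀ i j j≡1+i λ l → sum-cong-≋ λ k → *-congʳ (Mi≈Mj k))
      }

-- Block matrices, Schur complements and perturbations by 𝐉

punchIn-↑ˡ-↑ˡ : ∀ {n} m (j : Fin (suc n)) k → punchIn (j ↑ˡ m) (k ↑ˡ m) ≡ punchIn j k ↑ˡ m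
punchIn-↑ˡ-↑ˡ m zero    k       = ≡.refl
punchIn-↑ˡ-↑ˡ m (suc j) zero    = ≡.refl
punchIn-↑ˡ-↑ˡ m (suc j) (suc k) = ≡.cong suc (punchIn-↑ˡ-↑ˡ m j k)

punchIn-↑ˡ-↑ʳ : ∀ {n} m (j : Fin (suc n)) (k : Fin m) → punchIn (j ↑ˡ m) (n ↑ʳ k) ≡ suc n ↑ʳ k
punchIn-↑ˡ-↑ʳ         m zero    k = ≡.refl
punchIn-↑ˡ-↑ʳ {suc n} m (suc j) k = ≡.cong suc (punchIn-↑ˡ-↑ʳ m j k)

data SplitView n m : Fin (n ℕ.+ m) → Set where
  left  : ∀ i → SplitView n m (i ↑ˡ m)
  right : ∀ i → SplitView n m (n ↑ʳ i)

splitView : ∀ n m i → SplitView n m i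
splitView n m i with splitAt n i in eq
... | inj₁ j = ≡.subst (SplitView n m) (splitAt⁻¹-↑ˡ eq) (left j)
... | inj₂ j = ≡.subst (SplitView n m) (splitAt⁻¹-↑ʳ eq) (right j)

module BlockMatrices {c ℓ} (K : CommutativeRing c ℓ) where

  open CommutativeRing K hiding (zero)
  open SemiringSum semiring using (sum-cong-≋; ∑-distrib-+; *-distribˡ-sum; *-distribʳ-sum)
  open Matrices K
  open MatrixAlgebra K
  open IntegerCoefficients K
  open SetoidReasoning setoid

  sum-split : ∀ n {m} (t : Vector Carrier (n ℕ.+ m)) →
    sum t ≈ sum (λ i → t (i ↑ˡ m)) + sum (λ j → t (n ↑ʳ j))
  sum-split zero    t = sym (+-identityˡ _)
  sum-split (suc n) t = trans (+-congˡ (sum-split n (t ∘ suc))) (sym (+-assoc _ _ _))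

  -- The first row meets only columns of the left block, and deleting its row and such a column
  -- leaves a matrix of the same shape with a smaller upper left block.
  det-lowerBlock : ∀ n {m} (M : Matrix (n ℕ.+ m)) →
    (∀ i j → M (i ↑ˡ m) (n ↑ʳ j) ≈ 0#) →
    det M ≈ det {n} (λ i j → M (i ↑ˡ m) (j ↑ˡ m)) * det {m} (λ i j → M (n ↑ʳ i) (n ↑ʳ j))
  det-lowerBlock zero        M upper = sym (*-identityˡ _)
  det-lowerBlock (suc n) {m} M upper = begin
    sum term
      ≈⟨ sum-split (suc n) {m} term ⟩
    sum (λ j → term (j ↑ˡ m)) + sum (λ j → term (suc n ↑ʳ j))
      ≈⟨ +-cong (sum-cong-≋ left-term)
                (sum-zero λ j → trans (*-congʳ (trans (*-congˡ (upper zero j)) (zeroʳ _))) (zeroˡ _)) ⟩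
    sum (λ j → (- 1#) ^ toℕ j * A zero j * det (minor A j) * det D) + 0#
      ≈⟨ +-identityʳ _ ⟩
    sum (λ j → (- 1#) ^ toℕ j * A zero j * det (minor A j) * det D)
      ≈⟨ *-distribʳ-sum (det D) (λ j → (- 1#) ^ toℕ j * A zero j * det (minor A j)) ⟨
    det A * det D ∎
    where
    A : Matrix (suc n)
    A i j = M (i ↑ˡ m) (j ↑ˡ m)
    D : Matrix m
    D i j = M (suc n ↑ʳ i) (suc n ↑ʳ j)
    minor : ∀ {n} → Matrix (suc n) → Fin (suc n) → Matrix n
    minor N j i k = N (suc i) (punchIn j k)
    term : Vector Carrier (suc n ℕ.+ m)
    term j = (- 1#) ^ toℕ j * M zero j * det (minor M j)
    left-term : ∀ j → term (j ↑ˡ m) ≈ (- 1#) ^ toℕ j * A zero j * det (minor A j) * det D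
    left-term j = begin
      (- 1#) ^ toℕ (j ↑ˡ m) * A zero j * det (minor M (j ↑ˡ m))
        ≡⟨ ≡.cong (λ k → (- 1#) ^ k * A zero j * det (minor M (j ↑ˡ m))) (toℕ-↑ˡ j m) ⟩
      (- 1#) ^ toℕ j * A zero j * det (minor M (j ↑ˡ m))
        ≈⟨ *-congˡ (det-lowerBlock n (minor M (j ↑ˡ m)) (λ i k →
             trans (reflexive (≡.cong (M (suc (i ↑ˡ m))) (punchIn-↑ˡ-↑ʳ m j k))) (upper (suc i) k))) ⟩
      (- 1#) ^ toℕ j * A zero j *
        (det {n} (λ i k → M (suc (i ↑ˡ m)) (punchIn (j ↑ˡ m) (k ↑ˡ m))) *
         det {m} (λ i k → M (suc (n ↑ʳ i)) (punchIn (j ↑ˡ m) (n ↑ʳ k))))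
        ≈⟨ *-congˡ (*-cong
             (det-cong {n} λ i k → reflexive (≡.cong (M (suc (i ↑ˡ m))) (punchIn-↑ˡ-↑ˡ m j k)))
             (det-cong {m} λ i k → reflexive (≡.cong (M (suc (n ↑ʳ i))) (punchIn-↑ˡ-↑ʳ m j k)))) ⟩
      (- 1#) ^ toℕ j * A zero j * (det (minor A j) * det D)
        ≈⟨ *-assoc _ _ _ ⟨
      (- 1#) ^ toℕ j * A zero j * det (minor A j) * det D ∎

  block : ∀ {n m} → Matrix n → Rect n m → Rect m n → Matrix m → Matrix (n ℕ.+ m)
  block {n} A B C D i j = entry (splitAt n i) (splitAt n j)
    where
    entry : _ ⊎ _ → _ ⊎ _ → Carrier
    entry (inj₁ i) (inj₁ j) = A i j
    entry (inj₁ i) (inj₂ j) = B i j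
    entry (inj₂ i) (inj₁ j) = C i j
    entry (inj₂ i) (inj₂ j) = D i j

  module _ {n m} (A : Matrix n) (B : Rect n m) (C : Rect m n) (D : Matrix m) where

    block-₁₁ : ∀ i j → block A B C D (i ↑ˡ m) (j ↑ˡ m) ≈ A i j
    block-₁₁ i j rewrite splitAt-↑ˡ n i m | splitAt-↑ˡ n j m = refl

    block-₁₂ : ∀ i j → block A B C D (i ↑ˡ m) (n ↑ʳ j) ≈ B i j
    block-₁₂ i j rewrite splitAt-↑ˡ n i m | splitAt-↑ʳ n m j = refl

    block-₂₁ : ∀ i j → block A B C D (n ↑ʳ i) (j ↑ˡ m) ≈ C i j
    block-₂₁ i j rewrite splitAt-↑ʳ n m i | splitAt-↑ˡ n j m = refl

    block-₂₂ : ∀ i j → block A B C D (n ↑ʳ i) (n ↑ʳ j) ≈ D i j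
    block-₂₂ i j rewrite splitAt-↑ʳ n m i | splitAt-↑ʳ n m j = refl

    block-unique : ∀ {M : Matrix (n ℕ.+ m)} →
      (∀ i j → M (i ↑ˡ m) (j ↑ˡ m) ≈ A i j) → (∀ i j → M (i ↑ˡ m) (n ↑ʳ j) ≈ B i j) →
      (∀ i j → M (n ↑ʳ i) (j ↑ˡ m) ≈ C i j) → (∀ i j → M (n ↑ʳ i) (n ↑ʳ j) ≈ D i j) →
      M ≈ᴹ block A B C D
    block-unique a b c d i j with splitView n m i | splitView n m j
    ... | left i  | left j  = trans (a i j) (sym (block-₁₁ i j))
    ... | left i  | right j = trans (b i j) (sym (block-₁₂ i j))
    ... | right i | left j  = trans (c i j) (sym (block-₂₁ i j))
    ... | right i | right j = trans (d i j) (sym (block-₂₂ i j))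

    det-block-lower : B ≈ᴹ (λ _ _ → 0#) → det (block A B C D) ≈ det A * det D
    det-block-lower B≈0 = trans
      (det-lowerBlock n (block A B C D) λ i j → trans (block-₁₂ i j) (B≈0 i j))
      (*-cong (det-cong block-₁₁) (det-cong block-₂₂))

  0ᴹ : ∀ {n m} → Rect n m
  0ᴹ _ _ = 0#

  det-block-unitriangular : ∀ {n m} (B : Rect n m) → det (block 1ᴹ B 0ᴹ 1ᴹ) ≈ 1#
  det-block-unitriangular {n} {m} B = begin
    det (block 1ᴹ B 0ᴹ 1ᴹ)       ≈⟨ det-ᵀ (block 1ᴹ B 0ᴹ 1ᴹ) ⟨
    det (block 1ᴹ B 0ᴹ 1ᴹ ᵀ)
      ≈⟨ det-cong (block-unique 1ᴹ 0ᴹ (B ᵀ) 1ᴹ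
           (λ i j → trans (block-₁₁ 1ᴹ B 0ᴹ 1ᴹ j i) (diag-sym (λ _ → 1#) j i))
           (λ i j → block-₂₁ 1ᴹ B 0ᴹ 1ᴹ j i)
           (λ i j → block-₁₂ 1ᴹ B 0ᴹ 1ᴹ j i)
           (λ i j → trans (block-₂₂ 1ᴹ B 0ᴹ 1ᴹ j i) (diag-sym (λ _ → 1#) j i))) ⟩
    det (block 1ᴹ 0ᴹ (B ᵀ) 1ᴹ)   ≈⟨ det-block-lower 1ᴹ 0ᴹ (B ᵀ) 1ᴹ (λ _ _ → refl) ⟩
    det (1ᴹ {n}) * det (1ᴹ {m})  ≈⟨ *-cong (det-1ᴹ {n}) (det-1ᴹ {m}) ⟩
    1# * 1#                      ≈⟨ *-identityˡ 1# ⟩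
    1#                           ∎

  infixl 6 _⊕_
  _⊕_ : ∀ {n m} → Rect n m → Rect n m → Rect n m
  (M ⊕ N) i j = M i j + N i j

  infixl 8 _⊛_
  _⊛_ : ∀ {n m} → Carrier → Rect n m → Rect n m
  (x ⊛ M) i j = x * M i j

  module _ {n m} {A A′ : Matrix n} {B B′ : Rect n m} {C C′ : Rect m n} {D D′ : Matrix m} where

    private
      M N : Matrix (n ℕ.+ m)
      M = block A B C D
      N = block A′ B′ C′ D′

      split : ∀ i j → (M ·ᴹ N) i j ≈
        sum {n} (λ k → M i (k ↑ˡ m) * N (k ↑ˡ m) j) + sum {m} (λ k → M i (n ↑ʳ k) * N (n ↑ʳ k) j)
      split i j = sum-split n (λ k → M i k * N k j)

    block-·ᴹ : block A B C D ·ᴹ block A′ B′ C′ D′ ≈ᴹ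
      block (A ·ᴹ A′ ⊕ B ·ᴹ C′) (A ·ᴹ B′ ⊕ B ·ᴹ D′) (C ·ᴹ A′ ⊕ D ·ᴹ C′) (C ·ᴹ B′ ⊕ D ·ᴹ D′)
    block-·ᴹ = block-unique _ _ _ _
      (λ i j → trans (split (i ↑ˡ m) (j ↑ˡ m)) (+-cong
        (sum-cong-≋ λ k → *-cong (block-₁₁ A B C D i k) (block-₁₁ A′ B′ C′ D′ k j))
        (sum-cong-≋ λ k → *-cong (block-₁₂ A B C D i k) (block-₂₁ A′ B′ C′ D′ k j))))
      (λ i j → trans (split (i ↑ˡ m) (n ↑ʳ j)) (+-cong
        (sum-cong-≋ λ k → *-cong (block-₁₁ A B C D i k) (block-₁₂ A′ B′ C′ D′ k j))
        (sum-cong-≋ λ k → *-cong (block-₁₂ A B C D i k) (block-₂₂ A′ B′ C′ D′ k j))))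
      (λ i j → trans (split (n ↑ʳ i) (j ↑ˡ m)) (+-cong
        (sum-cong-≋ λ k → *-cong (block-₂₁ A B C D i k) (block-₁₁ A′ B′ C′ D′ k j))
        (sum-cong-≋ λ k → *-cong (block-₂₂ A B C D i k) (block-₂₁ A′ B′ C′ D′ k j))))
      (λ i j → trans (split (n ↑ʳ i) (n ↑ʳ j)) (+-cong
        (sum-cong-≋ λ k → *-cong (block-₂₁ A B C D i k) (block-₁₂ A′ B′ C′ D′ k j))
        (sum-cong-≋ λ k → *-cong (block-₂₂ A B C D i k) (block-₂₂ A′ B′ C′ D′ k j))))

  block-cong : ∀ {n m} {A A′ : Matrix n} {B B′ : Rect n m} {C C′ : Rect m n} {D D′ : Matrix m} →
    A ≈ᴹ A′ → B ≈ᴹ B′ → C ≈ᴹ C′ → D ≈ᴹ D′ → block A B C D ≈ᴹ block A′ B′ C′ D′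
  block-cong {A = A} {B = B} {C = C} {D = D} a b c d = block-unique _ _ _ _
    (λ i j → trans (block-₁₁ A B C D i j) (a i j))
    (λ i j → trans (block-₁₂ A B C D i j) (b i j))
    (λ i j → trans (block-₂₁ A B C D i j) (c i j))
    (λ i j → trans (block-₂₂ A B C D i j) (d i j))

  scalar-·ᴹ : ∀ {n m} x (M : Rect n m) → scalar x ·ᴹ M ≈ᴹ x ⊛ M
  scalar-·ᴹ x M i j = sum-diagˡ (λ _ → x) (λ k → M k j) i

  scalar-⊛ : ∀ {n} x → scalar {n} x ≈ᴹ x ⊛ 1ᴹ
  scalar-⊛ x i j with i ≟ j
  ... | yes _ = sym (*-identityʳ x)
  ... | no  _ = sym (zeroʳ x)

  1ᴹ-·ᴹ : ∀ {n m} (M : Rect n m) → 1ᴹ ·ᴹ M ≈ᴹ M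
  1ᴹ-·ᴹ M i j = trans (scalar-·ᴹ 1# M i j) (*-identityˡ _)

  ·ᴹ-scalar : ∀ {n m} (M : Rect n m) x → M ·ᴹ scalar x ≈ᴹ x ⊛ M
  ·ᴹ-scalar M x i j = trans (sum-diagʳ (λ _ → x) (M i) j) (*-comm _ _)

  ·ᴹ-1ᴹ : ∀ {n m} (M : Rect n m) → M ·ᴹ 1ᴹ ≈ᴹ M
  ·ᴹ-1ᴹ M i j = trans (·ᴹ-scalar M 1# i j) (*-identityˡ _)

  0ᴹ-·ᴹ : ∀ {n m l} (M : Rect m l) → 0ᴹ {n} ·ᴹ M ≈ᴹ 0ᴹ
  0ᴹ-·ᴹ M i j = sum-zero λ k → zeroˡ (M k j)

  ·ᴹ-0ᴹ : ∀ {n m l} (M : Rect n m) → M ·ᴹ 0ᴹ {m} {l} ≈ᴹ 0ᴹ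
  ·ᴹ-0ᴹ M i j = sum-zero λ k → zeroʳ (M i k)

  ⊛-·ᴹ : ∀ {n m l} x (M : Rect n m) (N : Rect m l) → (x ⊛ M) ·ᴹ N ≈ᴹ x ⊛ (M ·ᴹ N)
  ⊛-·ᴹ x M N i j = trans (sum-cong-≋ λ k → *-assoc x (M i k) (N k j))
    (sym (*-distribˡ-sum x λ k → M i k * N k j))

  -- The matrix is a product `U ·ᴹ L`, where `U` is upper unitriangular with corner x⁻¹B, and `L` is
  -- lower triangular with diagonal blocks A - x⁻¹BC and x. As the last block is scalar, only the
  -- scalar x has to be inverted.
  schur : ∀ {n m} (A : Matrix n) (B : Rect n m) (C : Rect m n) {x x⁻¹} → x⁻¹ * x ≈ 1# →
    det (block A B C (scalar x)) ≈ det (A ⊕ (- x⁻¹) ⊛ (B ·ᴹ C)) * det (scalar {m} x)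
  schur {n} {m} A B C {x} {x⁻¹} x⁻¹x≈1 = begin
    det (block A B C (scalar x))
      ≈⟨ det-cong factor ⟩
    det (U ·ᴹ L)
      ≈⟨ det-·ᴹ U L ⟩
    det U * det L
      ≈⟨ *-cong (det-block-unitriangular (x⁻¹ ⊛ B))
           (det-block-lower (A ⊕ (- x⁻¹) ⊛ (B ·ᴹ C)) 0ᴹ C (scalar x) (λ _ _ → refl)) ⟩
    1# * (det (A ⊕ (- x⁻¹) ⊛ (B ·ᴹ C)) * det (scalar {m} x))
      ≈⟨ *-identityˡ _ ⟩
    det (A ⊕ (- x⁻¹) ⊛ (B ·ᴹ C)) * det (scalar {m} x) ∎
    where
    U L : Matrix (n ℕ.+ m)
    U = block 1ᴹ (x⁻¹ ⊛ B) 0ᴹ 1ᴹ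
    L = block (A ⊕ (- x⁻¹) ⊛ (B ·ᴹ C)) 0ᴹ C (scalar x)
    factor : block A B C (scalar x) ≈ᴹ U ·ᴹ L
    factor i j = trans (block-cong
      (λ i j → begin
        A i j
          ≈⟨ solve 3 (λ a y z → a := a :+ (:- y) :* z :+ y :* z) refl (A i j) x⁻¹ ((B ·ᴹ C) i j) ⟩
        A i j + (- x⁻¹) * (B ·ᴹ C) i j + x⁻¹ * (B ·ᴹ C) i j
          ≈⟨ +-cong (1ᴹ-·ᴹ (A ⊕ (- x⁻¹) ⊛ (B ·ᴹ C)) i j) (⊛-·ᴹ x⁻¹ B C i j) ⟨
        (1ᴹ ·ᴹ (A ⊕ (- x⁻¹) ⊛ (B ·ᴹ C)) ⊕ (x⁻¹ ⊛ B) ·ᴹ C) i j ∎)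
      (λ i j → begin
        B i j
          ≈⟨ *-identityˡ _ ⟨
        1# * B i j
          ≈⟨ *-congʳ x⁻¹x≈1 ⟨
        x⁻¹ * x * B i j
          ≈⟨ solve 3 (λ x y b → y :* x :* b := :0 :+ x :* (y :* b)) refl x x⁻¹ (B i j) ⟩
        0# + x * (x⁻¹ * B i j)
          ≈⟨ +-cong (·ᴹ-0ᴹ {l = m} (1ᴹ {n}) i j) (·ᴹ-scalar (x⁻¹ ⊛ B) x i j) ⟨
        (1ᴹ ·ᴹ 0ᴹ ⊕ (x⁻¹ ⊛ B) ·ᴹ scalar x) i j ∎)
      (λ i j → begin
        C i j
          ≈⟨ +-identityˡ _ ⟨
        0# + C i j
          ≈⟨ +-cong (0ᴹ-·ᴹ {m} (A ⊕ (- x⁻¹) ⊛ (B ·ᴹ C)) i j) (1ᴹ-·ᴹ C i j) ⟨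
        (0ᴹ ·ᴹ (A ⊕ (- x⁻¹) ⊛ (B ·ᴹ C)) ⊕ 1ᴹ ·ᴹ C) i j ∎)
      (λ i j → begin
        scalar x i j
          ≈⟨ +-identityˡ _ ⟨
        0# + scalar x i j
          ≈⟨ +-cong (0ᴹ-·ᴹ {m} (0ᴹ {n} {m}) i j) (1ᴹ-·ᴹ (scalar {m} x) i j) ⟨
        (0ᴹ {m} {n} ·ᴹ 0ᴹ ⊕ 1ᴹ ·ᴹ scalar x) i j ∎)
      i j)
      (sym (block-·ᴹ {A = 1ᴹ} {A ⊕ (- x⁻¹) ⊛ (B ·ᴹ C)} {x⁻¹ ⊛ B} {0ᴹ} {0ᴹ} {C} {1ᴹ} {scalar x} i j))

  𝐉 : ∀ {n m} → Rect n m
  𝐉 _ _ = 1#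

  RowSums : ∀ {n} → Matrix n → Carrier → Set ℓ
  RowSums M r = ∀ i → sum (M i) ≈ r

  ·ᴹ-𝐉 : ∀ {n m} {M : Matrix n} {r} x → RowSums M r → M ·ᴹ (x ⊛ 𝐉 {n} {m}) ≈ᴹ (x * r) ⊛ 𝐉
  ·ᴹ-𝐉 {M = M} {r} x rows i j = begin
    sum (λ k → M i k * (x * 1#))  ≈⟨ *-distribʳ-sum (x * 1#) (M i) ⟨
    sum (M i) * (x * 1#)          ≈⟨ *-congʳ (rows i) ⟩
    r * (x * 1#)                  ≈⟨ solve 2 (λ r x → r :* (x :* :1) := x :* r :* :1) refl r x ⟩
    x * r * 1#                    ∎

  -- A and D act on 𝐉 as the scalars π and d, so diag(A, D) can be taken
  -- out of the block matrix, leaving a factor independent of A and D.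
  det-𝐉-perturbation : ∀ {n m} (A : Matrix n) (D : Matrix m) σ γ {π π⁻¹ d d⁻¹} →
    RowSums A π → RowSums D d → π⁻¹ * π ≈ 1# → d⁻¹ * d ≈ 1# →
    det (block (A ⊕ σ ⊛ 𝐉) (γ ⊛ 𝐉) (γ ⊛ 𝐉) D) ≈
    det A * det D * det (block (1ᴹ {n} ⊕ (σ * π⁻¹) ⊛ 𝐉) ((γ * π⁻¹) ⊛ 𝐉) ((γ * d⁻¹) ⊛ 𝐉) (1ᴹ {m}))
  det-𝐉-perturbation {n} {m} A D σ γ {π} {π⁻¹} {d} {d⁻¹} rowsA rowsD π⁻¹π≈1 d⁻¹d≈1 = begin
    det (block (A ⊕ σ ⊛ 𝐉) (γ ⊛ 𝐉) (γ ⊛ 𝐉) D)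
      ≈⟨ det-cong factor ⟩
    det (block A 0ᴹ (0ᴹ {m} {n}) D ·ᴹ R)
      ≈⟨ det-·ᴹ (block A 0ᴹ (0ᴹ {m} {n}) D) R ⟩
    det (block A 0ᴹ (0ᴹ {m} {n}) D) * det R
      ≈⟨ *-congʳ (det-block-lower A 0ᴹ 0ᴹ D (λ _ _ → refl)) ⟩
    det A * det D * det R ∎
    where
    R : Matrix (n ℕ.+ m)
    R = block {n} {m} (1ᴹ ⊕ (σ * π⁻¹) ⊛ 𝐉) ((γ * π⁻¹) ⊛ 𝐉) ((γ * d⁻¹) ⊛ 𝐉) 1ᴹ
    cancel : ∀ x {y y⁻¹} → y⁻¹ * y ≈ 1# → x ≈ x * y⁻¹ * y
    cancel x {y} {y⁻¹} e = sym (trans (*-assoc x y⁻¹ y) (trans (*-congˡ e) (*-identityʳ x)))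
    factor : block (A ⊕ σ ⊛ 𝐉) (γ ⊛ 𝐉) (γ ⊛ 𝐉) D ≈ᴹ block A 0ᴹ (0ᴹ {m} {n}) D ·ᴹ R
    factor i j = trans (block-cong
      (λ i j → begin
        A i j + σ * 1#
          ≈⟨ +-congˡ (*-congʳ (cancel σ π⁻¹π≈1)) ⟩
        A i j + σ * π⁻¹ * π * 1#
          ≈⟨ +-cong (·ᴹ-1ᴹ A i j) (·ᴹ-𝐉 {m = n} (σ * π⁻¹) rowsA i j) ⟨
        (A ·ᴹ 1ᴹ) i j + (A ·ᴹ ((σ * π⁻¹) ⊛ 𝐉)) i j
          ≈⟨ ∑-distrib-+ (λ k → A i k * 1ᴹ k j) (λ k → A i k * (σ * π⁻¹ * 1#)) ⟨
        sum (λ k → A i k * 1ᴹ k j + A i k * (σ * π⁻¹ * 1#))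
          ≈⟨ sum-cong-≋ (λ k → distribˡ (A i k) (1ᴹ k j) (σ * π⁻¹ * 1#)) ⟨
        (A ·ᴹ (1ᴹ ⊕ (σ * π⁻¹) ⊛ 𝐉)) i j
          ≈⟨ +-identityʳ _ ⟨
        (A ·ᴹ (1ᴹ ⊕ (σ * π⁻¹) ⊛ 𝐉)) i j + 0#
          ≈⟨ +-congˡ (0ᴹ-·ᴹ {n} ((γ * d⁻¹) ⊛ 𝐉 {m} {n}) i j) ⟨
        (A ·ᴹ (1ᴹ ⊕ (σ * π⁻¹) ⊛ 𝐉) ⊕ 0ᴹ {n} {m} ·ᴹ ((γ * d⁻¹) ⊛ 𝐉)) i j ∎)
      (λ i j → begin
        γ * 1#
          ≈⟨ *-congʳ (cancel γ π⁻¹π≈1) ⟩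
        γ * π⁻¹ * π * 1#
          ≈⟨ +-identityʳ _ ⟨
        γ * π⁻¹ * π * 1# + 0#
          ≈⟨ +-cong (·ᴹ-𝐉 {m = m} (γ * π⁻¹) rowsA i j) (0ᴹ-·ᴹ {n} (1ᴹ {m}) i j) ⟨
        (A ·ᴹ ((γ * π⁻¹) ⊛ 𝐉) ⊕ 0ᴹ {n} {m} ·ᴹ 1ᴹ) i j ∎)
      (λ i j → begin
        γ * 1#
          ≈⟨ *-congʳ (cancel γ d⁻¹d≈1) ⟩
        γ * d⁻¹ * d * 1#
          ≈⟨ +-identityˡ _ ⟨
        0# + γ * d⁻¹ * d * 1#
          ≈⟨ +-cong (0ᴹ-·ᴹ {m} (1ᴹ {n} ⊕ (σ * π⁻¹) ⊛ 𝐉) i j) (·ᴹ-𝐉 {m = n} (γ * d⁻¹) rowsD i j) ⟨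
        (0ᴹ {m} {n} ·ᴹ (1ᴹ ⊕ (σ * π⁻¹) ⊛ 𝐉) ⊕ D ·ᴹ ((γ * d⁻¹) ⊛ 𝐉)) i j ∎)
      (λ i j → begin
        D i j
          ≈⟨ +-identityˡ _ ⟨
        0# + D i j
          ≈⟨ +-cong (0ᴹ-·ᴹ {m} ((γ * π⁻¹) ⊛ 𝐉 {n} {m}) i j) (·ᴹ-1ᴹ D i j) ⟨
        (0ᴹ {m} {n} ·ᴹ ((γ * π⁻¹) ⊛ 𝐉) ⊕ D ·ᴹ 1ᴹ) i j ∎)
      i j)
      (sym (block-·ᴹ {A = A} {1ᴹ ⊕ (σ * π⁻¹) ⊛ 𝐉} {0ᴹ} {(γ * π⁻¹) ⊛ 𝐉} {0ᴹ} {(γ * d⁻¹) ⊛ 𝐉} {D} {1ᴹ} i j))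

-- The determinant of a matrix of join shape

module JoinDeterminant {c ℓ} (K : CommutativeRing c ℓ) where

  open CommutativeRing K hiding (zero)
  open SemiringSum semiring using (sum-cong-≋; ∑-distrib-+; ∑-comm; sum-replicate; *-distribˡ-sum; *-distribʳ-sum)
  open Matrices K
  open MatrixAlgebra K
  open BlockMatrices K
  open IntegerCoefficients K
  open SetoidReasoning setoid

  quadratic : ∀ {n} → Carrier → Carrier → Carrier → Matrix n → Matrix n
  quadratic c₀ c₁ c₂ A = scalar c₀ ⊕ c₁ ⊛ A ⊕ c₂ ⊛ (A ·ᴹ A)

  linear : ∀ {n} → Carrier → Carrier → Matrix n → Matrix n
  linear c₀ c₁ A = scalar c₀ ⊕ c₁ ⊛ A

  sum-⊕ : ∀ {n} {f g : Vector Carrier n} {x y} →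
    sum f ≈ x → sum g ≈ y → sum (λ k → f k + g k) ≈ x + y
  sum-⊕ {f = f} {g} f≈x g≈y = trans (∑-distrib-+ f g) (+-cong f≈x g≈y)

  sum-⊛ : ∀ {n} a {f : Vector Carrier n} {x} → sum f ≈ x → sum (λ k → a * f k) ≈ a * x
  sum-⊛ a {f} f≈x = trans (sym (*-distribˡ-sum a f)) (*-congˡ f≈x)

  sum-scalar : ∀ {n} x (i : Fin n) → sum (scalar {n} x i) ≈ x
  sum-scalar x i = begin
    sum (scalar x i)               ≈⟨ sum-cong-≋ (λ k → *-identityʳ (scalar x i k)) ⟨
    sum (λ k → scalar x i k * 1#)  ≈⟨ sum-diagˡ (λ _ → x) (λ _ → 1#) i ⟩
    x * 1#                         ≈⟨ *-identityʳ x ⟩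
    x                              ∎

  sum-1 : ∀ n → sum {n} (λ _ → 1#) ≈ fromℕ n
  sum-1 n = sum-replicate n

  linear-rowSums : ∀ {n} {A : Matrix n} {r} c₀ c₁ → RowSums A r → RowSums (linear c₀ c₁ A) (c₀ + c₁ * r)
  linear-rowSums {n} c₀ c₁ rows i = sum-⊕ {n} (sum-scalar c₀ i) (sum-⊛ {n} c₁ (rows i))

  square-rowSums : ∀ {n} {A : Matrix n} {r} → RowSums A r → RowSums (A ·ᴹ A) (r * r)
  square-rowSums {n} {A} {r} rows i = begin
    sum (λ j → sum λ k → A i k * A k j)  ≈⟨ ∑-comm (λ j k → A i k * A k j) ⟩
    sum (λ k → sum λ j → A i k * A k j)  ≈⟨ sum-cong-≋ (λ k → sum-⊛ {n} (A i k) (rows k)) ⟩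
    sum (λ k → A i k * r)                ≈⟨ *-distribʳ-sum r (A i) ⟨
    sum (A i) * r                        ≈⟨ *-congʳ (rows i) ⟩
    r * r                                ∎

  quadratic-rowSums : ∀ {n} {A : Matrix n} {r} c₀ c₁ c₂ → RowSums A r →
    RowSums (quadratic c₀ c₁ c₂ A) (c₀ + c₁ * r + c₂ * (r * r))
  quadratic-rowSums {n} {A} c₀ c₁ c₂ rows i =
    sum-⊕ {n} (linear-rowSums {n} {A} c₀ c₁ rows i) (sum-⊛ {n} c₂ (square-rowSums {n} {A} rows i))

  complement : ∀ {n} → Matrix n → Matrix n
  complement A i j = 1# - (1ᴹ i j + A i j)

  -- This is (J - (I + A))². Here J² = nJ, each of the two mixed products is (1 + r)J because the
  -- row sums of a symmetric A are also its column sums, and (I + A)² remains. The first factor is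
  -- transposed, as it occurs in the Schur complement.
  square-complement : ∀ {n} {A : Matrix n} {r} → RowSums A r → A ᵀ ≈ᴹ A → ∀ i j →
    sum (λ k → complement A k i * complement A k j) ≈
    (fromℕ n - (1# + r) - (1# + r)) + (1ᴹ i j + (A i j + A i j) + (A ·ᴹ A) i j)
  square-complement {n} {A} {r} rows symmetric i j = begin
    sum (λ k → complement A k i * complement A k j)
      ≈⟨ sum-cong-≋ (λ k → trans
           (*-congʳ (+-congˡ (-‿cong (+-cong (diag-sym (λ _ → 1#) k i) (symmetric i k)))))
           (solve 4 (λ e a f b → (:1 :- (e :+ a)) :* (:1 :- (f :+ b)) :=
             :1 :+ (:- :1) :* (f :+ b) :+ (:- :1) :* (e :+ a) :+
             (e :* f :+ e :* b :+ (a :* f :+ a :* b)))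
             refl (1ᴹ i k) (A i k) (1ᴹ k j) (A k j))) ⟩
    sum (λ k → 1# + (- 1#) * (1ᴹ k j + A k j) + (- 1#) * (1ᴹ i k + A i k) +
               (1ᴹ i k * 1ᴹ k j + 1ᴹ i k * A k j + (A i k * 1ᴹ k j + A i k * A k j)))
      ≈⟨ sum-⊕ {n} (sum-⊕ {n} (sum-⊕ {n} (sum-1 n) (sum-⊛ {n} (- 1#) (sum-⊕ {n} colOne colA)))
                      (sum-⊛ {n} (- 1#) (sum-⊕ {n} (sum-scalar 1# i) (rows i))))
               (sum-⊕ {n} (sum-⊕ {n} (1ᴹ-·ᴹ 1ᴹ i j) (1ᴹ-·ᴹ A i j)) (sum-⊕ {n} (·ᴹ-1ᴹ A i j) refl)) ⟩
    fromℕ n + (- 1#) * (1# + r) + (- 1#) * (1# + r) +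
      (1ᴹ i j + A i j + (A i j + (A ·ᴹ A) i j))
      ≈⟨ solve 5 (λ n r e a s → n :+ (:- :1) :* (:1 :+ r) :+ (:- :1) :* (:1 :+ r) :+
             (e :+ a :+ (a :+ s)) :=
             (n :- (:1 :+ r) :- (:1 :+ r)) :+ (e :+ (a :+ a) :+ s))
           refl (fromℕ n) r (1ᴹ i j) (A i j) ((A ·ᴹ A) i j) ⟩
    (fromℕ n - (1# + r) - (1# + r)) + (1ᴹ i j + (A i j + A i j) + (A ·ᴹ A) i j) ∎
    where
    colOne : sum (λ k → 1ᴹ k j) ≈ 1#
    colOne = trans (sum-cong-≋ λ k → diag-sym (λ _ → 1#) k j) (sum-scalar 1# j)
    colA : sum (λ k → A k j) ≈ r
    colA = trans (sum-cong-≋ λ k → symmetric j k) (rows j)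

  newRows : ∀ {n} m → Carrier → Matrix n → Rect n (n ℕ.+ m)
  newRows {n} m δ A i v = [ (λ j → δ * complement A i j) , (λ _ → 0#) ]′ (splitAt n v)

  -- The shape of xI − X(G ∨₌ H) for each of the four matrices X, when G
  -- and H are regular with adjacency matrices A and B.
  joinMatrix : ∀ {n m} (p q γ δ a b x : Carrier) → Matrix n → Matrix m → Matrix ((n ℕ.+ m) ℕ.+ n)
  joinMatrix {n} {m} p q γ δ a b x A B =
    block (block (linear p q A) (γ ⊛ 𝐉) (γ ⊛ 𝐉) (linear a b B))
      (newRows m δ A ᵀ) (newRows m δ A) (scalar x)

  -- The Schur complement subtracts x⁻¹δ²C² from p + qA. Expanding C² by `square-complement` sends
  -- `c₂` = -x⁻¹δ² to A² and to I, twice `c₂` to A, and the multiple `σ` to J. The other two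
  -- inverted scalars are the eigenvalues of the quadratic in A and of a + bB at the all-ones
  -- vector.
  det-joinMatrix : ∀ {n m} {A : Matrix n} {B : Matrix m} {r s} p q γ δ a b x {x⁻¹ π⁻¹ d⁻¹} →
    RowSums A r → A ᵀ ≈ᴹ A → RowSums B s →
    let c₂ = - x⁻¹ * (δ * δ)
        c₁ = q + (c₂ + c₂)
        c₀ = p + c₂
        σ  = c₂ * (fromℕ n - (1# + r) - (1# + r))
    in
    x⁻¹ * x ≈ 1# → π⁻¹ * (c₀ + c₁ * r + c₂ * (r * r)) ≈ 1# → d⁻¹ * (a + b * s) ≈ 1# →
    det (joinMatrix p q γ δ a b x A B) ≈
    det (quadratic c₀ c₁ c₂ A) * det (linear a b B) *
    det (block (1ᴹ {n} ⊕ (σ * π⁻¹) ⊛ 𝐉) ((γ * π⁻¹) ⊛ 𝐉) ((γ * d⁻¹) ⊛ 𝐉) (1ᴹ {m})) *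
    det (scalar {n} x)
  det-joinMatrix {n} {m} {A} {B} {r} {s} p q γ δ a b x {x⁻¹} {π⁻¹} {d⁻¹} rowsA symmetric rowsB x≉0 π≉0 d≉0 =
    begin
    det (joinMatrix p q γ δ a b x A B)
      ≈⟨ schur (block (linear p q A) (γ ⊛ 𝐉) (γ ⊛ 𝐉) (linear a b B)) (new ᵀ) new x≉0 ⟩
    det (block (linear p q A) (γ ⊛ 𝐉) (γ ⊛ 𝐉) (linear a b B) ⊕ (- x⁻¹) ⊛ (new ᵀ ·ᴹ new)) * det (scalar {n} x)
      ≈⟨ *-congʳ (det-cong (block-unique (quadratic c₀ c₁ c₂ A ⊕ σ ⊛ 𝐉) (γ ⊛ 𝐉) (γ ⊛ 𝐉) (linear a b B)
           entry₁₁ entry₁₂ entry₂₁ entry₂₂)) ⟩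
    det (block (quadratic c₀ c₁ c₂ A ⊕ σ ⊛ 𝐉) (γ ⊛ 𝐉) (γ ⊛ 𝐉) (linear a b B)) * det (scalar {n} x)
      ≈⟨ *-congʳ (det-𝐉-perturbation (quadratic c₀ c₁ c₂ A) (linear a b B) σ γ
           (quadratic-rowSums c₀ c₁ c₂ rowsA) (linear-rowSums a b rowsB) π≉0 d≉0) ⟩
    det (quadratic c₀ c₁ c₂ A) * det (linear a b B) *
      det (block (1ᴹ {n} ⊕ (σ * π⁻¹) ⊛ 𝐉) ((γ * π⁻¹) ⊛ 𝐉) ((γ * d⁻¹) ⊛ 𝐉) (1ᴹ {m})) *
      det (scalar {n} x) ∎
    where
    c₂ c₁ c₀ σ : Carrier
    c₂ = - x⁻¹ * (δ * δ)
    c₁ = q + (c₂ + c₂)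
    c₀ = p + c₂
    σ  = c₂ * (fromℕ n - (1# + r) - (1# + r))

    new : Rect n (n ℕ.+ m)
    new = newRows m δ A

    old : Matrix (n ℕ.+ m)
    old = block (linear p q A) (γ ⊛ 𝐉) (γ ⊛ 𝐉) (linear a b B)

    new-left : ∀ i j → new i (j ↑ˡ m) ≈ δ * complement A i j
    new-left i j rewrite splitAt-↑ˡ n j m = refl

    new-right : ∀ i j → new i (n ↑ʳ j) ≈ 0#
    new-right i j rewrite splitAt-↑ʳ n m j = refl

    entry₁₁ : ∀ i j → (old ⊕ (- x⁻¹) ⊛ (new ᵀ ·ᴹ new)) (i ↑ˡ m) (j ↑ˡ m) ≈ (quadratic c₀ c₁ c₂ A ⊕ σ ⊛ 𝐉) i j
    entry₁₁ i j = begin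
      old (i ↑ˡ m) (j ↑ˡ m) + - x⁻¹ * sum (λ k → new k (i ↑ˡ m) * new k (j ↑ˡ m))
        ≈⟨ +-cong (block-₁₁ (linear p q A) (γ ⊛ 𝐉) (γ ⊛ 𝐉) (linear a b B) i j)
             (*-congˡ (sum-cong-≋ λ k → trans (*-cong (new-left k i) (new-left k j))
               (solve 3 (λ δ u v → δ :* u :* (δ :* v) := δ :* δ :* (u :* v)) refl
                 δ (complement A k i) (complement A k j)))) ⟩
      scalar p i j + q * A i j + - x⁻¹ * sum (λ k → δ * δ * (complement A k i * complement A k j))
        ≈⟨ +-cong (+-congʳ (scalar-⊛ p i j)) (*-congˡ (sum-⊛ {n} (δ * δ) (square-complement rowsA symmetric i j))) ⟩
      p * 1ᴹ i j + q * A i j + - x⁻¹ * (δ * δ * (N + (1ᴹ i j + (A i j + A i j) + (A ·ᴹ A) i j)))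
        ≈⟨ solve 8 (λ p e q a y δ n s → p :* e :+ q :* a :+ y :* (δ :* (n :+ (e :+ (a :+ a) :+ s))) :=
             (p :+ y :* δ) :* e :+ (q :+ (y :* δ :+ y :* δ)) :* a :+ y :* δ :* s :+ y :* δ :* n :* :1)
             refl p (1ᴹ i j) q (A i j) (- x⁻¹) (δ * δ) N ((A ·ᴹ A) i j) ⟩
      c₀ * 1ᴹ i j + c₁ * A i j + c₂ * (A ·ᴹ A) i j + σ * 1#
        ≈⟨ +-congʳ (+-congʳ (+-congʳ (scalar-⊛ c₀ i j))) ⟨
      scalar c₀ i j + c₁ * A i j + c₂ * (A ·ᴹ A) i j + σ * 1# ∎
      where
      N : Carrier
      N = fromℕ n - (1# + r) - (1# + r)

    vanish : ∀ {u} y {t : Vector Carrier n} → (∀ k → t k ≈ 0#) → u + y * sum t ≈ u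
    vanish y t≈0 = trans (+-congˡ (trans (*-congˡ (sum-zero t≈0)) (zeroʳ y))) (+-identityʳ _)

    entry₁₂ : ∀ i j → (old ⊕ (- x⁻¹) ⊛ (new ᵀ ·ᴹ new)) (i ↑ˡ m) (n ↑ʳ j) ≈ γ * 1#
    entry₁₂ i j = trans (vanish (- x⁻¹) λ k → trans (*-congˡ (new-right k j)) (zeroʳ _))
      (block-₁₂ (linear p q A) (γ ⊛ 𝐉) (γ ⊛ 𝐉) (linear a b B) i j)

    entry₂₁ : ∀ i j → (old ⊕ (- x⁻¹) ⊛ (new ᵀ ·ᴹ new)) (n ↑ʳ i) (j ↑ˡ m) ≈ γ * 1#
    entry₂₁ i j = trans (vanish (- x⁻¹) λ k → trans (*-congʳ (new-right k i)) (zeroˡ _))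
      (block-₂₁ (linear p q A) (γ ⊛ 𝐉) (γ ⊛ 𝐉) (linear a b B) i j)

    entry₂₂ : ∀ i j → (old ⊕ (- x⁻¹) ⊛ (new ᵀ ·ᴹ new)) (n ↑ʳ i) (n ↑ʳ j) ≈ linear a b B i j
    entry₂₂ i j = trans (vanish (- x⁻¹) λ k → trans (*-congʳ (new-right k i)) (zeroˡ _))
      (block-₂₂ (linear p q A) (γ ⊛ 𝐉) (γ ⊛ 𝐉) (linear a b B) i j)

-- Polynomial functions over an algebraically closed field

record IsClosedField {c ℓ} (K : CommutativeRing c ℓ) : Set (c ⊔ ℓ) where
  open CommutativeRing K
  open Matrices K
  infix 9 _⁻¹
  field
    dec      : Decidable _≈_
    _⁻¹      : Carrier → Carrier
    inverse  : ∀ {x} → ¬ x ≈ 0# → x ⁻¹ * x ≈ 1#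
    char-0   : ∀ n → ¬ fromℕ (suc n) ≈ 0#
    closed   : AlgebraicallyClosed

module Polynomials {c ℓ} {K : CommutativeRing c ℓ} (F : IsClosedField K) where

  open CommutativeRing K hiding (zero)
  open RingProperties ring using (-‿involutive)
  open SemiringSum semiring using (sum-cong-≋)
  open Matrices K
  open MatrixAlgebra K
  open BlockMatrices K
  open JoinDeterminant K
  open IntegerCoefficients K
  open SetoidReasoning setoid
  open IsClosedField F

  1≉0 : ¬ 1# ≈ 0#
  1≉0 1≈0 = char-0 0 (trans (+-identityʳ 1#) 1≈0)

  cancel : ∀ {x y} → ¬ x ≈ 0# → x * y ≈ 0# → y ≈ 0#
  cancel {x} {y} x≉0 xy≈0 = begin
    y               ≈⟨ *-identityˡ y ⟨
    1# * y          ≈⟨ *-congʳ (inverse x≉0) ⟨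
    x ⁻¹ * x * y    ≈⟨ *-assoc _ _ _ ⟩
    x ⁻¹ * (x * y)  ≈⟨ *-congˡ xy≈0 ⟩
    x ⁻¹ * 0#       ≈⟨ zeroʳ _ ⟩
    0#              ∎

  -- Lead n a f: f is a polynomial function of degree at most n in which
  -- xⁿ has coefficient a.
  data Lead : ℕ → Carrier → (Carrier → Carrier) → Set (c ⊔ ℓ) where
    constant : ∀ {a f} → (∀ x → f x ≈ a) → Lead 0 a f
    horner   : ∀ {n a f} b {g} → Lead n a g → (∀ x → f x ≈ b + x * g x) → Lead (suc n) a f

  Lead-cong : ∀ {n a b f g} → a ≈ b → (∀ x → f x ≈ g x) → Lead n a f → Lead n b g
  Lead-cong a≈b f≈g (constant f≈a) = constant λ x → trans (sym (f≈g x)) (trans (f≈a x) a≈b)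
  Lead-cong a≈b f≈g (horner d p e) =
    horner d (Lead-cong a≈b (λ _ → refl) p) λ x → trans (sym (f≈g x)) (e x)

  Lead-+ : ∀ {n a b f g} → Lead n a f → Lead n b g → Lead n (a + b) (λ x → f x + g x)
  Lead-+ (constant p) (constant q) = constant λ x → +-cong (p x) (q x)
  Lead-+ (horner a {f} p e) (horner b {g} q e′) = horner (a + b) (Lead-+ p q) λ x →
    trans (+-cong (e x) (e′ x))
      (solve 5 (λ a b x f g → a :+ x :* f :+ (b :+ x :* g) := a :+ b :+ x :* (f :+ g))
        refl a b x (f x) (g x))

  Lead-* : ∀ {n a f} k → Lead n a f → Lead n (k * a) (λ x → k * f x)
  Lead-* k (constant p) = constant λ x → *-congˡ (p x)
  Lead-* k (horner a {f} p e) = horner (k * a) (Lead-* k p) λ x →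
    trans (*-congˡ (e x))
      (solve 4 (λ k a x f → k :* (a :+ x :* f) := k :* a :+ x :* (k :* f)) refl k a x (f x))

  Lead-raise : ∀ {n a f} → Lead n a f → Lead (suc n) 0# f
  Lead-raise {a = a} (constant p) = horner a (constant (λ _ → refl)) λ x →
    trans (p x) (solve 2 (λ a x → a := a :+ x :* :0) refl a x)
  Lead-raise (horner b p e) = horner b (Lead-raise p) e

  Lead-raise-< : ∀ {m n a f} → m ℕ.< n → Lead m a f → Lead n 0# f
  Lead-raise-< {n = suc n} (ℕ.s≤s m≤n) p with ℕ.m≤n⇒m<n∨m≡n m≤n
  ... | inj₁ m<n    = Lead-raise (Lead-raise-< m<n p)
  ... | inj₂ ≡.refl = Lead-raise p

  Lead-x* : ∀ {n a f} → Lead n a f → Lead (suc n) a (λ x → x * f x)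
  Lead-x* p = horner 0# p λ x → sym (+-identityˡ _)

  Lead-linear* : ∀ {n a f} u v → Lead n a f → Lead (suc n) (v * a) (λ x → (u + x * v) * f x)
  Lead-linear* {f = f} u v p = Lead-cong (+-identityˡ _)
    (λ x → solve 4 (λ u v x f → u :* f :+ x :* (v :* f) := (u :+ x :* v) :* f) refl u v x (f x))
    (Lead-+ (Lead-raise (Lead-* u p)) (Lead-x* (Lead-* v p)))

  division : ∀ {n a f} → Lead (suc n) a f → ∀ z →
    ∃ λ g → Lead n a g × (∀ x → f x ≈ f z + (x - z) * g x)
  division {a = a} {f} (horner b {g} p@(constant g≈a) e) z = g , p , λ x → begin
    f x                          ≈⟨ e x ⟩
    b + x * g x
      ≈⟨ solve 4 (λ b x g z → b :+ x :* g := b :+ z :* g :+ (x :- z) :* g) refl b x (g x) z ⟩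
    b + z * g x + (x - z) * g x  ≈⟨ +-congʳ (+-congˡ (*-congˡ (trans (g≈a x) (sym (g≈a z))))) ⟩
    b + z * g z + (x - z) * g x  ≈⟨ +-congʳ (e z) ⟨
    f z + (x - z) * g x          ∎
  division {f = f} (horner b {g} p@(horner _ _ _) e) z with division p z
  ... | q , pq , g≈ = (λ x → g x + z * q x) ,
    Lead-cong (+-identityʳ _) (λ _ → refl) (Lead-+ p (Lead-raise (Lead-* z pq))) ,
    λ x → begin
      f x
        ≈⟨ e x ⟩
      b + x * g x
        ≈⟨ solve 4 (λ b x z g → b :+ x :* g := b :+ z :* g :+ (x :- z) :* g) refl b x z (g x) ⟩
      b + z * g x + (x - z) * g x
        ≈⟨ +-congʳ (+-congˡ (*-congˡ (g≈ x))) ⟩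
      b + z * (g z + (x - z) * q x) + (x - z) * g x
        ≈⟨ solve 6 (λ b x z g h q → b :+ z :* (h :+ (x :- z) :* q) :+ (x :- z) :* g :=
             b :+ z :* h :+ (x :- z) :* (g :+ z :* q)) refl b x z (g x) (g z) (q x) ⟩
      b + z * g z + (x - z) * (g x + z * q x)
        ≈⟨ +-congʳ (e z) ⟨
      f z + (x - z) * (g x + z * q x) ∎

  -- The points a + k are distinct in characteristic zero.
  vanishing : ∀ {n b f} → Lead n b f → ∀ a → (∀ k → f (a + fromℕ k) ≈ 0#) →
    b ≈ 0# × (∀ x → f x ≈ 0#)
  vanishing (constant p) a f≈0 = b≈0 , λ x → trans (p x) b≈0
    where b≈0 = trans (sym (p _)) (f≈0 0)
  vanishing {f = f} p@(horner _ _ _) a f≈0 with division p (a + fromℕ 0)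
  ... | g , pg , f≈ = proj₁ ih , λ x → begin
      f x                              ≈⟨ f≈ x ⟩
      f (a + fromℕ 0) + (x - (a + fromℕ 0)) * g x
        ≈⟨ +-cong (f≈0 0) (trans (*-congˡ (proj₂ ih x)) (zeroʳ _)) ⟩
      0# + 0#                          ≈⟨ +-identityˡ 0# ⟩
      0#                               ∎
    where
    g≈0 : ∀ k → g (a + 1# + fromℕ k) ≈ 0#
    g≈0 k = trans (g-cong pg (+-assoc a 1# (fromℕ k))) (cancel (char-0 k) (begin
      fromℕ (suc k) * g x
        ≈⟨ solve 3 (λ a n g → n :* g := :0 :+ (a :+ n :- (a :+ :0)) :* g) refl a (fromℕ (suc k)) (g x) ⟩
      0# + (x - (a + fromℕ 0)) * g x
        ≈⟨ +-congʳ (f≈0 0) ⟨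
      f (a + fromℕ 0) + (x - (a + fromℕ 0)) * g x
        ≈⟨ f≈ x ⟨
      f x
        ≈⟨ f≈0 (suc k) ⟩
      0# ∎))
      where
      x = a + fromℕ (suc k)
      -- A polynomial is an arbitrary function together with a Horner form, and it respects `≈` only
      -- by virtue of that form.
      g-cong : ∀ {n b g} → Lead n b g → ∀ {x y} → x ≈ y → g x ≈ g y
      g-cong (constant p)   x≈y = trans (p _) (sym (p _))
      g-cong (horner b q e) x≈y = trans (e _) (trans (+-congˡ (*-cong x≈y (g-cong q x≈y))) (sym (e _)))
    ih = vanishing pg (a + 1#) g≈0

  Lead-unique : ∀ {n a b f g} → Lead n a f → Lead n b g → (∀ x → f x ≈ g x) → a ≈ b
  Lead-unique {a = a} {b} {f} {g} p q f≈g = begin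
    a                     ≈⟨ solve 2 (λ a b → a := a :+ (:- :1) :* b :+ b) refl a b ⟩
    a + (- 1#) * b + b    ≈⟨ +-congʳ (proj₁ (vanishing (Lead-+ p (Lead-* (- 1#) q)) 0# λ k →
                               trans (+-congʳ (f≈g _)) (solve 1 (λ y → y :+ (:- :1) :* y := :0) refl _))) ⟩
    0# + b                ≈⟨ +-identityˡ b ⟩
    b                     ∎

  -- If the degrees differed, the function of smaller degree, read at the larger one, would have
  -- leading coefficient 0 as well as 1.
  degree-unique : ∀ {m n f g} → Lead m 1# f → Lead n 1# g → (∀ x → f x ≈ g x) → m ≡ n
  degree-unique {m} {n} p q f≈g with ℕ.<-cmp m n
  ... | tri≈ _ m≡n _ = m≡n
  ... | tri< m<n _ _ = ⊥-elim (1≉0 (Lead-unique q (Lead-raise-< m<n p) λ x → sym (f≈g x)))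
  ... | tri> _ _ n<m = ⊥-elim (1≉0 (Lead-unique p (Lead-raise-< n<m q) f≈g))

  cofinitely-zero : ∀ {n a f} → Lead n a f → ∀ bs →
    (∀ x → All (λ b → ¬ x ≈ b) bs → f x ≈ 0#) → ∀ x → f x ≈ 0#
  cofinitely-zero {f = f} p []       f≈0 x = f≈0 x []
  cofinitely-zero {f = f} p (b ∷ bs) f≈0 = proj₂ (vanishing p (b + 1#) λ k →
    cancel (char-0 k) (begin
      fromℕ (suc k) * f (b + 1# + fromℕ k)
        -- The points start at b + 1, so that the factor x - b takes the values 1, 2, ..., all of
        -- which can be cancelled.
        ≈⟨ *-congʳ (solve 2 (λ b n → :1 :+ n := :- b :+ (b :+ :1 :+ n) :* :1) refl b (fromℕ k)) ⟩
      (- b + (b + 1# + fromℕ k) * 1#) * f (b + 1# + fromℕ k)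
        ≈⟨ product≈0 (b + 1# + fromℕ k) ⟩
      0# ∎))
    where
    product≈0 : ∀ x → (- b + x * 1#) * f x ≈ 0#
    product≈0 = cofinitely-zero (Lead-linear* (- b) 1# p) bs off-bs
      where
      off-bs : ∀ x → All (λ b → ¬ x ≈ b) bs → (- b + x * 1#) * f x ≈ 0#
      off-bs x x∉bs with dec x b
      ... | yes x≈b = trans (*-congʳ (trans (+-congˡ (trans (*-identityʳ x) x≈b)) (-‿inverseˡ b))) (zeroˡ _)
      ... | no  x≉b = trans (*-congˡ (f≈0 x (x≉b ∷ x∉bs))) (zeroʳ _)

  -- Turns a Horner form into the sum of powers for which `closed` provides a root.
  coefficients : ∀ {n b f} → Lead n b f →
    ∃ λ (a : Vector Carrier n) → ∀ x → f x ≈ b * x ^ n + sum (λ i → a i * x ^ toℕ i)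
  coefficients {b = b} (constant p) = (λ ()) , λ x →
    trans (p x) (solve 1 (λ b → b := b :* :1 :+ :0) refl b)
  coefficients {suc n} {b} {f} (horner a₀ {g} p e) with coefficients p
  ... | a , g≈ = a₀ Vector.∷ a , λ x → begin
    f x
      ≈⟨ e x ⟩
    a₀ + x * g x
      ≈⟨ +-congˡ (*-congˡ (g≈ x)) ⟩
    a₀ + x * (b * x ^ n + sum (λ i → a i * x ^ toℕ i))
      ≈⟨ solve 5 (λ a x b y s → a :+ x :* (b :* y :+ s) := b :* (x :* y) :+ (a :* :1 :+ x :* s))
           refl a₀ x b (x ^ n) (sum (λ i → a i * x ^ toℕ i)) ⟩
    b * (x * x ^ n) + (a₀ * 1# + x * sum (λ i → a i * x ^ toℕ i))
      ≈⟨ +-congˡ (+-congˡ (sum-⊛ {n} x {λ i → a i * x ^ toℕ i} refl)) ⟨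
    b * (x * x ^ n) + (a₀ * 1# + sum (λ i → x * (a i * x ^ toℕ i)))
      ≈⟨ +-congˡ (+-congˡ (sum-cong-≋ λ i → solve 3 (λ x a y → x :* (a :* y) := a :* (x :* y))
           refl x (a i) (x ^ toℕ i))) ⟩
    b * (x * x ^ n) + (a₀ * 1# + sum (λ i → a i * (x * x ^ toℕ i))) ∎

  -- The quotient by x - z keeps the leading coefficient 1, so `closed` applies to it again.
  factorisation : ∀ {n f} → Lead n 1# f →
    ∃ λ λs → ∀ x → f x ≈ foldr (λ e p → (x - e) * p) 1# λs
  factorisation (constant p) = [] , p
  factorisation {suc n} {f} p@(horner _ _ _) with coefficients p
  ... | a , f≈ with closed n a
  ... | z , root with division p z
  ... | g , pg , f≈′ with factorisation pg
  ... | λs , g≈ = z ∷ λs , λ x → begin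
    f x                  ≈⟨ f≈′ x ⟩
    f z + (x - z) * g x  ≈⟨ +-congʳ (trans (f≈ z) (trans (+-congʳ (*-identityˡ _)) root)) ⟩
    0# + (x - z) * g x   ≈⟨ +-identityˡ _ ⟩
    (x - z) * g x        ≈⟨ *-congˡ (g≈ x) ⟩
    (x - z) * foldr (λ e p → (x - e) * p) 1# λs ∎

  -- `closed` gives one root of z² + uz + v; by Vieta the other one has to be -u - z.
  quadratic-roots : ∀ u v → ∃ λ z → ∃ λ z′ → - (z + z′) ≈ u × z * z′ ≈ v
  quadratic-roots u v with closed 1 (v Vector.∷ u Vector.∷ Vector.[])
  ... | z , root = z , - u - z , solve 2 (λ z u → :- (z :+ (:- u :- z)) := u) refl z u , (begin
    z * (- u - z)
      ≈⟨ solve 3 (λ z u v → z :* (:- u :- z) := v :- (z :* (z :* :1) :+ (v :* :1 :+ (u :* (z :* :1) :+ :0))))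
           refl z u v ⟩
    v - (z * (z * 1#) + (v * 1# + (u * (z * 1#) + 0#)))  ≈⟨ +-congˡ (-‿cong root) ⟩
    v - 0#                                               ≈⟨ solve 1 (λ v → v :- :0 := v) refl v ⟩
    v                                                    ∎)

  Degree≤ : ℕ → (Carrier → Carrier) → Set (c ⊔ ℓ)
  Degree≤ n f = ∃ λ a → Lead n a f

  Degree≤-sum : ∀ {n m} (f : Fin m → Carrier → Carrier) → (∀ j → Degree≤ n (f j)) →
    Degree≤ n (λ x → sum λ j → f j x)
  Degree≤-sum {n} {zero} f p = zero-polynomial n
    where
    zero-polynomial : ∀ n → Degree≤ n (λ _ → 0#)
    zero-polynomial zero    = 0# , constant (λ _ → refl)
    zero-polynomial (suc n) = 0# , Lead-raise (proj₂ (zero-polynomial n))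
  Degree≤-sum {m = suc m} f p =
    _ , Lead-+ (proj₂ (p zero)) (proj₂ (Degree≤-sum (f ∘ suc) (p ∘ suc)))

  Degree≤-* : ∀ {n f g} k → Degree≤ 1 f → Degree≤ n g → Degree≤ (suc n) (λ x → k * f x * g x)
  Degree≤-* {g = g} k (v , horner u (constant h≈v) f≈) (_ , q) =
    _ , Lead-cong refl
      (λ x → trans (*-congʳ (solve 4 (λ k u x v → k :* u :+ x :* (k :* v) := k :* (u :+ x :* v)) refl k u x v))
        (*-congʳ (*-congˡ (sym (trans (f≈ x) (+-congˡ (*-congˡ (h≈v x))))))))
      (Lead-linear* (k * u) (k * v) q)

  Degree≤-constant* : ∀ {n f g} k → Degree≤ 0 f → Degree≤ n g → Degree≤ n (λ x → k * f x * g x)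
  Degree≤-constant* k (a , constant f≈a) (_ , q) =
    _ , Lead-cong refl (λ x → *-congʳ (*-congˡ (sym (f≈a x)))) (Lead-* (k * a) q)

  det-degree : ∀ {n} (M : Carrier → Matrix n) → (∀ i j → Degree≤ 1 (λ x → M x i j)) →
    Degree≤ n (λ x → det (M x))
  det-degree {zero}  M p = 1# , constant λ _ → refl
  det-degree {suc n} M p = Degree≤-sum _ λ j → Degree≤-* ((- 1#) ^ toℕ j) (p zero j)
    (det-degree (λ x i k → M x (suc i) (punchIn j k)) λ i k → p (suc i) (punchIn j k))

  det-degree-constantRow : ∀ {n} (M : Carrier → Matrix (suc n)) l →
    (∀ i j → Degree≤ 1 (λ x → M x i j)) → (∀ j → Degree≤ 0 (λ x → M x l j)) →
    Degree≤ n (λ x → det (M x))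
  det-degree-constantRow M zero p q = Degree≤-sum _ λ j → Degree≤-constant* ((- 1#) ^ toℕ j) (q j)
    (det-degree (λ x i k → M x (suc i) (punchIn j k)) λ i k → p (suc i) (punchIn j k))
  det-degree-constantRow {suc n} M (suc l) p q = Degree≤-sum _ λ j → Degree≤-* ((- 1#) ^ toℕ j) (p zero j)
    (det-degree-constantRow (λ x i k → M x (suc i) (punchIn j k)) l
      (λ i k → p (suc i) (punchIn j k)) (λ k → q (punchIn j k)))

  -- The two leading coefficients of the characteristic polynomial

  trace : ∀ {n} → Matrix n → Carrier
  trace M = sum λ i → M i i

  private
    pencil : ∀ {n} → Matrix n → Carrier → Matrix n
    pencil M x = diag (λ _ → x) -ᴹ M

    pencil-degree : ∀ {n} (M : Matrix n) i j → Degree≤ 1 (λ x → pencil M x i j)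
    pencil-degree M i j with i ≟ j
    ... | yes _ = 1# , horner (- M i j) (constant (λ _ → refl)) λ x →
      solve 2 (λ x m → x :- m := :- m :+ x :* :1) refl x (M i j)
    ... | no  _ = 0# , Lead-raise (constant λ x → +-identityˡ (- M i j))

    pencil-constant : ∀ {n} (M : Matrix n) {i j} → i ≢ j → Degree≤ 0 (λ x → pencil M x i j)
    pencil-constant M {i} {j} i≢j =
      - M i j , constant λ x → trans (+-congʳ (diag-≢ (λ _ → x) i≢j)) (+-identityˡ _)

  charPoly-cong : ∀ {n} {M N : Matrix n} → M ≈ᴹ N → ∀ x → charPoly M x ≈ charPoly N x
  charPoly-cong M≈N x = det-cong λ i j → +-congˡ (-‿cong (M≈N i j))

  -- In a term off the diagonal the entry in front is constant. Its minor has lost column `suc j`,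
  -- hence the diagonal entry of that row, and so contains a constant row. Such terms fall two
  -- degrees short, and the two top coefficients come from the diagonal term alone.
  charPoly-expansion : ∀ {n} (M : Matrix (suc n)) → ∃ λ g → Lead n 0# g ×
    (∀ x → charPoly M x ≈ (x - M zero zero) * charPoly (λ i j → M (suc i) (suc j)) x + g x)
  charPoly-expansion {n} M = (λ x → sum λ j → rest M j x) , rest-degree n M , λ x → +-congʳ (*-cong
    (*-identityˡ _) (det-cong {n} λ i j → +-congʳ (diag-suc (λ _ → x) i j)))
    where
    rest : ∀ {n} → Matrix (suc n) → Fin n → Carrier → Carrier
    rest M j x = (- 1#) ^ suc (toℕ j) * pencil M x zero (suc j) *
      det (λ i k → pencil M x (suc i) (punchIn (suc j) k))
    rest-degree : ∀ n (M : Matrix (suc n)) → Lead n 0# (λ x → sum λ j → rest M j x)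
    rest-degree zero    M = constant λ _ → refl
    rest-degree (suc n) M = Lead-raise (proj₂ (Degree≤-sum (rest M) λ j →
      Degree≤-constant* ((- 1#) ^ suc (toℕ j)) (pencil-constant M (λ ()))
        (det-degree-constantRow (λ x i k → pencil M x (suc i) (punchIn (suc j) k)) j
          (λ i k → pencil-degree M (suc i) (punchIn (suc j) k))
          (λ k → pencil-constant M λ e → punchInᵢ≢i (suc j) k (≡.sym e)))))

  charPoly-lead : ∀ {n} (M : Matrix n) → Lead n 1# (charPoly M)
  charPoly-lead {zero}  M = constant λ _ → refl
  charPoly-lead {suc n} M with charPoly-expansion M
  ... | g , pg , f≈ = Lead-cong (solve 0 (:1 :* :1 :+ :0 := :1) refl)
    (λ x → sym (trans (f≈ x) (+-congʳ (*-congʳ (solve 2 (λ x m → x :- m := :- m :+ x :* :1) refl x (M zero zero))))))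
    (Lead-+ (Lead-linear* (- M zero zero) 1# (charPoly-lead _)) (Lead-raise pg))

  -- Subtracting the top power brings the next coefficient to the lead. In (x - m)·p, with p the
  -- characteristic polynomial of the remaining diagonal block, it is the one of p minus m. This
  -- makes the trace an invariant of the characteristic polynomial without reference to eigenvalues.
  charPoly-trace : ∀ {n} (M : Matrix (suc n)) →
    Lead n (- trace M) (λ x → charPoly M x - x ^ suc n)
  charPoly-trace {zero} M = constant λ x →
    solve 2 (λ x m → :1 :* (x :- m) :* :1 :+ :0 :- x :* :1 := :- (m :+ :0)) refl x (M zero zero)
  charPoly-trace {suc n} M with charPoly-expansion M
  ... | g , pg , f≈ = Lead-cong
    (solve 2 (λ m t → :- t :+ (:- m) :* :1 :+ :0 := :- (m :+ t)) refl m (trace M′))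
    (λ x → begin
      x * (charPoly M′ x - x ^ suc n) + - m * charPoly M′ x + g x
        ≈⟨ solve 5 (λ x p y m g → x :* (p :- y) :+ (:- m) :* p :+ g := (x :- m) :* p :+ g :- x :* y)
             refl x (charPoly M′ x) (x ^ suc n) m (g x) ⟩
      (x - m) * charPoly M′ x + g x - x ^ suc (suc n)
        ≈⟨ +-congʳ (f≈ x) ⟨
      charPoly M x - x ^ suc (suc n) ∎)
    (Lead-+ (Lead-+ (Lead-x* (charPoly-trace M′)) (Lead-* (- m) (charPoly-lead M′))) pg)
    where
    m  = M zero zero
    M′ : Matrix (suc n)
    M′ i j = M (suc i) (suc j)

  CharPoly≈ : ∀ {n m} → Matrix n → Matrix m → Set (c ⊔ ℓ)
  CharPoly≈ M N = ∀ x → charPoly M x ≈ charPoly N x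

  size-unique : ∀ {n m} (M : Matrix n) (N : Matrix m) → CharPoly≈ M N → n ≡ m
  size-unique M N = degree-unique (charPoly-lead M) (charPoly-lead N)

  trace-unique : ∀ {n} (M N : Matrix n) → CharPoly≈ M N → trace M ≈ trace N
  trace-unique {zero}  M N M≈N = refl
  trace-unique {suc n} M N M≈N = begin
    trace M        ≈⟨ -‿involutive _ ⟨
    - - trace M    ≈⟨ -‿cong (Lead-unique (charPoly-trace M) (charPoly-trace N) λ x → +-congʳ (M≈N x)) ⟩
    - - trace N    ≈⟨ -‿involutive _ ⟩
    trace N        ∎

  -- Determinants of linear and quadratic polynomials in a matrix

  det-linear-charPoly : ∀ {n} (A : Matrix n) c₀ c₁ {c₁⁻¹} → c₁⁻¹ * c₁ ≈ 1# →
    det (linear c₀ c₁ A) ≈ det (scalar {n} (- c₁)) * charPoly A (- (c₁⁻¹ * c₀))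
  det-linear-charPoly {n} A c₀ c₁ {c₁⁻¹} c₁≉0 = begin
    det (linear c₀ c₁ A)
      ≈⟨ det-cong (λ i j → begin
           scalar c₀ i j + c₁ * A i j
             ≈⟨ +-congʳ (scalar-⊛ c₀ i j) ⟩
           c₀ * 1ᴹ i j + c₁ * A i j
             ≈⟨ +-congʳ (*-congʳ (trans (*-congʳ c₁≉0) (*-identityˡ c₀))) ⟨
           c₁⁻¹ * c₁ * c₀ * 1ᴹ i j + c₁ * A i j
             ≈⟨ solve 5 (λ y c d e a → y :* c :* d :* e :+ c :* a := (:- c) :* ((:- (y :* d)) :* e :- a))
                  refl c₁⁻¹ c₁ c₀ (1ᴹ i j) (A i j) ⟩
           - c₁ * (- (c₁⁻¹ * c₀) * 1ᴹ i j - A i j)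
             ≈⟨ *-congˡ (+-congʳ (scalar-⊛ (- (c₁⁻¹ * c₀)) i j)) ⟨
           - c₁ * pencil A (- (c₁⁻¹ * c₀)) i j
             ≈⟨ scalar-·ᴹ (- c₁) (pencil A (- (c₁⁻¹ * c₀))) i j ⟨
           (scalar (- c₁) ·ᴹ pencil A (- (c₁⁻¹ * c₀))) i j ∎) ⟩
    det (scalar (- c₁) ·ᴹ pencil A (- (c₁⁻¹ * c₀)))
      ≈⟨ det-·ᴹ (scalar (- c₁)) (pencil A (- (c₁⁻¹ * c₀))) ⟩
    det (scalar {n} (- c₁)) * charPoly A (- (c₁⁻¹ * c₀)) ∎

  det-linear-≈ : ∀ {n} (A B : Matrix n) → CharPoly≈ A B → ∀ c₀ c₁ →
    det (linear c₀ c₁ A) ≈ det (linear c₀ c₁ B)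
  det-linear-≈ {n} A B A≈B c₀ c₁ with dec c₁ 0#
  ... | yes c₁≈0 = det-cong {n} λ i j → +-congˡ (trans (trans (*-congʳ c₁≈0) (zeroˡ (A i j)))
                                                 (sym (trans (*-congʳ c₁≈0) (zeroˡ (B i j)))))
  ... | no  c₁≉0 = begin
    det (linear {n} c₀ c₁ A)                           ≈⟨ det-linear-charPoly A c₀ c₁ (inverse c₁≉0) ⟩
    det (scalar {n} (- c₁)) * charPoly A (- (c₁ ⁻¹ * c₀))  ≈⟨ *-congˡ (A≈B _) ⟩
    det (scalar {n} (- c₁)) * charPoly B (- (c₁ ⁻¹ * c₀))  ≈⟨ det-linear-charPoly B c₀ c₁ (inverse c₁≉0) ⟨
    det (linear c₀ c₁ B)                               ∎

  pencil-·ᴹ : ∀ {n} (A : Matrix n) z z′ → pencil A z ·ᴹ pencil A z′ ≈ᴹ quadratic (z * z′) (- (z + z′)) 1# A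
  pencil-·ᴹ {n} A z z′ i j = begin
    sum (λ k → (scalar z i k - A i k) * (scalar z′ k j - A k j))
      ≈⟨ sum-cong-≋ (λ k → solve 4 (λ s a t b → (s :- a) :* (t :- b) :=
           s :* t :+ (:- :1) :* (s :* b) :+ (:- :1) :* (a :* t) :+ a :* b)
           refl (scalar z i k) (A i k) (scalar z′ k j) (A k j)) ⟩
    sum (λ k → scalar z i k * scalar z′ k j + - 1# * (scalar z i k * A k j) +
               - 1# * (A i k * scalar z′ k j) + A i k * A k j)
      ≈⟨ sum-⊕ {n} (sum-⊕ {n} (sum-⊕ {n} (scalar-·ᴹ z (scalar z′) i j)
           (sum-⊛ {n} (- 1#) (scalar-·ᴹ z A i j))) (sum-⊛ {n} (- 1#) (·ᴹ-scalar A z′ i j))) refl ⟩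
    z * scalar z′ i j + - 1# * (z * A i j) + - 1# * (z′ * A i j) + (A ·ᴹ A) i j
      ≈⟨ +-congʳ (+-congʳ (+-congʳ (scalar-·ᴹ z (scalar z′) i j))) ⟨
    (scalar z ·ᴹ scalar z′) i j + - 1# * (z * A i j) + - 1# * (z′ * A i j) + (A ·ᴹ A) i j
      ≈⟨ +-congʳ (+-congʳ (+-congʳ (scalar-scalar i j))) ⟩
    scalar (z * z′) i j + - 1# * (z * A i j) + - 1# * (z′ * A i j) + (A ·ᴹ A) i j
      ≈⟨ solve 5 (λ e z w a s → e :+ (:- :1) :* (z :* a) :+ (:- :1) :* (w :* a) :+ s :=
           e :+ (:- (z :+ w)) :* a :+ :1 :* s) refl (scalar (z * z′) i j) z z′ (A i j) ((A ·ᴹ A) i j) ⟩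
    quadratic (z * z′) (- (z + z′)) 1# A i j ∎
    where
    scalar-scalar : ∀ i j → (scalar z ·ᴹ scalar z′) i j ≈ scalar {n} (z * z′) i j
    scalar-scalar i j with i ≟ j
    ... | yes ≡.refl = trans (scalar-·ᴹ z (scalar z′) i i) (*-congˡ (diag-≡ (λ _ → z′) i))
    ... | no  i≢j    = trans (scalar-·ᴹ z (scalar z′) i j) (trans (*-congˡ (diag-≢ (λ _ → z′) i≢j)) (zeroʳ z))

  ⊛-quadratic : ∀ {n} (A : Matrix n) k u v → k ⊛ quadratic u v 1# A ≈ᴹ quadratic (k * u) (k * v) k A
  ⊛-quadratic {n} A k u v i j = trans
    (solve 5 (λ k e v a s → k :* (e :+ v :* a :+ :1 :* s) := k :* e :+ k :* v :* a :+ k :* s)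
      refl k (scalar u i j) v (A i j) ((A ·ᴹ A) i j))
    (+-congʳ (+-congʳ (scaled i j)))
    where
    scaled : ∀ i j → k * scalar u i j ≈ scalar {n} (k * u) i j
    scaled i j with i ≟ j
    ... | yes _ = refl
    ... | no  _ = zeroʳ k

  -- Over an algebraically closed field a quadratic polynomial in A is k (A − z)(A − z′).
  det-quadratic-≈ : ∀ {n} (A B : Matrix n) → CharPoly≈ A B → ∀ c₀ c₁ c₂ →
    det (quadratic c₀ c₁ c₂ A) ≈ det (quadratic c₀ c₁ c₂ B)
  det-quadratic-≈ {n} A B A≈B c₀ c₁ c₂ with dec c₂ 0#
  ... | yes c₂≈0 = begin
    det (quadratic c₀ c₁ c₂ A)  ≈⟨ det-cong (degenerate A) ⟩
    det (linear c₀ c₁ A)        ≈⟨ det-linear-≈ A B A≈B c₀ c₁ ⟩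
    det (linear c₀ c₁ B)        ≈⟨ det-cong (degenerate B) ⟨
    det (quadratic c₀ c₁ c₂ B)  ∎
    where
    degenerate : ∀ A → quadratic c₀ c₁ c₂ A ≈ᴹ linear {n} c₀ c₁ A
    degenerate A i j = trans (+-congˡ (trans (*-congʳ c₂≈0) (zeroˡ _))) (+-identityʳ _)
  ... | no c₂≉0 with quadratic-roots (c₂ ⁻¹ * c₁) (c₂ ⁻¹ * c₀)
  ... | z , z′ , z+z′ , zz′ = begin
    det (quadratic c₀ c₁ c₂ A)                           ≈⟨ factored A ⟩
    det (scalar {n} c₂) * (charPoly A z * charPoly A z′)     ≈⟨ *-congˡ (*-cong (A≈B z) (A≈B z′)) ⟩
    det (scalar {n} c₂) * (charPoly B z * charPoly B z′)     ≈⟨ factored B ⟨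
    det (quadratic c₀ c₁ c₂ B)                           ∎
    where
    restore : ∀ {x} y → x ≈ c₂ ⁻¹ * y → c₂ * x ≈ y
    restore {x} y x≈ = begin
      c₂ * x               ≈⟨ *-congˡ x≈ ⟩
      c₂ * (c₂ ⁻¹ * y)     ≈⟨ solve 3 (λ c d y → c :* (d :* y) := d :* c :* y) refl c₂ (c₂ ⁻¹) y ⟩
      c₂ ⁻¹ * c₂ * y       ≈⟨ *-congʳ (inverse c₂≉0) ⟩
      1# * y               ≈⟨ *-identityˡ y ⟩
      y                    ∎
    scalar-cong : ∀ {x y} → x ≈ y → scalar {n} x ≈ᴹ scalar y
    scalar-cong x≈y i j with i ≟ j
    ... | yes _ = x≈y
    ... | no  _ = refl
    factored : ∀ A → det (quadratic c₀ c₁ c₂ A) ≈ det (scalar {n} c₂) * (charPoly A z * charPoly A z′)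
    factored A = begin
      det (quadratic c₀ c₁ c₂ A)
        ≈⟨ det-cong (λ i j → begin
             quadratic c₀ c₁ c₂ A i j
               ≈⟨ +-congʳ (+-cong (scalar-cong (restore c₀ zz′) i j) (*-congʳ (restore c₁ z+z′))) ⟨
             quadratic (c₂ * (z * z′)) (c₂ * - (z + z′)) c₂ A i j
               ≈⟨ ⊛-quadratic A c₂ (z * z′) (- (z + z′)) i j ⟨
             c₂ * quadratic (z * z′) (- (z + z′)) 1# A i j
               ≈⟨ *-congˡ (pencil-·ᴹ A z z′ i j) ⟨
             c₂ * (pencil A z ·ᴹ pencil A z′) i j
               ≈⟨ scalar-·ᴹ c₂ (pencil A z ·ᴹ pencil A z′) i j ⟨
             (scalar c₂ ·ᴹ (pencil A z ·ᴹ pencil A z′)) i j ∎) ⟩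
      det (scalar c₂ ·ᴹ (pencil A z ·ᴹ pencil A z′))
        ≈⟨ det-·ᴹ (scalar c₂) (pencil A z ·ᴹ pencil A z′) ⟩
      det (scalar {n} c₂) * det (pencil A z ·ᴹ pencil A z′)
        ≈⟨ *-congˡ (det-·ᴹ (pencil A z) (pencil A z′)) ⟩
      det (scalar {n} c₂) * (charPoly A z * charPoly A z′) ∎

  charPoly-linear-≈ : ∀ {n} (A B : Matrix n) → CharPoly≈ A B → ∀ u v → CharPoly≈ (linear u v A) (linear u v B)
  charPoly-linear-≈ {n} A B A≈B u v x = begin
    charPoly (linear u v A) x         ≈⟨ det-cong (shifted A) ⟩
    det (linear (x - u) (- v) A)      ≈⟨ det-linear-≈ A B A≈B (x - u) (- v) ⟩
    det (linear (x - u) (- v) B)      ≈⟨ det-cong (shifted B) ⟨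
    charPoly (linear u v B) x         ∎
    where
    shifted : ∀ A → pencil (linear u v A) x ≈ᴹ linear {n} (x - u) (- v) A
    shifted A i j with i ≟ j
    ... | yes _ = solve 4 (λ x u v a → x :- (u :+ v :* a) := x :- u :+ (:- v) :* a) refl x u v (A i j)
    ... | no  _ = solve 2 (λ v a → :0 :- (:0 :+ v :* a) := :0 :+ (:- v) :* a) refl v (A i j)

  -- As x - M² is a quadratic polynomial in M, its determinant is determined by the characteristic
  -- polynomial of M. Through `trace-unique` this makes tr M² an invariant as well.
  charPoly-square-≈ : ∀ {n} (M N : Matrix n) → CharPoly≈ M N → CharPoly≈ (M ·ᴹ M) (N ·ᴹ N)
  charPoly-square-≈ {n} M N M≈N x = begin
    charPoly (M ·ᴹ M) x                  ≈⟨ det-cong (shifted M) ⟩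
    det (quadratic x 0# (- 1#) M)        ≈⟨ det-quadratic-≈ M N M≈N x 0# (- 1#) ⟩
    det (quadratic x 0# (- 1#) N)        ≈⟨ det-cong (shifted N) ⟨
    charPoly (N ·ᴹ N) x                  ∎
    where
    shifted : ∀ M → pencil (M ·ᴹ M) x ≈ᴹ quadratic {n} x 0# (- 1#) M
    shifted M i j = solve 3 (λ e a s → e :- s := e :+ :0 :* a :+ (:- :1) :* s)
      refl (scalar x i j) (M i j) ((M ·ᴹ M) i j)

-- Characteristic polynomials of matrices of join shape

module JoinCharPoly {c ℓ} {K : CommutativeRing c ℓ} (F : IsClosedField K) where

  open CommutativeRing K hiding (zero)
  open RingProperties ring using (x∙y⁻¹≈ε⇒x≈y)
  open Matrices K
  open MatrixAlgebra K
  open BlockMatrices K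
  open JoinDeterminant K
  open IntegerCoefficients K
  open SetoidReasoning setoid
  open IsClosedField F
  open Polynomials F

  -- Both determinants factor by `det-joinMatrix` with the same scalars, wherever the three inverted
  -- scalars are nonzero. Both sides are polynomials in x, so it is enough that the bad points are
  -- finitely many.
  charPoly-join-≈ : ∀ {n m} {A A′ : Matrix n} {B B′ : Matrix m} {r s}
    {X X′ : Matrix ((n ℕ.+ m) ℕ.+ n)} φu φv φw q γ δ b →
    RowSums A r → RowSums A′ r → A ᵀ ≈ᴹ A → A′ ᵀ ≈ᴹ A′ → RowSums B s → RowSums B′ s →
    CharPoly≈ A A′ → CharPoly≈ B B′ →
    (∀ x → diag (λ _ → x) -ᴹ X ≈ᴹ joinMatrix (x - φu) q γ δ (x - φv) b (x - φw) A B) →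
    (∀ x → diag (λ _ → x) -ᴹ X′ ≈ᴹ joinMatrix (x - φu) q γ δ (x - φv) b (x - φw) A′ B′) →
    CharPoly≈ X X′
  charPoly-join-≈ {n} {m} {A} {A′} {B} {B′} {r} {s} {X} {X′} φu φv φw q γ δ b
    rowsA rowsA′ symA symA′ rowsB rowsB′ A≈A′ B≈B′ X≈ X′≈ x =
    x∙y⁻¹≈ε⇒x≈y _ _ (trans (solve 2 (λ f g → f :- g := f :+ (:- :1) :* g) refl _ _)
      (cofinitely-zero (Lead-+ (charPoly-lead X) (Lead-* (- 1#) (charPoly-lead X′))) exceptional
        (λ x x∉ → trans (+-congʳ (agree x x∉)) (solve 1 (λ f → f :+ (:- :1) :* f := :0) refl _)) x))
    where
    κ : Carrier
    κ = φu - q * r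

    -- `π` contains α⁻¹ through `c₂` and is not polynomial in x. But α·π equals (x - φw)(x - κ) -
    -- δ²(1 + r)², where 1 + 2r + r² collects the contributions of I, 2A and A²; these are the zeros
    -- of that quadratic.
    roots : ∃ λ z → ∃ λ z′ → - (z + z′) ≈ - (φw + κ) × z * z′ ≈ φw * κ - δ * δ * ((1# + r) * (1# + r))
    roots = quadratic-roots _ _

    ρ ρ′ : Carrier
    ρ  = proj₁ roots
    ρ′ = proj₁ (proj₂ roots)

    -- In this order: the zero of `α`, the zero of `d`, and the two zeros of α·π.
    exceptional : List Carrier
    exceptional = φw ∷ (φv - b * s) ∷ ρ ∷ ρ′ ∷ []

    agree : ∀ x → All (λ b → ¬ x ≈ b) exceptional → charPoly X x ≈ charPoly X′ x
    agree x (x≉φw ∷ x≉d ∷ x≉ρ ∷ x≉ρ′ ∷ []) = begin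
      charPoly X x
        ≈⟨ det-cong (X≈ x) ⟩
      det (joinMatrix (x - φu) q γ δ (x - φv) b α A B)
        ≈⟨ det-joinMatrix (x - φu) q γ δ (x - φv) b α rowsA symA rowsB
             (inverse α≉0) (inverse π≉0) (inverse d≉0) ⟩
      det (quadratic c₀ c₁ c₂ A) * det (linear (x - φv) b B) * common * det (scalar {n} α)
        ≈⟨ *-congʳ (*-congʳ (*-cong (det-quadratic-≈ A A′ A≈A′ c₀ c₁ c₂) (det-linear-≈ B B′ B≈B′ (x - φv) b))) ⟩
      det (quadratic c₀ c₁ c₂ A′) * det (linear (x - φv) b B′) * common * det (scalar {n} α)
        ≈⟨ det-joinMatrix (x - φu) q γ δ (x - φv) b α rowsA′ symA′ rowsB′
             (inverse α≉0) (inverse π≉0) (inverse d≉0) ⟨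
      det (joinMatrix (x - φu) q γ δ (x - φv) b α A′ B′)
        ≈⟨ det-cong (X′≈ x) ⟨
      charPoly X′ x ∎
      where
      α : Carrier
      α = x - φw
      α≉0 : ¬ α ≈ 0#
      α≉0 α≈0 = x≉φw (x∙y⁻¹≈ε⇒x≈y _ _ α≈0)
      c₂ c₁ c₀ σ π d : Carrier
      c₂ = - (α ⁻¹) * (δ * δ)
      c₁ = q + (c₂ + c₂)
      c₀ = x - φu + c₂
      σ  = c₂ * (fromℕ n - (1# + r) - (1# + r))
      π  = c₀ + c₁ * r + c₂ * (r * r)
      d  = x - φv + b * s
      d≉0 : ¬ d ≈ 0#
      d≉0 d≈0 = x≉d (x∙y⁻¹≈ε⇒x≈y _ _ (trans
        (solve 3 (λ x v t → x :- (v :- t) := x :- v :+ t) refl x φv (b * s)) d≈0))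
      απ≈ : α * π ≈ (x - ρ) * (x - ρ′)
      απ≈ = begin
        α * π
          ≈⟨ solve 7 (λ a y d x u q r →
               let c = (:- y) :* d in
               a :* (x :- u :+ c :+ (q :+ (c :+ c)) :* r :+ c :* (r :* r)) :=
               a :* (x :- (u :- q :* r)) :- y :* a :* (d :* ((:1 :+ r) :* (:1 :+ r))))
               refl α (α ⁻¹) (δ * δ) x φu q r ⟩
        α * (x - κ) - α ⁻¹ * α * (δ * δ * ((1# + r) * (1# + r)))
          ≈⟨ +-congˡ (-‿cong (trans (*-congʳ (inverse α≉0)) (*-identityˡ _))) ⟩
        α * (x - κ) - δ * δ * ((1# + r) * (1# + r))
          ≈⟨ solve 4 (λ x w k e → (x :- w) :* (x :- k) :- e := x :* x :+ (:- (w :+ k)) :* x :+ (w :* k :- e))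
               refl x φw κ (δ * δ * ((1# + r) * (1# + r))) ⟩
        x * x + - (φw + κ) * x + (φw * κ - δ * δ * ((1# + r) * (1# + r)))
          ≈⟨ +-cong (+-congˡ (*-congʳ (proj₁ (proj₂ (proj₂ roots))))) (proj₂ (proj₂ (proj₂ roots))) ⟨
        x * x + - (ρ + ρ′) * x + ρ * ρ′
          ≈⟨ solve 3 (λ x z w → x :* x :+ (:- (z :+ w)) :* x :+ z :* w := (x :- z) :* (x :- w)) refl x ρ ρ′ ⟩
        (x - ρ) * (x - ρ′) ∎
      π≉0 : ¬ π ≈ 0#
      π≉0 π≈0 = x≉ρ′ (x∙y⁻¹≈ε⇒x≈y _ _ (cancel (λ e → x≉ρ (x∙y⁻¹≈ε⇒x≈y _ _ e))
        (trans (sym απ≈) (trans (*-congˡ π≈0) (zeroʳ α)))))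
      common : Carrier
      common = det (block (1ᴹ {n} ⊕ (σ * π ⁻¹) ⊛ 𝐉) ((γ * π ⁻¹) ⊛ 𝐉) ((γ * d ⁻¹) ⊛ 𝐉) (1ᴹ {m}))

-- ℂ as an algebraically closed field of characteristic zero

module ComplexNumbers {c ℓ₁ ℓ₂} (R : RealClosedField c ℓ₁ ℓ₂) where

  open RealClosedField R
  open CommutativeRing commutativeRing hiding (zero)
  open Matrices commutativeRing using (fromℕ)
  open Complexification commutativeRing
  open IntegerCoefficients commutativeRing
  open IsDecTotalOrder isDecTotalOrder using (total; antisym; ≤-respˡ-≈; ≤-respʳ-≈)
    renaming (_≟_ to _≈?_; refl to ≤-refl; trans to ≤-trans)
  open SetoidReasoning setoid
  private module ℂ where
    open CommutativeRing complexRing public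
    open Matrices complexRing public

  ≤-+ : ∀ {x y} → 0# ≤ x → 0# ≤ y → y ≤ x + y
  ≤-+ {x} {y} 0≤x 0≤y = ≤-respˡ-≈ (+-identityˡ y) (+-mono-≤ y 0≤x)

  +-nonneg : ∀ {x y} → 0# ≤ x → 0# ≤ y → 0# ≤ x + y
  +-nonneg 0≤x 0≤y = ≤-trans 0≤y (≤-+ 0≤x 0≤y)

  square-nonneg : ∀ x → 0# ≤ x * x
  square-nonneg x with total 0# x
  ... | inj₁ 0≤x = *-nonneg 0≤x 0≤x
  ... | inj₂ x≤0 = ≤-respʳ-≈ (solve 1 (λ x → (:- x) :* (:- x) := x :* x) refl x) (*-nonneg 0≤-x 0≤-x)
    where
    0≤-x : 0# ≤ - x
    0≤-x = ≤-respˡ-≈ (-‿inverseʳ x) (≤-respʳ-≈ (+-identityˡ (- x)) (+-mono-≤ (- x) x≤0))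

  0≤1 : 0# ≤ 1#
  0≤1 = ≤-respʳ-≈ (*-identityˡ 1#) (square-nonneg 1#)

  fromℕ-nonneg : ∀ n → 0# ≤ fromℕ n
  fromℕ-nonneg zero    = ≤-refl
  fromℕ-nonneg (suc n) = +-nonneg 0≤1 (fromℕ-nonneg n)

  -- Characteristic zero comes from the order: n + 1 = 0 would give 1 ≤ 0, hence 0 = 1.
  fromℕ-suc≉0 : ∀ n → ¬ fromℕ (suc n) ≈ 0#
  fromℕ-suc≉0 n 1+n≈0 = 0≉1 (antisym 0≤1 (≤-respʳ-≈ (trans (+-comm _ _) 1+n≈0) (≤-+ (fromℕ-nonneg n) 0≤1)))

  square≈0 : ∀ {x} → x * x ≈ 0# → x ≈ 0#
  square≈0 {x} xx≈0 with x ≈? 0#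
  ... | yes x≈0 = x≈0
  ... | no  x≉0 = begin
    x               ≈⟨ *-identityʳ x ⟨
    x * 1#          ≈⟨ *-congˡ (*-inverseʳ x x≉0) ⟨
    x * (x * x ⁻¹)  ≈⟨ *-assoc x x (x ⁻¹) ⟨
    x * x * x ⁻¹    ≈⟨ *-congʳ xx≈0 ⟩
    0# * x ⁻¹       ≈⟨ zeroˡ _ ⟩
    0#              ∎

  norm : Carrier × Carrier → Carrier
  norm (a , b) = a * a + b * b

  -- Squares are nonnegative, so each of the two lies between 0 and their sum.
  norm≈0 : ∀ z → norm z ≈ 0# → z ≈ᶜ ℂ.0#
  norm≈0 (a , b) e =
    square≈0 (antisym (≤-respʳ-≈ (trans (+-comm _ _) e) (≤-+ (square-nonneg b) (square-nonneg a))) (square-nonneg a)) ,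
    square≈0 (antisym (≤-respʳ-≈ e (≤-+ (square-nonneg a) (square-nonneg b))) (square-nonneg b))

  infix 9 _⁻¹ᶜ
  _⁻¹ᶜ : Carrier × Carrier → Carrier × Carrier
  (a , b) ⁻¹ᶜ = a * norm (a , b) ⁻¹ , - b * norm (a , b) ⁻¹

  ⁻¹ᶜ-inverse : ∀ {z} → ¬ z ≈ᶜ ℂ.0# → z ⁻¹ᶜ *ᶜ z ≈ᶜ ℂ.1#
  ⁻¹ᶜ-inverse {a , b} z≉0 =
    trans (solve 3 (λ a b y → a :* y :* a :- (:- b) :* y :* b := (a :* a :+ b :* b) :* y) refl a b (norm (a , b) ⁻¹))
          (*-inverseʳ (norm (a , b)) λ e → z≉0 (norm≈0 (a , b) e)) ,
    solve 3 (λ a b y → a :* y :* b :+ (:- b) :* y :* a := :0) refl a b (norm (a , b) ⁻¹)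

  real-fromℕ : ∀ n → ℂ.fromℕ n ≈ᶜ real (fromℕ n)
  real-fromℕ zero    = refl , refl
  real-fromℕ (suc n) = +-congˡ (proj₁ (real-fromℕ n)) , trans (+-identityˡ _) (proj₂ (real-fromℕ n))

  isClosedField : IsClosedField complexRing
  isClosedField = record
    { dec     = λ { (a , b) (c , d) → (a ≈? c) ×-dec (b ≈? d) }
    ; _⁻¹     = _⁻¹ᶜ
    ; inverse = ⁻¹ᶜ-inverse
    ; char-0  = λ n e → fromℕ-suc≉0 n (trans (sym (proj₁ (real-fromℕ (suc n)))) (proj₁ e))
    ; closed  = ℂ-closed
    }

-- Degrees and isomorphisms of NNS joins

module Combinatorics where

  open ≡ using (refl; sym; trans; cong; cong₂; subst; module ≡-Reasoning)
  open import Data.Nat.Base using (_+_; _<_)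
  open CommutativeMonoidSum ℕ.+-0-commutativeMonoid using (sum; sum-cong-≗; ∑-distrib-+; sum-permute)

  bit : Bool → ℕ
  bit b = if b then 1 else 0

  count : ∀ {n} → (Fin n → Bool) → ℕ
  count f = sum (bit ∘ f)

  ∣tabulate∣ : ∀ {n} (f : Fin n → Bool) → ∣ tabulate f ∣ ≡ count f
  ∣tabulate∣ {zero}  f = refl
  ∣tabulate∣ {suc n} f with f zero
  ... | true  = cong suc (∣tabulate∣ (f ∘ suc))
  ... | false = ∣tabulate∣ (f ∘ suc)

  degree-count : ∀ {n} (G : Graph n) i → degree G i ≡ count (adj G i)
  degree-count G i = ∣tabulate∣ (adj G i)

  count-cong : ∀ {n} {f g : Fin n → Bool} → (∀ i → f i ≡ g i) → count f ≡ count g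
  count-cong f≗g = sum-cong-≗ λ i → cong bit (f≗g i)

  count-false : ∀ n → count {n} (λ _ → false) ≡ 0
  count-false zero    = refl
  count-false (suc n) = count-false n

  count-true : ∀ n → count {n} (λ _ → true) ≡ n
  count-true zero    = refl
  count-true (suc n) = cong suc (count-true n)

  count-split : ∀ n {m} (f : Fin (n + m) → Bool) →
    count f ≡ count (λ i → f (i ↑ˡ m)) + count (λ j → f (n ↑ʳ j))
  count-split zero    f = refl
  count-split (suc n) f =
    trans (cong (bit (f zero) +_) (count-split n (f ∘ suc))) (sym (ℕ.+-assoc (bit (f zero)) _ _))

  count-≟ : ∀ {n} (i : Fin n) → count (λ j → does (i ≟ j)) ≡ 1
  count-≟ {suc n} zero    = cong suc (count-false n)
  count-≟         (suc i) = count-≟ i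

  count≡0 : ∀ {n} (f : Fin n → Bool) → count f ≡ 0 → ∀ i → f i ≡ false
  count≡0 f f≡0 zero with f zero
  ... | false = refl
  count≡0 f f≡0 (suc i) = count≡0 (f ∘ suc) (ℕ.m+n≡0⇒n≡0 (bit (f zero)) f≡0) i

  module _ {n} (G : Graph n) where

    nonDegree : Fin n → ℕ
    nonDegree i = count (nonNeighbour G i)

    1+degree+nonDegree : ∀ i → suc (degree G i + nonDegree i) ≡ n
    1+degree+nonDegree i = begin
      suc (degree G i + nonDegree i)
        ≡⟨ cong₂ _+_ (count-≟ i) (cong (_+ nonDegree i) (sym (degree-count G i))) ⟨
      count (λ j → does (i ≟ j)) + (count (adj G i) + nonDegree i)
        ≡⟨ cong (count (λ j → does (i ≟ j)) +_) (∑-distrib-+ (bit ∘ adj G i) (bit ∘ nonNeighbour G i)) ⟨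
      count (λ j → does (i ≟ j)) + sum (λ j → bit (adj G i j) + bit (nonNeighbour G i j))
        ≡⟨ ∑-distrib-+ (λ j → bit (does (i ≟ j))) (λ j → bit (adj G i j) + bit (nonNeighbour G i j)) ⟨
      sum (λ j → bit (does (i ≟ j)) + (bit (adj G i j) + bit (nonNeighbour G i j)))
        ≡⟨ sum-cong-≗ trichotomy ⟩
      count {n} (λ _ → true)
        ≡⟨ count-true n ⟩
      n ∎
      where
      open ≡-Reasoning
      trichotomy : ∀ j → bit (does (i ≟ j)) + (bit (adj G i j) + bit (nonNeighbour G i j)) ≡ 1
      trichotomy j with i ≟ j
      ... | yes refl rewrite adj-irrefl G i = refl
      ... | no  _ with adj G i j
      ...   | true  = refl
      ...   | false = refl

    nonNeighbour-sym : ∀ i j → nonNeighbour G i j ≡ nonNeighbour G j i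
    nonNeighbour-sym i j with i ≟ j | j ≟ i
    ... | yes _    | yes _   = refl
    ... | yes i≡j  | no  j≢i = ⊥-elim (j≢i (sym i≡j))
    ... | no  i≢j  | yes j≡i = ⊥-elim (i≢j (sym j≡i))
    ... | no  _    | no  _   = cong not (adj-sym G i j)

    module _ {r} (reg : ∀ i → degree G i ≡ r) where

      1+r+nonDegree : ∀ i → suc (r + nonDegree i) ≡ n
      1+r+nonDegree i = trans (cong (λ d → suc (d + nonDegree i)) (sym (reg i))) (1+degree+nonDegree i)

      nonDegree-regular : ∀ i → nonDegree i ≡ n ℕ.∸ suc r
      nonDegree-regular i = begin
        nonDegree i                      ≡⟨ ℕ.m+n∸m≡n (suc r) (nonDegree i) ⟨
        suc r + nonDegree i ℕ.∸ suc r    ≡⟨ cong (ℕ._∸ suc r) (1+r+nonDegree i) ⟩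
        n ℕ.∸ suc r                      ∎
        where open ≡-Reasoning

      complete : suc r ≡ n → ∀ i j → adj G i j ≡ not (does (i ≟ j))
      complete 1+r≡n i j with i ≟ j | count≡0 (nonNeighbour G i) none j
        where
        none : nonDegree i ≡ 0
        none = trans (nonDegree-regular i) (trans (cong (ℕ._∸ suc r) (sym 1+r≡n)) (ℕ.n∸n≡0 (suc r)))
      ... | yes refl | _ = adj-irrefl G i
      ... | no  _    | e with adj G i j
      ...   | true  = refl
      ...   | false = sym e

  module _ {n m} (G : Graph n) (H : Graph m) where

    private Γ = G ∨₌ H

    oldˡ : Fin n → Fin ((n + m) + n)
    oldˡ i = (i ↑ˡ m) ↑ˡ n

    oldʳ : Fin m → Fin ((n + m) + n)
    oldʳ j = (n ↑ʳ j) ↑ˡ n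

    new : Fin n → Fin ((n + m) + n)
    new i = (n + m) ↑ʳ i

    adj-ˡˡ : ∀ i j → adj Γ (oldˡ i) (oldˡ j) ≡ adj G i j
    adj-ˡˡ i j rewrite splitAt-↑ˡ (n + m) (i ↑ˡ m) n | splitAt-↑ˡ (n + m) (j ↑ˡ m) n
      | splitAt-↑ˡ n i m | splitAt-↑ˡ n j m = refl

    adj-ˡʳ : ∀ i j → adj Γ (oldˡ i) (oldʳ j) ≡ true
    adj-ˡʳ i j rewrite splitAt-↑ˡ (n + m) (i ↑ˡ m) n | splitAt-↑ˡ (n + m) (n ↑ʳ j) n
      | splitAt-↑ˡ n i m | splitAt-↑ʳ n m j = refl

    adj-ˡ′ : ∀ i j → adj Γ (oldˡ i) (new j) ≡ nonNeighbour G j i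
    adj-ˡ′ i j rewrite splitAt-↑ˡ (n + m) (i ↑ˡ m) n | splitAt-↑ʳ (n + m) n j
      | splitAt-↑ˡ n i m = refl

    adj-ʳˡ : ∀ i j → adj Γ (oldʳ i) (oldˡ j) ≡ true
    adj-ʳˡ i j = trans (adj-sym Γ (oldʳ i) (oldˡ j)) (adj-ˡʳ j i)

    adj-ʳʳ : ∀ i j → adj Γ (oldʳ i) (oldʳ j) ≡ adj H i j
    adj-ʳʳ i j rewrite splitAt-↑ˡ (n + m) (n ↑ʳ i) n | splitAt-↑ˡ (n + m) (n ↑ʳ j) n
      | splitAt-↑ʳ n m i | splitAt-↑ʳ n m j = refl

    adj-ʳ′ : ∀ i j → adj Γ (oldʳ i) (new j) ≡ false
    adj-ʳ′ i j rewrite splitAt-↑ˡ (n + m) (n ↑ʳ i) n | splitAt-↑ʳ (n + m) n j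
      | splitAt-↑ʳ n m i = refl

    adj-′ˡ : ∀ i j → adj Γ (new i) (oldˡ j) ≡ nonNeighbour G i j
    adj-′ˡ i j = trans (adj-sym Γ (new i) (oldˡ j)) (adj-ˡ′ j i)

    adj-′ʳ : ∀ i j → adj Γ (new i) (oldʳ j) ≡ false
    adj-′ʳ i j = trans (adj-sym Γ (new i) (oldʳ j)) (adj-ʳ′ j i)

    adj-′′ : ∀ i j → adj Γ (new i) (new j) ≡ false
    adj-′′ i j rewrite splitAt-↑ʳ (n + m) n i | splitAt-↑ʳ (n + m) n j = refl

    degree-split : ∀ v → degree Γ v ≡
      count (λ j → adj Γ v (oldˡ j)) + count (λ j → adj Γ v (oldʳ j)) + count (λ j → adj Γ v (new j))
    degree-split v = begin
      degree Γ v                                                 ≡⟨ degree-count Γ v ⟩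
      count (adj Γ v)                                            ≡⟨ count-split (n + m) (adj Γ v) ⟩
      count (λ w → adj Γ v (w ↑ˡ n)) + count (λ j → adj Γ v (new j))
        ≡⟨ cong (_+ count (λ j → adj Γ v (new j))) (count-split n (λ w → adj Γ v (w ↑ˡ n))) ⟩
      count (λ j → adj Γ v (oldˡ j)) + count (λ j → adj Γ v (oldʳ j)) + count (λ j → adj Γ v (new j)) ∎
      where open ≡-Reasoning

    data Vertex : Fin ((n + m) + n) → Set where
      isˡ : ∀ i → Vertex (oldˡ i)
      isʳ : ∀ j → Vertex (oldʳ j)
      is′ : ∀ i → Vertex (new i)

    vertex : ∀ v → Vertex v
    vertex v with splitView (n + m) n v
    ... | right i = is′ i
    ... | left w with splitView n m w
    ...   | left i  = isˡ i
    ...   | right j = isʳ j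

  -- Functions of the parameters alone, so that joins of graphs with equal sizes and degrees produce
  -- literally the same scalars.
  degreeˡ : (n m r : ℕ) → ℕ
  degreeˡ n m r = (r + m) + (n ℕ.∸ suc r)

  degreeʳ degree′ : ℕ → ℕ → ℕ
  degreeʳ n s = n ℕ.+ s
  degree′ n r = n ℕ.∸ suc r

  module RegularJoin {n m r s} (G : Graph n) (H : Graph m)
    (regG : ∀ i → degree G i ≡ r) (regH : ∀ j → degree H j ≡ s) where

    private Γ = G ∨₌ H

    degree-oldˡ : ∀ i → degree Γ (oldˡ G H i) ≡ degreeˡ n m r
    degree-oldˡ i = trans (degree-split G H (oldˡ G H i)) (cong₂ _+_ (cong₂ _+_
      (trans (count-cong (adj-ˡˡ G H i)) (trans (sym (degree-count G i)) (regG i)))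
      (trans (count-cong (adj-ˡʳ G H i)) (count-true m)))
      (trans (count-cong λ j → trans (adj-ˡ′ G H i j) (nonNeighbour-sym G j i)) (nonDegree-regular G regG i)))

    degree-oldʳ : ∀ j → degree Γ (oldʳ G H j) ≡ degreeʳ n s
    degree-oldʳ j = trans (degree-split G H (oldʳ G H j)) (trans (cong₂ _+_ (cong₂ _+_
      (trans (count-cong (adj-ʳˡ G H j)) (count-true n))
      (trans (count-cong (adj-ʳʳ G H j)) (trans (sym (degree-count H j)) (regH j))))
      (trans (count-cong (adj-ʳ′ G H j)) (count-false n))) (ℕ.+-identityʳ (n + s)))

    degree-new : ∀ i → degree Γ (new G H i) ≡ degree′ n r
    degree-new i = trans (degree-split G H (new G H i)) (trans (cong₂ _+_ (cong₂ _+_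
      (trans (count-cong (adj-′ˡ G H i)) (nonDegree-regular G regG i))
      (trans (count-cong (adj-′ʳ G H i)) (count-false m)))
      (trans (count-cong (adj-′′ G H i)) (count-false n)))
      (trans (ℕ.+-identityʳ _) (ℕ.+-identityʳ _)))

    -- The vertex `i` witnesses r < n, which makes the truncated subtraction exact.
    degree-classˡ : ∀ i → suc (degreeˡ n m r) ≡ n + m
    degree-classˡ i = begin
      suc (r + m + ν)       ≡⟨ cong suc (ℕ.+-assoc r m ν) ⟩
      suc (r + (m + ν))     ≡⟨ cong (λ k → suc (r + k)) (ℕ.+-comm m ν) ⟩
      suc (r + (ν + m))     ≡⟨ cong suc (ℕ.+-assoc r ν m) ⟨
      suc (r + ν) + m       ≡⟨ cong (λ k → suc (r + k) + m) (nonDegree-regular G regG i) ⟨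
      suc (r + nonDegree G i) + m ≡⟨ cong (_+ m) (1+r+nonDegree G regG i) ⟩
      n + m                 ∎
      where
      open ≡-Reasoning
      ν = n ℕ.∸ suc r

    -- The non-neighbours of uᵢ contribute equally to the degrees of uᵢ and of its copy u′ᵢ; uᵢ has
    -- r + m further neighbours, so equal degrees would force m = 0.
    not-regular : .{{_ : NonZero n}} .{{_ : NonZero m}} → ¬ Regular Γ
    not-regular (d , reg) = ℕ.≢-nonZero⁻¹ m (ℕ.m+n≡0⇒n≡0 r
      (ℕ.+-cancelʳ-≡ (n ℕ.∸ suc r) (r + m) 0
        (trans (sym (degree-oldˡ i)) (trans (reg (oldˡ G H i)) (trans (sym (reg (new G H i))) (degree-new i))))))
      where
      i : Fin n
      i = fromℕ< (ℕ.n≢0⇒n>0 (ℕ.≢-nonZero⁻¹ n))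

    -- Since u has degree n + m − 1 and u′ has degree less than n, only the
    -- vertices of H have degree n + s, unless H is complete.
    degreeʳ-vertex : suc s ≢ m → ∀ v → degree Γ v ≡ degreeʳ n s → ∃ λ j → v ≡ oldʳ G H j
    degreeʳ-vertex 1+s≢m v d with vertex G H v
    ... | isʳ j = j , refl
    ... | isˡ i = ⊥-elim (1+s≢m (ℕ.+-cancelˡ-≡ n (suc s) m
      (trans (ℕ.+-suc n s) (trans (cong suc (trans (sym d) (degree-oldˡ i))) (degree-classˡ i)))))
    ... | is′ i = ⊥-elim (ℕ.<⇒≢ (ℕ.<-≤-trans ν<n (ℕ.m≤m+n n s)) (trans (sym (degree-new i)) d))
      where
      ν<n : n ℕ.∸ suc r < n
      ν<n = subst (_< n) (nonDegree-regular G regG i)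
        (subst (nonDegree G i <_) (1+r+nonDegree G regG i) (ℕ.s≤s (ℕ.m≤n+m _ r)))

  ≅-degree : ∀ {n m} {G : Graph n} {H : Graph m} ((φ , _) : G ≅ H) →
    ∀ i → degree H (Inverse.to φ i) ≡ degree G i
  ≅-degree {G = G} {H} (φ , φ-adj) i = begin
    degree H (Inverse.to φ i)                                 ≡⟨ degree-count H _ ⟩
    count (adj H (Inverse.to φ i))                            ≡⟨ sum-permute (bit ∘ adj H (Inverse.to φ i)) φ ⟩
    count (λ j → adj H (Inverse.to φ i) (Inverse.to φ j))     ≡⟨ count-cong (φ-adj i) ⟨
    count (adj G i)                                           ≡⟨ degree-count G i ⟨
    degree G i                                                ∎
    where open ≡-Reasoning

  module _ {n m r s} (G₁ H₁ : Graph n) (G₂ H₂ : Graph m)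
    (regG₁ : ∀ i → degree G₁ i ≡ r) (regH₁ : ∀ i → degree H₁ i ≡ r)
    (regG₂ : ∀ j → degree G₂ j ≡ s) (regH₂ : ∀ j → degree H₂ j ≡ s) where

    private
      module G = RegularJoin G₁ G₂ regG₁ regG₂
      module H = RegularJoin H₁ H₂ regH₁ regH₂

    ∨₌-reflects-≅ : (G₁ ∨₌ G₂) ≅ (H₁ ∨₌ H₂) → G₂ ≅ H₂
    ∨₌-reflects-≅ iso@(φ , φ-adj) with suc s ℕ.≟ m
    -- Here the old vertices of both factors have degree n + m - 1 and cannot be separated. But `G₂`
    -- and `H₂` are both complete on m vertices, so the identity is an isomorphism.
    ... | yes 1+s≡m = ↔-id _ , λ i j →
      trans (complete G₂ regG₂ 1+s≡m i j) (sym (complete H₂ regH₂ 1+s≡m i j))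
    ... | no  1+s≢m = mk↔ₛ′ ψ ψ⁻¹ ψ∘ψ⁻¹ ψ⁻¹∘ψ , λ i j → begin
      adj G₂ i j                                           ≡⟨ adj-ʳʳ G₁ G₂ i j ⟨
      adj (G₁ ∨₌ G₂) (v i) (v j)                           ≡⟨ φ-adj (v i) (v j) ⟩
      adj (H₁ ∨₌ H₂) (to (v i)) (to (v j))                 ≡⟨ cong₂ (adj (H₁ ∨₌ H₂)) (to-v i) (to-v j) ⟩
      adj (H₁ ∨₌ H₂) (v (ψ i)) (v (ψ j))                   ≡⟨ adj-ʳʳ H₁ H₂ (ψ i) (ψ j) ⟩
      adj H₂ (ψ i) (ψ j)                                   ∎
      where
      open ≡-Reasoning
      open Inverse φ using (to; from; strictlyInverseˡ; strictlyInverseʳ)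

      v : Fin m → Fin ((n + m) + n)
      v = oldʳ G₁ G₂

      v-injective : ∀ {i j} → v i ≡ v j → i ≡ j
      v-injective e = ↑ʳ-injective n _ _ (↑ˡ-injective n _ _ e)

      image : ∀ j → ∃ λ k → to (v j) ≡ v k
      image j = H.degreeʳ-vertex 1+s≢m (to (v j))
        (trans (≅-degree {G = G₁ ∨₌ G₂} {H₁ ∨₌ H₂} iso (v j)) (G.degree-oldʳ j))

      preimage : ∀ j → ∃ λ k → from (v j) ≡ v k
      preimage j = G.degreeʳ-vertex 1+s≢m (from (v j)) (begin
        degree (G₁ ∨₌ G₂) (from (v j))       ≡⟨ ≅-degree {G = G₁ ∨₌ G₂} {H₁ ∨₌ H₂} iso (from (v j)) ⟨
        degree (H₁ ∨₌ H₂) (to (from (v j)))  ≡⟨ cong (degree (H₁ ∨₌ H₂)) (strictlyInverseˡ (v j)) ⟩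
        degree (H₁ ∨₌ H₂) (v j)              ≡⟨ H.degree-oldʳ j ⟩
        degreeʳ n s                      ∎)

      ψ ψ⁻¹ : Fin m → Fin m
      ψ   = proj₁ ∘ image
      ψ⁻¹ = proj₁ ∘ preimage

      to-v : ∀ j → to (v j) ≡ v (ψ j)
      to-v = proj₂ ∘ image

      from-v : ∀ j → from (v j) ≡ v (ψ⁻¹ j)
      from-v = proj₂ ∘ preimage

      ψ∘ψ⁻¹ : ∀ j → ψ (ψ⁻¹ j) ≡ j
      ψ∘ψ⁻¹ j = v-injective (trans (sym (to-v (ψ⁻¹ j))) (trans (cong to (sym (from-v j))) (strictlyInverseˡ (v j))))

      ψ⁻¹∘ψ : ∀ j → ψ⁻¹ (ψ j) ≡ j
      ψ⁻¹∘ψ j = v-injective (trans (sym (from-v (ψ j))) (trans (cong from (sym (to-v j))) (strictlyInverseʳ (v j))))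

open Combinatorics

-- Weighted adjacency matrices of regular graphs and of their joins

↑ˡ≢↑ʳ : ∀ {n m} (i : Fin n) (j : Fin m) → i ↑ˡ m ≢ n ↑ʳ j
↑ˡ≢↑ʳ {n} {m} i j e
  with ≡.trans (≡.sym (splitAt-↑ˡ n i m)) (≡.trans (≡.cong (splitAt n) e) (splitAt-↑ʳ n m j))
... | ()

module WeightedGraphs {c ℓ} {K : CommutativeRing c ℓ} (F : IsClosedField K) where

  open CommutativeRing K hiding (zero)
  open SemiringSum semiring using (sum-cong-≋)
  open Matrices K
  open MatrixAlgebra K
  open BlockMatrices K
  open JoinDeterminant K
  open IntegerCoefficients K
  open SetoidReasoning setoid
  open Polynomials F
  open JoinCharPoly F

  indicator : Bool → Carrier
  indicator b = if b then 1# else 0#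

  adjMatrix : ∀ {n} → Graph n → Matrix n
  adjMatrix G i j = indicator (adj G i j)

  sum-indicator : ∀ {n} (f : Fin n → Bool) → sum (indicator ∘ f) ≈ fromℕ (count f)
  sum-indicator {zero}  f = refl
  sum-indicator {suc n} f with f zero
  ... | true  = +-congˡ (sum-indicator (f ∘ suc))
  ... | false = trans (+-identityˡ _) (sum-indicator (f ∘ suc))

  adjMatrix-sym : ∀ {n} (G : Graph n) → adjMatrix G ᵀ ≈ᴹ adjMatrix G
  adjMatrix-sym G i j = reflexive (≡.cong indicator (adj-sym G j i))

  -- Each of the four graph matrices has this form for suitable φ, ω, ε.
  weighted : (φ ω : ℕ → Carrier) → Carrier → ∀ {n} → Graph n → Matrix n
  weighted φ ω ε G i j =
    diag (λ i → φ (degree G i)) i j + ε * (ω (degree G i) * adjMatrix G i j * ω (degree G j))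

  diag-↑ˡ : ∀ {n m} (d : Vector Carrier (n ℕ.+ m)) i j → diag d (i ↑ˡ m) (j ↑ˡ m) ≈ diag (λ i → d (i ↑ˡ m)) i j
  diag-↑ˡ {n} {m} d i j with i ≟ j
  ... | yes ≡.refl = diag-≡ d (i ↑ˡ m)
  ... | no  i≢j    = diag-≢ d (i≢j ∘ ↑ˡ-injective m i j)

  diag-↑ʳ : ∀ {n m} (d : Vector Carrier (n ℕ.+ m)) i j → diag d (n ↑ʳ i) (n ↑ʳ j) ≈ diag (λ i → d (n ↑ʳ i)) i j
  diag-↑ʳ {n} {m} d i j with i ≟ j
  ... | yes ≡.refl = diag-≡ d (n ↑ʳ i)
  ... | no  i≢j    = diag-≢ d (i≢j ∘ ↑ʳ-injective n i j)

  diag-shift : ∀ {n} {d : Vector Carrier n} {y} x → (∀ i → d i ≈ y) → ∀ i j →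
    scalar x i j - diag d i j ≈ scalar (x - y) i j
  diag-shift x d≈y i j with i ≟ j
  ... | yes _ = +-congˡ (-‿cong (d≈y i))
  ... | no  _ = -‿inverseʳ 0#

  module _ {n r} (G : Graph n) (reg : ∀ i → degree G i ≡ r) where

    private A = adjMatrix G

    adjMatrix-rowSums : RowSums A (fromℕ r)
    adjMatrix-rowSums i = trans (sum-indicator (adj G i))
      (reflexive (≡.cong fromℕ (≡.trans (≡.sym (degree-count G i)) (reg i))))

    weighted-regular : ∀ φ ω ε → weighted φ ω ε G ≈ᴹ linear (φ r) (ε * (ω r * ω r)) A
    weighted-regular φ ω ε i j = +-cong diagonal
      (trans (reflexive (≡.cong₂ (λ d d′ → ε * (ω d * A i j * ω d′)) (reg i) (reg j)))
        (solve 3 (λ ε w a → ε :* (w :* a :* w) := ε :* (w :* w) :* a) refl ε (ω r) (A i j)))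
      where
      diagonal : diag (λ i → φ (degree G i)) i j ≈ scalar (φ r) i j
      diagonal with i ≟ j
      ... | yes _ = reflexive (≡.cong φ (reg i))
      ... | no  _ = refl

    trace-adjMatrix : trace A ≈ 0#
    trace-adjMatrix = sum-zero λ i → reflexive (≡.cong indicator (adj-irrefl G i))

    -- By symmetry and because the entries are 0 or 1, the diagonal entries of A² are the row sums
    -- of A.
    trace-adjMatrix² : trace (A ·ᴹ A) ≈ fromℕ n * fromℕ r
    trace-adjMatrix² = begin
      sum (λ i → sum λ k → A i k * A k i)
        ≈⟨ sum-cong-≋ (λ i → sum-cong-≋ λ k → trans (*-congˡ (adjMatrix-sym G i k)) (idempotent (adj G i k))) ⟩
      sum (λ i → sum (A i))
        ≈⟨ sum-cong-≋ adjMatrix-rowSums ⟩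
      sum {n} (λ i → fromℕ r)
        ≈⟨ sum-cong-≋ {n} (λ i → *-identityʳ (fromℕ r)) ⟨
      sum {n} (λ i → fromℕ r * 1#)
        ≈⟨ sum-⊛ {n} (fromℕ r) (sum-1 n) ⟩
      fromℕ r * fromℕ n
        ≈⟨ *-comm _ _ ⟩
      fromℕ n * fromℕ r ∎
      where
      idempotent : ∀ b → indicator b * indicator b ≈ indicator b
      idempotent true  = *-identityˡ 1#
      idempotent false = zeroˡ 0#

    trace-scalar : ∀ y → trace (scalar {n} y) ≈ y * fromℕ n
    trace-scalar y = trans
      (sum-cong-≋ {n} λ i → trans (diag-≡ (λ _ → y) i) (sym (*-identityʳ y)))
      (sum-⊛ {n} y (sum-1 n))

    trace-linear : ∀ a b → trace (linear a b A) ≈ fromℕ n * a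
    trace-linear a b = trans (sum-⊕ {n} (trace-scalar a) (sum-⊛ {n} b trace-adjMatrix))
      (solve 3 (λ a n b → a :* n :+ b :* :0 := n :* a) refl a (fromℕ n) b)

    trace-linear² : ∀ a b → trace (linear a b A ·ᴹ linear a b A) ≈ fromℕ n * (a * a + b * b * fromℕ r)
    trace-linear² a b = begin
      trace (linear a b A ·ᴹ linear a b A)
        ≈⟨ sum-cong-≋ (λ i → square i i) ⟩
      sum (λ i → a * scalar a i i + (a * b + b * a) * A i i + b * b * (A ·ᴹ A) i i)
        ≈⟨ sum-⊕ {n} (sum-⊕ {n} (sum-⊛ {n} a (trace-scalar a)) (sum-⊛ {n} (a * b + b * a) trace-adjMatrix))
             (sum-⊛ {n} (b * b) trace-adjMatrix²) ⟩
      a * (a * fromℕ n) + (a * b + b * a) * 0# + b * b * (fromℕ n * fromℕ r)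
        ≈⟨ solve 4 (λ a b n r → a :* (a :* n) :+ (a :* b :+ b :* a) :* :0 :+ b :* b :* (n :* r) :=
             n :* (a :* a :+ b :* b :* r)) refl a b (fromℕ n) (fromℕ r) ⟩
      fromℕ n * (a * a + b * b * fromℕ r) ∎
      where
      square : ∀ i j → (linear a b A ·ᴹ linear a b A) i j ≈
        a * scalar a i j + (a * b + b * a) * A i j + b * b * (A ·ᴹ A) i j
      square i j = begin
        sum (λ k → (scalar a i k + b * A i k) * (scalar a k j + b * A k j))
          ≈⟨ sum-cong-≋ (λ k → solve 5 (λ s x t y b → (s :+ b :* x) :* (t :+ b :* y) :=
               s :* t :+ b :* (s :* y) :+ b :* (x :* t) :+ b :* b :* (x :* y))
               refl (scalar a i k) (A i k) (scalar a k j) (A k j) b) ⟩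
        sum (λ k → scalar a i k * scalar a k j + b * (scalar a i k * A k j) +
                   b * (A i k * scalar a k j) + b * b * (A i k * A k j))
          ≈⟨ sum-⊕ {n} (sum-⊕ {n} (sum-⊕ {n} (scalar-·ᴹ a (scalar a) i j) (sum-⊛ {n} b (scalar-·ᴹ a A i j)))
               (sum-⊛ {n} b (·ᴹ-scalar A a i j))) (sum-⊛ {n} (b * b) refl) ⟩
        a * scalar a i j + b * (a * A i j) + b * (a * A i j) + b * b * (A ·ᴹ A) i j
          ≈⟨ solve 5 (λ a e b x s → a :* e :+ b :* (a :* x) :+ b :* (a :* x) :+ b :* b :* s :=
               a :* e :+ (a :* b :+ b :* a) :* x :+ b :* b :* s) refl a (scalar a i j) b (A i j) ((A ·ᴹ A) i j) ⟩
        a * scalar a i j + (a * b + b * a) * A i j + b * b * (A ·ᴹ A) i j ∎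

  -- `φ` and `ω` are constant on each of the three classes of vertices, the old ones of G, those of
  -- H and the new ones, so the weights become scalars in front of the blocks. The sign in `- ε`
  -- comes from subtracting the matrix from x.
  joinPencil : ∀ {n m r s} (G : Graph n) (H : Graph m) →
    (∀ i → degree G i ≡ r) → (∀ j → degree H j ≡ s) → ∀ φ ω ε →
    let u = degreeˡ n m r ; v = degreeʳ n s ; w = degree′ n r in
    ∀ x → diag (λ _ → x) -ᴹ weighted φ ω ε (G ∨₌ H) ≈ᴹ
      joinMatrix (x - φ u) (- ε * (ω u * ω u)) (- ε * (ω u * ω v)) (- ε * (ω u * ω w))
                 (x - φ v) (- ε * (ω v * ω v)) (x - φ w) (adjMatrix G) (adjMatrix H)
  joinPencil {n} {m} {r} {s} G H regG regH φ ω ε x =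
    block-unique (block (linear (x - φ u) q A) (γ ⊛ 𝐉) (γ ⊛ 𝐉) (linear (x - φ v) b B))
      (newRows m δ A ᵀ) (newRows m δ A) (scalar (x - φ w))
      (block-unique (linear (x - φ u) q A) (γ ⊛ 𝐉) (γ ⊛ 𝐉) (linear (x - φ v) b B)
        (λ i j → entry (shiftˡ i j) (degree-oldˡ i) (degree-oldˡ j) (adj-ˡˡ G H i j))
        (λ i j → trans (entry (offDiagonal (oldˡ≢oldʳ i j)) (degree-oldˡ i) (degree-oldʳ j) (adj-ˡʳ G H i j))
                   (+-identityˡ _))
        (λ i j → trans (entry (offDiagonal (oldˡ≢oldʳ j i ∘ ≡.sym)) (degree-oldʳ i) (degree-oldˡ j) (adj-ʳˡ G H i j))
                   (trans (+-identityˡ _) (*-congʳ (*-congˡ (*-comm (ω v) (ω u))))))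
        (λ i j → entry (shiftʳ i j) (degree-oldʳ i) (degree-oldʳ j) (adj-ʳʳ G H i j)))
      column
      (λ i j → trans (symmetric (new G H i) (j ↑ˡ n)) (column j i))
      (λ i j → trans (entry (shift′ i j) (degree-new i) (degree-new j) (adj-′′ G H i j))
                 (trans (+-congˡ (zeroʳ _)) (+-identityʳ _)))
    where
    open RegularJoin G H regG regH
    Γ = G ∨₌ H
    u v w : ℕ
    u = degreeˡ n m r
    v = degreeʳ n s
    w = degree′ n r
    A = adjMatrix G
    B = adjMatrix H
    q γ δ b : Carrier
    q = - ε * (ω u * ω u)
    γ = - ε * (ω u * ω v)
    δ = - ε * (ω u * ω w)
    b = - ε * (ω v * ω v)

    P : Matrix ((n ℕ.+ m) ℕ.+ n)
    P = diag (λ _ → x) -ᴹ weighted φ ω ε Γ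

    φᵈ : Vector Carrier ((n ℕ.+ m) ℕ.+ n)
    φᵈ i = φ (degree Γ i)

    entry : ∀ {i j d d′ e β} → diag (λ _ → x) i j - diag φᵈ i j ≈ e →
      degree Γ i ≡ d → degree Γ j ≡ d′ → adj Γ i j ≡ β → P i j ≈ e + - ε * (ω d * ω d′) * indicator β
    entry {i} {j} diagonal ≡.refl ≡.refl ≡.refl = trans
      (solve 6 (λ x f ε w a w′ → x :- (f :+ ε :* (w :* a :* w′)) := x :- f :+ (:- ε) :* (w :* w′) :* a)
        refl (diag (λ _ → x) i j) (diag φᵈ i j) ε (ω (degree Γ i)) (adjMatrix Γ i j) (ω (degree Γ j)))
      (+-congʳ diagonal)

    symmetric : ∀ i j → P i j ≈ P j i
    symmetric i j = +-cong (diag-sym (λ _ → x) i j) (-‿cong (+-cong (diag-sym φᵈ i j)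
      (*-congˡ (trans (*-congʳ (*-congˡ (adjMatrix-sym Γ j i)))
        (solve 3 (λ w a w′ → w :* a :* w′ := w′ :* a :* w) refl _ _ _)))))

    offDiagonal : ∀ {i j} → i ≢ j → diag (λ _ → x) i j - diag φᵈ i j ≈ 0#
    offDiagonal i≢j = trans (+-cong (diag-≢ (λ _ → x) i≢j) (-‿cong (diag-≢ φᵈ i≢j))) (-‿inverseʳ 0#)

    oldˡ≢oldʳ : ∀ i j → oldˡ G H i ≢ oldʳ G H j
    oldˡ≢oldʳ i j = ↑ˡ≢↑ʳ i j ∘ ↑ˡ-injective n _ _

    shiftˡ : ∀ i j → diag (λ _ → x) (oldˡ G H i) (oldˡ G H j) - diag φᵈ (oldˡ G H i) (oldˡ G H j) ≈ scalar (x - φ u) i j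
    shiftˡ i j = trans
      (+-cong (trans (diag-↑ˡ (λ _ → x) (i ↑ˡ m) (j ↑ˡ m)) (diag-↑ˡ (λ _ → x) i j))
        (-‿cong (trans (diag-↑ˡ φᵈ (i ↑ˡ m) (j ↑ˡ m)) (diag-↑ˡ (λ i → φᵈ (i ↑ˡ n)) i j))))
      (diag-shift x (λ i → reflexive (≡.cong φ (degree-oldˡ i))) i j)

    shiftʳ : ∀ i j → diag (λ _ → x) (oldʳ G H i) (oldʳ G H j) - diag φᵈ (oldʳ G H i) (oldʳ G H j) ≈ scalar (x - φ v) i j
    shiftʳ i j = trans
      (+-cong (trans (diag-↑ˡ (λ _ → x) (n ↑ʳ i) (n ↑ʳ j)) (diag-↑ʳ {n} (λ _ → x) i j))
        (-‿cong (trans (diag-↑ˡ φᵈ (n ↑ʳ i) (n ↑ʳ j)) (diag-↑ʳ {n} (λ i → φᵈ (i ↑ˡ n)) i j))))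
      (diag-shift x (λ i → reflexive (≡.cong φ (degree-oldʳ i))) i j)

    shift′ : ∀ i j → diag (λ _ → x) (new G H i) (new G H j) - diag φᵈ (new G H i) (new G H j) ≈ scalar (x - φ w) i j
    shift′ i j = trans
      (+-cong (diag-↑ʳ {n ℕ.+ m} (λ _ → x) i j) (-‿cong (diag-↑ʳ {n ℕ.+ m} φᵈ i j)))
      (diag-shift x (λ i → reflexive (≡.cong φ (degree-new i))) i j)

    indicator-nonNeighbour : ∀ i j → indicator (nonNeighbour G i j) ≈ complement A i j
    indicator-nonNeighbour i j with i ≟ j
    ... | yes ≡.refl rewrite adj-irrefl G i = solve 0 (:0 := :1 :- (:1 :+ :0)) refl
    ... | no  _ with adj G i j
    ...   | true  = solve 0 (:0 := :1 :- (:0 :+ :1)) refl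
    ...   | false = solve 0 (:1 := :1 :- (:0 :+ :0)) refl

    column : ∀ i j → P (i ↑ˡ n) (new G H j) ≈ newRows m δ A j i
    column i j with splitView n m i
    ... | left i  = trans (entry (offDiagonal (↑ˡ≢↑ʳ (i ↑ˡ m) j)) (degree-oldˡ i) (degree-new j) (adj-ˡ′ G H i j))
      (trans (+-identityˡ _) (trans (*-congˡ (indicator-nonNeighbour j i))
        (reflexive (≡.cong [ (λ k → δ * complement A j k) , (λ _ → 0#) ]′ (≡.sym (splitAt-↑ˡ n i m))))))
    ... | right i = trans (entry (offDiagonal (↑ˡ≢↑ʳ (n ↑ʳ i) j)) (degree-oldʳ i) (degree-new j) (adj-ʳ′ G H i j))
      (trans (+-identityˡ _) (trans (zeroʳ _)
        (reflexive (≡.cong [ (λ k → δ * complement A j k) , (λ _ → 0#) ]′ (≡.sym (splitAt-↑ʳ n m i))))))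

  charPoly-∨₌ : ∀ {n m r s} (G₁ H₁ : Graph n) (G₂ H₂ : Graph m) →
    (∀ i → degree G₁ i ≡ r) → (∀ i → degree H₁ i ≡ r) →
    (∀ j → degree G₂ j ≡ s) → (∀ j → degree H₂ j ≡ s) →
    CharPoly≈ (adjMatrix G₁) (adjMatrix H₁) → CharPoly≈ (adjMatrix G₂) (adjMatrix H₂) →
    ∀ φ ω ε → CharPoly≈ (weighted φ ω ε (G₁ ∨₌ G₂)) (weighted φ ω ε (H₁ ∨₌ H₂))
  charPoly-∨₌ G₁ H₁ G₂ H₂ regG₁ regH₁ regG₂ regH₂ G₁≈H₁ G₂≈H₂ φ ω ε =
    charPoly-join-≈ _ _ _ _ _ _ _
      (adjMatrix-rowSums G₁ regG₁) (adjMatrix-rowSums H₁ regH₁) (adjMatrix-sym G₁) (adjMatrix-sym H₁)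
      (adjMatrix-rowSums G₂ regG₂) (adjMatrix-rowSums H₂ regH₂) G₁≈H₁ G₂≈H₂
      (joinPencil G₁ G₂ regG₁ regG₂ φ ω ε) (joinPencil H₁ H₂ regH₁ regH₂ φ ω ε)

-- Recovering the adjacency spectrum of a regular graph

module RegularSpectra {c ℓ} {K : CommutativeRing c ℓ} (F : IsClosedField K) where

  open CommutativeRing K hiding (zero)
  open RingProperties ring using (x∙y⁻¹≈ε⇒x≈y)
  open Matrices K
  open MatrixAlgebra K
  open BlockMatrices K
  open JoinDeterminant K
  open IntegerCoefficients K
  open SetoidReasoning setoid
  open IsClosedField F
  open Polynomials F
  open WeightedGraphs F

  fromℕ-cancel : ∀ n .{{_ : NonZero n}} {x y} → fromℕ n * x ≈ fromℕ n * y → x ≈ y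
  fromℕ-cancel (suc n) {x} {y} e = x∙y⁻¹≈ε⇒x≈y _ _ (cancel (char-0 n) (trans
    (solve 3 (λ n x y → n :* (x :- y) := n :* x :- n :* y) refl (fromℕ (suc n)) x y)
    (trans (+-congʳ e) (-‿inverseʳ _))))

  module _ {n r r′} (G H : Graph n) (regG : ∀ i → degree G i ≡ r) (regH : ∀ i → degree H i ≡ r′)
    (φ ω : ℕ → Carrier) (ε : Carrier)
    (G≈H : CharPoly≈ (weighted φ ω ε G) (weighted φ ω ε H)) where

    private
      coefficient : ℕ → Carrier
      coefficient d = ε * (ω d * ω d)

      M N : Matrix n
      M = linear (φ r) (coefficient r) (adjMatrix G)
      N = linear (φ r′) (coefficient r′) (adjMatrix H)

      linear-≈ : CharPoly≈ M N
      linear-≈ x = trans (sym (charPoly-cong (weighted-regular G regG φ ω ε) x))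
        (trans (G≈H x) (charPoly-cong (weighted-regular H regH φ ω ε) x))

    regular-diagonal : .{{_ : NonZero n}} → φ r ≈ φ r′
    regular-diagonal = fromℕ-cancel n (begin
      fromℕ n * φ r    ≈⟨ trace-linear G regG (φ r) (coefficient r) ⟨
      trace M          ≈⟨ trace-unique M N linear-≈ ⟩
      trace N          ≈⟨ trace-linear H regH (φ r′) (coefficient r′) ⟩
      fromℕ n * φ r′   ∎)

    regular-squares : .{{_ : NonZero n}} →
      coefficient r * coefficient r * fromℕ r ≈ coefficient r′ * coefficient r′ * fromℕ r′
    regular-squares = begin
      b * b * fromℕ r
        ≈⟨ solve 2 (λ a y → y := a :* a :+ y :- a :* a) refl a (b * b * fromℕ r) ⟩
      a * a + b * b * fromℕ r - a * a
        ≈⟨ +-cong squares (-‿cong (*-cong regular-diagonal regular-diagonal)) ⟩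
      a′ * a′ + b′ * b′ * fromℕ r′ - a′ * a′
        ≈⟨ solve 2 (λ a y → y := a :* a :+ y :- a :* a) refl a′ (b′ * b′ * fromℕ r′) ⟨
      b′ * b′ * fromℕ r′ ∎
      where
      a a′ b b′ : Carrier
      a  = φ r
      a′ = φ r′
      b  = coefficient r
      b′ = coefficient r′
      squares : a * a + b * b * fromℕ r ≈ a′ * a′ + b′ * b′ * fromℕ r′
      squares = fromℕ-cancel n (begin
        fromℕ n * (a * a + b * b * fromℕ r)      ≈⟨ trace-linear² G regG a b ⟨
        trace (M ·ᴹ M)                           ≈⟨ trace-unique (M ·ᴹ M) (N ·ᴹ N) (charPoly-square-≈ M N linear-≈) ⟩
        trace (N ·ᴹ N)                           ≈⟨ trace-linear² H regH a′ b′ ⟩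
        fromℕ n * (a′ * a′ + b′ * b′ * fromℕ r′) ∎)

  -- For X = a + bA with b ≠ 0, A is the linear polynomial (X - a)/b in X. The alternative r = 0 is
  -- for 𝓛, where b vanishes at degree 0; both adjacency matrices are then zero.
  adjMatrix-≈ : ∀ {n r} (G H : Graph n) → (∀ i → degree G i ≡ r) → (∀ i → degree H i ≡ r) →
    ∀ φ ω ε → ¬ ε * (ω r * ω r) ≈ 0# ⊎ r ≡ 0 →
    CharPoly≈ (weighted φ ω ε G) (weighted φ ω ε H) → CharPoly≈ (adjMatrix G) (adjMatrix H)
  adjMatrix-≈ G H regG regH φ ω ε (inj₂ ≡.refl) G≈H =
    charPoly-cong λ i j → reflexive (≡.cong indicator (≡.trans (no-edges G regG i j) (≡.sym (no-edges H regH i j))))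
    where
    no-edges : ∀ {n} (G : Graph n) → (∀ i → degree G i ≡ 0) → ∀ i j → adj G i j ≡ false
    no-edges G reg i = count≡0 (adj G i) (≡.trans (≡.sym (degree-count G i)) (reg i))
  adjMatrix-≈ {n} {r} G H regG regH φ ω ε (inj₁ b≉0) G≈H x = begin
    charPoly (adjMatrix G) x
      ≈⟨ charPoly-cong (recover G regG) x ⟩
    charPoly (linear (- (b ⁻¹ * a)) (b ⁻¹) (weighted φ ω ε G)) x
      ≈⟨ charPoly-linear-≈ (weighted φ ω ε G) (weighted φ ω ε H) G≈H (- (b ⁻¹ * a)) (b ⁻¹) x ⟩
    charPoly (linear (- (b ⁻¹ * a)) (b ⁻¹) (weighted φ ω ε H)) x
      ≈⟨ charPoly-cong (recover H regH) x ⟨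
    charPoly (adjMatrix H) x ∎
    where
    a b : Carrier
    a = φ r
    b = ε * (ω r * ω r)
    recover : ∀ (G : Graph n) → (∀ i → degree G i ≡ r) →
      adjMatrix G ≈ᴹ linear (- (b ⁻¹ * a)) (b ⁻¹) (weighted φ ω ε G)
    recover G reg i j = begin
      A i j
        ≈⟨ *-identityˡ _ ⟨
      1# * A i j
        ≈⟨ *-congʳ (inverse b≉0) ⟨
      b ⁻¹ * b * A i j
        ≈⟨ solve 5 (λ y b x a e → y :* b :* x := (:- (y :* a)) :* e :+ y :* (a :* e :+ b :* x))
             refl (b ⁻¹) b (A i j) a (1ᴹ i j) ⟩
      - (b ⁻¹ * a) * 1ᴹ i j + b ⁻¹ * (a * 1ᴹ i j + b * A i j)
        ≈⟨ +-cong (scalar-⊛ (- (b ⁻¹ * a)) i j) (*-congˡ (+-congʳ (scalar-⊛ a i j))) ⟨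
      scalar (- (b ⁻¹ * a)) i j + b ⁻¹ * (scalar a i j + b * A i j)
        ≈⟨ +-congˡ (*-congˡ (weighted-regular G reg φ ω ε i j)) ⟨
      linear (- (b ⁻¹ * a)) (b ⁻¹) (weighted φ ω ε G) i j ∎
      where A = adjMatrix G

-- The four graph matrices over ℂ

module GraphSpectra {c ℓ₁ ℓ₂} (R : RealClosedField c ℓ₁ ℓ₂) where

  open RealClosedField R using (commutativeRing; _⁻¹; √_; 0≉1; *-inverseʳ; √-square)
  open CommutativeRing commutativeRing hiding (zero)
  open RingProperties ring using (-0#≈0#; +-cancelˡ)
  open Matrices commutativeRing using (fromℕ; diag)
  open MatrixAlgebra commutativeRing using (sum-diagˡ; sum-diagʳ)
  open IntegerCoefficients commutativeRing
  open Complexification commutativeRing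
  open ComplexNumbers R
  open Spectral R
  open Polynomials isClosedField
  open WeightedGraphs isClosedField
  open RegularSpectra isClosedField
  open MatrixAlgebra complexRing using (_≈ᴹ_)
  open SetoidReasoning setoid
  private module C = CommutativeRing complexRing

  real-+ : ∀ a b → real (a + b) ≈ᶜ real a +ᶜ real b
  real-+ a b = refl , sym (+-identityˡ 0#)

  real-* : ∀ a b → real (a * b) ≈ᶜ real a *ᶜ real b
  real-* = λ a b → solve 2 (λ a b → a :* b := a :* b :- :0 :* :0) refl a b ,
                   solve 2 (λ a b → :0 := a :* :0 :+ :0 :* b) refl a b

  real-cong : ∀ {a b} → a ≈ b → real a ≈ᶜ real b
  real-cong a≈b = a≈b , refl

  support : ℕ → Carrier
  support zero    = 0#
  support (suc d) = 1#

  φ ω : MatrixKind → ℕ → Carrier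
  φ 𝐀 d = 0#
  φ 𝐋 d = fromℕ d
  φ 𝐐 d = fromℕ d
  φ 𝓛 d = support d
  ω 𝐀 d = 1#
  ω 𝐋 d = 1#
  ω 𝐐 d = 1#
  ω 𝓛 d = invSqrt d

  ε : MatrixKind → Carrier
  ε 𝐀 = 1#
  ε 𝐋 = - 1#
  ε 𝐐 = 1#
  ε 𝓛 = - 1#

  supportIdentity-diag : ∀ {n} (G : Graph n) i j → supportIdentity G i j ≈ diag (λ i → support (degree G i)) i j
  supportIdentity-diag G i j with i ≟ j | degree G i
  ... | yes _ | zero  = refl
  ... | yes _ | suc _ = refl
  ... | no  _ | _     = refl

  matrix-entry : ∀ X {n} (G : Graph n) i j → matrix X G i j ≈
    diag (λ i → φ X (degree G i)) i j + ε X * (ω X (degree G i) * adjacency G i j * ω X (degree G j))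
  matrix-entry 𝐀 G i j with i ≟ j
  ... | yes _ = solve 1 (λ a → a := :0 :+ :1 :* (:1 :* a :* :1)) refl (adjacency G i j)
  ... | no  _ = solve 1 (λ a → a := :0 :+ :1 :* (:1 :* a :* :1)) refl (adjacency G i j)
  matrix-entry 𝐋 G i j = solve 2 (λ d a → d :- a := d :+ (:- :1) :* (:1 :* a :* :1)) refl _ (adjacency G i j)
  matrix-entry 𝐐 G i j = solve 2 (λ d a → d :+ a := d :+ :1 :* (:1 :* a :* :1)) refl _ (adjacency G i j)
  matrix-entry 𝓛 {n} G i j = trans
    (+-cong (supportIdentity-diag G i j) (-‿cong (trans
      (sum-diagʳ w (λ l → Matrices.sum commutativeRing λ k → diag w i k * adjacency G k l) j)
      (*-congʳ (sum-diagˡ w (λ k → adjacency G k j) i)))))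
    (solve 2 (λ d y → d :- y := d :+ (:- :1) :* y) refl _ _)
    where
    w : Vector Carrier n
    w i = invSqrt (degree G i)

  matrix-weighted : ∀ X {n} (G : Graph n) →
    (λ i j → real (matrix X G i j)) ≈ᴹ weighted (real ∘ φ X) (real ∘ ω X) (real (ε X)) G
  matrix-weighted X G i j = C.trans (real-cong (matrix-entry X G i j)) (C.trans (real-+ _ _) (C.+-cong
    real-diag
    (C.trans (real-* _ _) (C.*-congˡ {real (ε X)} (C.trans (real-* _ _) (C.*-cong
      (C.trans (real-* _ _) (C.*-congˡ {real (ω X (degree G i))} real-adjacency)) C.refl))))))
    where
    real-diag : real (diag (λ i → φ X (degree G i)) i j) ≈ᶜ
      ℂ.diag (λ i → real (φ X (degree G i))) i j
    real-diag with i ≟ j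
    ... | yes _ = C.refl
    ... | no  _ = C.refl
    real-adjacency : real (adjacency G i j) ≈ᶜ adjMatrix G i j
    real-adjacency with adj G i j
    ... | true  = C.refl
    ... | false = C.refl

  fromℕ-injective : ∀ m n → fromℕ m ≈ fromℕ n → m ≡ n
  fromℕ-injective zero    zero    e = ≡.refl
  fromℕ-injective zero    (suc n) e = ⊥-elim (fromℕ-suc≉0 n (sym e))
  fromℕ-injective (suc m) zero    e = ⊥-elim (fromℕ-suc≉0 m e)
  fromℕ-injective (suc m) (suc n) e = ≡.cong suc (fromℕ-injective m n (+-cancelˡ 1# _ _ e))

  invSqrt² : ∀ d → invSqrt (suc d) * invSqrt (suc d) * fromℕ (suc d) ≈ 1#
  invSqrt² d = begin
    s ⁻¹ * s ⁻¹ * fromℕ (suc d)  ≈⟨ *-congˡ s*s ⟨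
    s ⁻¹ * s ⁻¹ * (s * s)        ≈⟨ solve 2 (λ s t → t :* t :* (s :* s) := s :* t :* (s :* t)) refl s (s ⁻¹) ⟩
    s * s ⁻¹ * (s * s ⁻¹)        ≈⟨ *-cong s*s⁻¹ s*s⁻¹ ⟩
    1# * 1#                      ≈⟨ *-identityˡ 1# ⟩
    1#                           ∎
    where
    s : Carrier
    s = √ fromℕ (suc d)
    s*s : s * s ≈ fromℕ (suc d)
    s*s = √-square _ (fromℕ-nonneg (suc d))
    s*s⁻¹ : s * s ⁻¹ ≈ 1#
    s*s⁻¹ = *-inverseʳ s λ s≈0 → fromℕ-suc≉0 d (trans (sym s*s) (trans (*-congʳ s≈0) (zeroˡ s)))

  coefficient : MatrixKind → ℕ → Carrier
  coefficient X d = ε X * (ω X d * ω X d)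

  -- For 𝐋 and 𝐐 the diagonal is the degree; for 𝐀 the coefficient is 1, so b²r = r. For 𝓛 the
  -- diagonal separates r = 0 from r > 0, and in the latter case b²r reduces to the square of
  -- `invSqrt`, the inverse of r.
  degree-determined : ∀ X r r′ → φ X r ≈ φ X r′ →
    coefficient X r * coefficient X r * fromℕ r ≈ coefficient X r′ * coefficient X r′ * fromℕ r′ → r ≡ r′
  degree-determined 𝐀 r r′ _ e = fromℕ-injective r r′ (trans (sym (simplify r)) (trans e (simplify r′)))
    where
    simplify : ∀ d → coefficient 𝐀 d * coefficient 𝐀 d * fromℕ d ≈ fromℕ d
    simplify d = solve 1 (λ d → :1 :* (:1 :* :1) :* (:1 :* (:1 :* :1)) :* d := d) refl (fromℕ d)
  degree-determined 𝐋 r r′ e _ = fromℕ-injective r r′ e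
  degree-determined 𝐐 r r′ e _ = fromℕ-injective r r′ e
  degree-determined 𝓛 zero     zero    _ _ = ≡.refl
  degree-determined 𝓛 zero    (suc r′) e _ = ⊥-elim (0≉1 e)
  degree-determined 𝓛 (suc r)  zero    e _ = ⊥-elim (0≉1 (sym e))
  degree-determined 𝓛 (suc r) (suc r′) _ e = fromℕ-injective (suc r) (suc r′) (begin
    fromℕ (suc r)                ≈⟨ *-identityʳ _ ⟨
    fromℕ (suc r) * 1#           ≈⟨ *-congˡ (invSqrt² r′) ⟨
    fromℕ (suc r) * (t′ * fromℕ (suc r′))
      ≈⟨ *-congˡ (*-congʳ (trans (sym (simplify r)) (trans e (simplify r′)))) ⟨
    fromℕ (suc r) * (t * fromℕ (suc r′))
      ≈⟨ solve 3 (λ f t g → f :* (t :* g) := t :* f :* g) refl (fromℕ (suc r)) t (fromℕ (suc r′)) ⟩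
    t * fromℕ (suc r) * fromℕ (suc r′)
      ≈⟨ *-congʳ (invSqrt² r) ⟩
    1# * fromℕ (suc r′)          ≈⟨ *-identityˡ _ ⟩
    fromℕ (suc r′)               ∎)
    where
    t t′ : Carrier
    t  = invSqrt (suc r) * invSqrt (suc r)
    t′ = invSqrt (suc r′) * invSqrt (suc r′)
    simplify : ∀ d → let t = invSqrt (suc d) * invSqrt (suc d) in
      coefficient 𝓛 (suc d) * coefficient 𝓛 (suc d) * fromℕ (suc d) ≈ t
    simplify d = trans
      (solve 2 (λ w f → (:- :1) :* (w :* w) :* ((:- :1) :* (w :* w)) :* f := w :* w :* (w :* w :* f))
        refl (invSqrt (suc d)) (fromℕ (suc d)))
      (trans (*-congˡ (invSqrt² d)) (*-identityʳ _))

  coefficient≉0 : ∀ X r → ¬ coefficient X r ≈ 0# ⊎ r ≡ 0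
  coefficient≉0 𝐀 r = inj₁ λ e → 0≉1 (trans (sym e) (solve 0 (:1 :* (:1 :* :1) := :1) refl))
  coefficient≉0 𝐋 r = inj₁ λ e → 0≉1 (trans (trans (sym -0#≈0#) (-‿cong (sym e)))
    (solve 0 (:- ((:- :1) :* (:1 :* :1)) := :1) refl))
  coefficient≉0 𝐐 r = inj₁ λ e → 0≉1 (trans (sym e) (solve 0 (:1 :* (:1 :* :1) := :1) refl))
  coefficient≉0 𝓛 zero    = inj₂ ≡.refl
  coefficient≉0 𝓛 (suc r) = inj₁ λ e → 0≉1 (begin
    0#                                              ≈⟨ zeroˡ _ ⟨
    0# * - fromℕ (suc r)                            ≈⟨ *-congʳ e ⟨
    coefficient 𝓛 (suc r) * - fromℕ (suc r)
      ≈⟨ solve 2 (λ w f → (:- :1) :* (w :* w) :* (:- f) := w :* w :* f) refl (invSqrt (suc r)) (fromℕ (suc r)) ⟩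
    invSqrt (suc r) * invSqrt (suc r) * fromℕ (suc r) ≈⟨ invSqrt² r ⟩
    1#                                              ∎)

  real-coefficient : ∀ X d → real (coefficient X d) ≈ᶜ real (ε X) *ᶜ (real (ω X d) *ᶜ real (ω X d))
  real-coefficient X d = C.trans (real-* (ε X) _) (C.*-congˡ {real (ε X)} (real-* (ω X d) (ω X d)))

  real-squares : ∀ X d → let b = real (ε X) *ᶜ (real (ω X d) *ᶜ real (ω X d)) in
    real (coefficient X d * coefficient X d * fromℕ d) ≈ᶜ b *ᶜ b *ᶜ ℂ.fromℕ d
  real-squares X d = C.trans (real-* _ (fromℕ d)) (C.*-cong
    (C.trans (real-* _ _) (C.*-cong (real-coefficient X d) (real-coefficient X d)))
    (C.sym (real-fromℕ d)))

  -- Cospectrality in terms of characteristic polynomials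

  weightedMatrix : MatrixKind → ∀ {n} → Graph n → ℂ.Matrix n
  weightedMatrix X = weighted (real ∘ φ X) (real ∘ ω X) (real (ε X))

  WeightedSpectra : MatrixKind → ∀ {n m} → Graph n → Graph m → Set (c ⊔ ℓ₁)
  WeightedSpectra X G H = CharPoly≈ (weightedMatrix X G) (weightedMatrix X H)

  cospectral⇒charPoly : ∀ X {n m} (G : Graph n) (H : Graph m) → Cospectral X G H → WeightedSpectra X G H
  cospectral⇒charPoly X G H (λs , specG , specH) x = C.trans
    (C.sym (charPoly-cong (matrix-weighted X G) x))
    (C.trans (C.trans (specG x) (C.sym (specH x))) (charPoly-cong (matrix-weighted X H) x))

  -- The common list of eigenvalues has to be produced, and algebraic closedness provides it by
  -- splitting one of the two equal characteristic polynomials.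
  charPoly⇒cospectral : ∀ X {n m} (G : Graph n) (H : Graph m) → WeightedSpectra X G H → Cospectral X G H
  charPoly⇒cospectral X G H G≈H with factorisation (charPoly-lead (λ i j → real (matrix X G i j)))
  ... | λs , spec = λs , spec , λ x → C.trans (charPoly-cong (matrix-weighted X H) x)
    (C.trans (C.sym (G≈H x)) (C.trans (C.sym (charPoly-cong (matrix-weighted X G) x)) (spec x)))

  -- An inductive family, so that matching identifies the two sizes and supplies one common degree;
  -- the join computations compare graphs on the same `Fin n`.
  data SameSpectrum : ∀ {n m} → Graph n → Graph m → Set (c ⊔ ℓ₁) where
    sameSpectrum : ∀ {n r} {G H : Graph n} → (∀ i → degree G i ≡ r) → (∀ i → degree H i ≡ r) →
      CharPoly≈ (adjMatrix G) (adjMatrix H) → SameSpectrum G H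

  regularCospectral⇒size : ∀ {n m} (G : Graph n) (H : Graph m) → RegularCospectral G H → n ≡ m
  regularCospectral⇒size G H (_ , _ , X , cosp) =
    size-unique (weightedMatrix X G) (weightedMatrix X H) (cospectral⇒charPoly X G H cosp)

  complexCoefficient : MatrixKind → ℕ → ℂ.Carrier
  complexCoefficient X d = real (ε X) *ᶜ (real (ω X d) *ᶜ real (ω X d))

  -- The trace identity holds in ℂ, whereas degrees are recovered in the real field. All quantities
  -- are images of reals, so the first components suffice.
  reflect-squares : ∀ X r r′ →
    complexCoefficient X r *ᶜ complexCoefficient X r *ᶜ ℂ.fromℕ r ≈ᶜ
      complexCoefficient X r′ *ᶜ complexCoefficient X r′ *ᶜ ℂ.fromℕ r′ →
    coefficient X r * coefficient X r * fromℕ r ≈ coefficient X r′ * coefficient X r′ * fromℕ r′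
  reflect-squares X r r′ e = trans (proj₁ (real-squares X r)) (trans (proj₁ e) (sym (proj₁ (real-squares X r′))))

  -- A vertex is required: every number counts as the degree of the empty graph, and the traces
  -- carry the factor n that has to be cancelled.
  regularCospectral⇒degree : ∀ X {n r r′} .{{_ : NonZero n}} (G H : Graph n) →
    (∀ i → degree G i ≡ r) → (∀ i → degree H i ≡ r′) → WeightedSpectra X G H → r ≡ r′
  regularCospectral⇒degree X {r = r} {r′} G H regG regH G≈H = degree-determined X r r′
    (proj₁ (regular-diagonal G H regG regH (real ∘ φ X) (real ∘ ω X) (real (ε X)) G≈H))
    (reflect-squares X r r′
      (regular-squares G H regG regH (real ∘ φ X) (real ∘ ω X) (real (ε X)) G≈H))

  complexCoefficient≉0 : ∀ X r → ¬ complexCoefficient X r ≈ᶜ C.0# ⊎ r ≡ 0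
  complexCoefficient≉0 X r = Sum.map₁
    (λ b≉0 e → b≉0 (trans (proj₁ (real-coefficient X r)) (proj₁ e))) (coefficient≉0 X r)

  regularCospectral⇒sameSpectrum : ∀ {n m} .{{_ : NonZero n}} (G : Graph n) (H : Graph m) →
    RegularCospectral G H → SameSpectrum G H
  regularCospectral⇒sameSpectrum G H G~H@((_ , regG) , (_ , regH) , X , cosp) =
    sameSize (regularCospectral⇒size G H G~H) G H regG regH (cospectral⇒charPoly X G H cosp)
    where
    sameDegree : ∀ {n r r′} → r ≡ r′ → (G H : Graph n) → (∀ i → degree G i ≡ r) → (∀ i → degree H i ≡ r′) →
      WeightedSpectra X G H → SameSpectrum G H
    sameDegree {r = r} ≡.refl G H regG regH G≈H = sameSpectrum regG regH
      (adjMatrix-≈ G H regG regH (real ∘ φ X) (real ∘ ω X) (real (ε X)) (complexCoefficient≉0 X r) G≈H)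
    sameSize : ∀ {n m r r′} .{{_ : NonZero n}} → n ≡ m → (G : Graph n) (H : Graph m) →
      (∀ i → degree G i ≡ r) → (∀ i → degree H i ≡ r′) → WeightedSpectra X G H → SameSpectrum G H
    sameSize ≡.refl G H regG regH G≈H =
      sameDegree (regularCospectral⇒degree X G H regG regH G≈H) G H regG regH G≈H

  nonRegularNICS : ∀ {n₁ n₂ m₁ m₂} .{{_ : NonZero n₁}} .{{_ : NonZero n₂}}
    {G₁ : Graph n₁} {G₂ : Graph n₂} {H₁ : Graph m₁} {H₂ : Graph m₂} →
    SameSpectrum G₁ H₁ → ¬ G₂ ≅ H₂ → SameSpectrum G₂ H₂ →
    ¬ Regular (G₁ ∨₌ G₂) × ¬ Regular (H₁ ∨₌ H₂) ×
    NICS (𝐀 ∷ 𝐋 ∷ 𝐐 ∷ 𝓛 ∷ []) (G₁ ∨₌ G₂) (H₁ ∨₌ H₂)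
  nonRegularNICS {G₁ = G₁} {G₂} {H₁} {H₂}
    (sameSpectrum regG₁ regH₁ G₁≈H₁) G₂≇H₂ (sameSpectrum regG₂ regH₂ G₂≈H₂) =
    RegularJoin.not-regular G₁ G₂ regG₁ regG₂ ,
    RegularJoin.not-regular H₁ H₂ regH₁ regH₂ ,
    (λ iso → G₂≇H₂ (∨₌-reflects-≅ G₁ H₁ G₂ H₂ regG₁ regH₁ regG₂ regH₂ iso)) ,
    λ X _ → charPoly⇒cospectral X (G₁ ∨₌ G₂) (H₁ ∨₌ H₂)
      (charPoly-∨₌ G₁ H₁ G₂ H₂ regG₁ regH₁ regG₂ regH₂ G₁≈H₁ G₂≈H₂
        (real ∘ φ X) (real ∘ ω X) (real (ε X)))

empty-≅ : ∀ {m} → 0 ≡ m → (G : Graph 0) (H : Graph m) → G ≅ H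
empty-≅ ≡.refl G H = ↔-id _ , λ ()

-- `n₁` is nonzero because the join with an empty first graph is the second graph itself, which is
-- regular. For `n₂` the same follows from non-isomorphism.
corollary6p5 : ∀ {c ℓ₁ ℓ₂} (R : RealClosedField c ℓ₁ ℓ₂) →
    let open Spectral R in
    ∀ (n₁ n₂ m₁ m₂ : ℕ) .{{_ : NonZero n₁}}
    (G₁ : Graph n₁) (G₂ : Graph n₂) (H₁ : Graph m₁) (H₂ : Graph m₂) →
    RegularCospectral G₁ H₁ →
    ¬ G₂ ≅ H₂ →
    RegularCospectral G₂ H₂ →
    ¬ Regular (G₁ ∨₌ G₂) ×
    ¬ Regular (H₁ ∨₌ H₂) ×
    NICS (𝐀 ∷ 𝐋 ∷ 𝐐 ∷ 𝓛 ∷ []) (G₁ ∨₌ G₂) (H₁ ∨₌ H₂)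
-- Cospectral graphs have equally many vertices, so `H₂` is empty too, hence isomorphic to `G₂`.
corollary6p5 R n₁ zero m₁ m₂ G₁ G₂ H₁ H₂ G₁~H₁ G₂≇H₂ G₂~H₂ =
  ⊥-elim (G₂≇H₂ (empty-≅ (GraphSpectra.regularCospectral⇒size R G₂ H₂ G₂~H₂) G₂ H₂))
corollary6p5 R n₁ (suc _) m₁ m₂ G₁ G₂ H₁ H₂ G₁~H₁ G₂≇H₂ G₂~H₂ =
  nonRegularNICS (regularCospectral⇒sameSpectrum G₁ H₁ G₁~H₁) G₂≇H₂
                 (regularCospectral⇒sameSpectrum G₂ H₂ G₂~H₂)
  where open GraphSpectra R
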